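{- Let $p$ be a prime, $p>3$, and let $c\in D_p$ with $c^2\not\equiv -3\pmod p$. Then \[ \sum_{k=0}^{p-1}\binom{3k}{k}\left(\frac{4}{9(c^2+3)}\right)^k\equiv \begin{cases} 1 \pmod{p}, & c\in C_0(p);\\ -\frac{1+c}{2c} \pmod{p}, & c\in C_1(p);\\ \frac{1-c}{2c} \pmod{p}, & c\in C_2(p), \end{cases} \qquad \sum_{k=0}^{p-1}C_k^{(2)}\left(\frac{4c^2}{27(c^2+3)}\right)^k\equiv \begin{cases} 1 \pmod{p}, & c\in C_0(p);\\ -\frac{9+c}{2c} \pmod{p}, & c\in C_1(p);\\ \frac{9-c}{2c} \pmod{p}, & c\in C_2(p). \end{cases} \]
   Context: $C_n^{(2)}=\frac{1}{2n+1}\binom{3n}{n}$. $D_p$ is the set of rationals whose denominator is not divisible by $p$. Let $\omega=e^{2\pi i/3}$ and $\mathbb{Z}[\omega]$ the Eisenstein integers, with norm $N(a+b\omega)=a^2-ab+b^2$. For a prime $\pi$ of $\mathbb{Z}[\omega]$ with $N(\pi)\neq 3$ and $\alpha\in\mathbb{Z}[\omega]$, $\left(\frac{\alpha}{\pi}\right)_3$ is $0$ if $\pi\mid\alpha$, and otherwise the unique $\omega^j$ with $\alpha^{(N(\pi)-1)/3}\equiv\omega^j\pmod{\pi}$. For a rational prime $p\equiv 2\pmod 3$, $p$ is prime in $\mathbb{Z}[\omega]$ and $\left(\frac{\alpha}{p}\right)_3$ is this character; for $p\equiv 1\pmod 3$, write $p=\pi\bar\pi$ with $\pi\equiv 2\pmod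 3$ and set $\left(\frac{\alpha}{p}\right)_3=\left(\frac{\alpha}{\pi}\right)_3\left(\frac{\alpha}{\bar\pi}\right)_3$. Elements of $D_p$ are reduced modulo these primes naturally. For $j\in\{0,1,2\}$, $C_j(p)=\{c\in D_p : \left(\frac{c+1+2\omega}{p}\right)_3=\omega^j\}$.
   Formalization: The hypothesis c ≢ 0 (mod p) is added: the right-hand sides contain 1/(2c), and the claim fails for c = 0, p = 5, where c ∈ C_0(5) but the first sum is ≡ 4, not 1, mod 5. -}

module Defs where

open import Data.Nat as ℕ using (ℕ; zero; suc)
open import Data.Nat.DivMod using (_/_; _%_)
open import Data.Nat.Divisibility using (_∣_)
open import Data.Nat.Combinatorics using (_C_)
open import Data.Integer as ℤ using (ℤ; +_; +[1+_]; -[1+_])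
open import Data.Rational as ℚ using (ℚ; mkℚ; ↥_; ↧ₙ_; 0ℚ; 1ℚ)
open import Data.Product using (Σ; ∃; _×_; _,_)
open import Data.Sum using (_⊎_)
open import Relation.Nullary using (¬_)
open import Relation.Binary.PropositionalEquality using (_≡_)

-- total inverse on ℚ (inv 0 = 0); only ever applied to nonzero arguments
inv : ℚ → ℚ
inv q@(mkℚ (+ zero) _ _)   = 0ℚ
inv q@(mkℚ +[1+ n ] _ _)   = ℚ.1/ q
inv q@(mkℚ -[1+ n ] _ _)   = ℚ.1/ q

_^Q_ : ℚ → ℕ → ℚ
q ^Q zero  = 1ℚ
q ^Q suc n = q ℚ.* (q ^Q n)

fromℕ : ℕ → ℚ
fromℕ n = (+ n) ℚ./ 1

fromℤ : ℤ → ℚ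
fromℤ z = z ℚ./ 1

InD : ℕ → ℚ → Set
InD p q = ¬ (p ∣ ↧ₙ q)

_≡[mod_]_ : ℚ → ℕ → ℚ → Set
a ≡[mod p ] b = p ∣ ℤ.∣ ↥ (a ℚ.- b) ∣

sumQ : ℕ → (ℕ → ℚ) → ℚ
sumQ zero    f = 0ℚ
sumQ (suc n) f = sumQ n f ℚ.+ f n

C2 : ℕ → ℚ
C2 n = (+ ((3 ℕ.* n) C n)) ℚ./ suc (2 ℕ.* n)

-- Eisenstein integers a + b ω,  ω² = -1 - ω

record ℤω : Set where
  constructor _+_ω
  field
    re : ℤ
    im : ℤ
open ℤω public

infixl 7 _*ω_
infixl 6 _+ω_ _-ω_

_+ω_ : ℤω → ℤω → ℤω
(a + b ω) +ω (c + d ω) = (a ℤ.+ c) + (b ℤ.+ d) ω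

_-ω_ : ℤω → ℤω → ℤω
(a + b ω) -ω (c + d ω) = (a ℤ.- c) + (b ℤ.- d) ω

_*ω_ : ℤω → ℤω → ℤω
(a + b ω) *ω (c + d ω) =
  (a ℤ.* c ℤ.- b ℤ.* d) + (a ℤ.* d ℤ.+ b ℤ.* c ℤ.- b ℤ.* d) ω

ι : ℤ → ℤω
ι z = z + (+ 0) ω

ωE : ℤω
ωE = (+ 0) + (+ 1) ω

_^ω_ : ℤω → ℕ → ℤω
x ^ω zero  = ι (+ 1)
x ^ω suc n = x *ω (x ^ω n)

-- complex conjugate: conj (a + bω) = a + bω² = (a - b) - bω
conj : ℤω → ℤω
conj (a + b ω) = (a ℤ.- b) + (ℤ.- b) ω

N : ℤω → ℤ
N (a + b ω) = a ℤ.* a ℤ.- a ℤ.* b ℤ.+ b ℤ.* b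

_∣ω_ : ℤω → ℤω → Set
π ∣ω x = ∃ λ y → π *ω y ≡ x

_≡ω_[mod_] : ℤω → ℤω → ℤω → Set
x ≡ω y [mod π ] = π ∣ω (x -ω y)

-- Cubic residue character of  c + 1 + 2ω  for c ∈ D_p.
-- Write c = u / v (reduced, p ∤ v). In the residue field ℤ[ω]/π,
-- c + 1 + 2ω = (u + v + 2vω) · v⁻¹, so
--   ((c + 1 + 2ω)/π)₃ = ω^j   iff   (u + v + 2vω)^e ≡ ω^j · v^e (mod π),
-- with e = (N(π) - 1)/3.  (The right-hand side is a unit mod π, so this
-- forces π ∤ c + 1 + 2ω, i.e. the symbol is nonzero.)

lift : ℚ → ℤω
lift c = (↥ c ℤ.+ + (↧ₙ c)) + (+ 2 ℤ.* + (↧ₙ c)) ω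

CharIs : ℤω → ℚ → ℕ → Set
CharIs π c j =
  let e = (ℤ.∣ N π ∣ ℕ.∸ 1) / 3 in
  (lift c ^ω e) ≡ω ((ωE ^ω j) *ω (ι (+ (↧ₙ c)) ^ω e)) [mod π ]

Primary : ℤω → Set
Primary π = ι (+ 3) ∣ω (π -ω ι (+ 2))

-- ((c + 1 + 2ω)/p)₃ = ω^j  for a rational prime p ≠ 3
Cubic3 : ℕ → ℚ → ℕ → Set
Cubic3 p c j =
    (p % 3 ≡ 2 × CharIs (ι (+ p)) c j)
  ⊎ (p % 3 ≡ 1 × Σ ℤω λ π → Σ ℕ λ a → Σ ℕ λ b →
       Primary π × π *ω conj π ≡ ι (+ p)
       × CharIs π c a × CharIs (conj π) c b × (a ℕ.+ b) % 3 ≡ j % 3)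

Cset : ℕ → ℕ → ℚ → Set
Cset j p c = InD p c × Cubic3 p c j

{-# OPTIONS --safe #-}
module Submission where

-- The binomial coefficient (3k choose k-m) is a coefficient of (1+z)^{3k}, so the sums
-- g(m) = Σ_{k<p} (3k choose k-m) x^k are, modulo p, coefficients of a geometric series and hence
-- satisfy the linear recurrence with characteristic equation (1+ρ)³ = ρ²/x.  Its roots are
-- ρ = q²/x - 1, where q³ - q² + x = 0.  For x = 4/(9(c²+3)) this cubic is solved by radicals:
-- q = (1+M)/3 with M = μ + μ⁻¹ and μ³ = (c+√-3)/(c-√-3); for x = 4c²/(27(c²+3)) one replaces M by -M.
-- The hypothesis c ∈ C_j(p) says exactly that the Frobenius map sends M = μ + μ⁻¹ to ω^j μ + ω^{-j} μ⁻¹,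
-- i.e. it shifts the three roots cyclically by j.  Expressing ρ^{p+1} = ρ · ρ^p through g(0), g(1), g(2)
-- by the recurrence and solving the resulting linear system over the three roots (Cramer's rule)
-- gives g(0) and g(1); the second sum is g(0) - 2 g(1).

open import Defs
open import Level using (0ℓ)
open import Function using (id)
open import Algebra.Bundles using (CommutativeRing)
import Algebra.Properties.CommutativeSemiring.Binomial
import Algebra.Properties.CommutativeSemiring.Exp
import Algebra.Properties.Semiring.Mult
import Algebra.Properties.Semiring.Sum
import Algebra.Solver.Ring
open import Algebra.Solver.Ring.AlmostCommutativeRing using (fromCommutativeRing; _-Raw-AlmostCommutative⟶_)
open import Data.Fin as Fin using (Fin; toℕ; inject₁)
import Data.Fin.Properties as Fin
open import Data.Integer as ℤ using (ℤ; +_; +[1+_]; -[1+_]; ∣_∣)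
import Data.Integer.Properties as ℤ
import Data.Integer.Tactic.RingSolver as ℤ-Tactic
open import Data.Maybe.Base using (Maybe; just; nothing)
open import Data.Nat as ℕ using (ℕ; zero; suc; _<_; s≤s; z≤n)
import Data.Nat.Properties as ℕ
open import Data.Nat.Combinatorics using (_C_; nCk+nC[k+1]≡[n+1]C[k+1]; k>n⇒nCk≡0; nC1≡n; nCn≡1; nCk≡nC[n∸k])
open import Data.Nat.Coprimality using (Coprime; coprime-Bézout)
open import Data.Nat.Divisibility using (_∣_; _∣0; _∣?_; divides; ∣-refl; ∣1⇒≡1; ∣m+n∣m⇒∣n; ∣m⇒∣m*n; n∣m*n; >⇒∤)
open import Data.Nat.DivMod using (_/_; _%_; m≡m%n+[m/n]*n; m*n/n≡m)
open import Data.Nat.GCD using (module Bézout)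
open import Data.Nat.Primality using (Prime; euclidsLemma; prime⇒irreducible; ¬prime[1])
import Data.Nat.Tactic.RingSolver as ℕ-Tactic
open import Data.Product using (_×_; _,_; ∃; proj₁; proj₂)
open import Data.Rational as ℚ using (ℚ; mkℚ; ↥_; ↧_; ↧ₙ_; 0ℚ; 1ℚ; toℚᵘ)
import Data.Rational.Properties as ℚ
open import Data.Rational.Unnormalised using (mkℚᵘ; *≡*)
import Data.Rational.Unnormalised.Properties as ℚᵘ
open import Data.Sum using (_⊎_; inj₁; inj₂; [_,_])
open import Relation.Nullary using (¬_; yes; no; contradiction)
open import Relation.Binary.PropositionalEquality as ≡ using (_≡_; cong; cong₂; subst; subst₂; module ≡-Reasoning)
import Relation.Binary.Reasoning.Setoid

-- Neither ℤ[ω]/p nor the ring obtained from it by adjoining μ is known to be a field: p may split,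
-- and μ³ may already be a cube. In these rings no factorisation is inferred from roots and nothing
-- is cancelled that has no explicit inverse. The three roots are therefore given through Vieta's
-- formulas, and the determinant of the linear system is evaluated in closed form: after scaling by
-- 27x it is -81c for the first sum and 243/c for the second, hence a unit. All inverses are
-- integers carried along: `a` = 1/x, `w` = 1/(c²+3), `t` = 1/3, `i` = 1/(2c), each modulo p.
-- Working modulo p instead of modulo π makes the descent easy, since a congruence between integers
-- can be read off from the coordinate of 1. The price is that for p = π · conj π the two cubic
-- characters have to be glued into one congruence modulo p beforehand. The structure map `η` lets
-- one ring solver with integer coefficients serve all these rings and ℚ; numerals are written
-- `η (+ n)` because this is the form in which the solver produces them.

record ℤAlgebra : Set₁ where
  field
    commRing : CommutativeRing 0ℓ 0ℓ
  open CommutativeRing commRing public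
  field
    η   : ℤ → Carrier
    η-+ : ∀ m n → η (m ℤ.+ n) ≈ η m + η n
    η-* : ∀ m n → η (m ℤ.* n) ≈ η m * η n
    η-neg : ∀ m → η (ℤ.- m) ≈ - η m
    η-0 : η (+ 0) ≈ 0#
    η-1 : η (+ 1) ≈ 1#

module AlgebraSolver (K : ℤAlgebra) where
  open ℤAlgebra K

  η-morphism : CommutativeRing.rawRing ℤ.+-*-commutativeRing -Raw-AlmostCommutative⟶ fromCommutativeRing commRing
  η-morphism = record
    { ⟦_⟧ = η ; +-homo = η-+ ; *-homo = η-* ; -‿homo = η-neg ; 0-homo = η-0 ; 1-homo = η-1 }

  -- Coefficients are compared as integers only, so each solver identity is an identity of
  -- polynomials over ℤ; characteristic p enters through hypotheses such as `ηp≈0`.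
  η-≟ : ∀ m n → Maybe (η m ≈ η n)
  η-≟ m n with m ℤ.≟ n
  ... | yes ≡.refl = just refl
  ... | no  _      = nothing

  open Algebra.Solver.Ring (CommutativeRing.rawRing ℤ.+-*-commutativeRing) (fromCommutativeRing commRing) η-morphism η-≟ public
    using (solve; _:=_; _:+_; _:*_; _:-_; :-_; con; _:^_)

  -- Equalities that follow from hypotheses are obtained from a ring identity exhibiting
  -- the difference of the two sides as a linear combination of the hypotheses.
  lincomb₁ : ∀ {X Y A B} u → X ≈ Y + u * (A - B) → A ≈ B → X ≈ Y
  lincomb₁ {X} {Y} {A} {B} u eq h = trans eq (trans (+-congˡ (trans (*-congˡ (trans (+-congʳ h) (-‿inverseʳ B))) (zeroʳ u)))
      (+-identityʳ Y))

  lincomb₂ : ∀ {X Y A B C D} u v → X ≈ Y + u * (A - B) + v * (C - D) → A ≈ B → C ≈ D → X ≈ Y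
  lincomb₂ u v eq h k = lincomb₁ u (lincomb₁ v eq k) h

  lincomb₃ : ∀ {X Y A B C D E F} u v w → X ≈ Y + u * (A - B) + v * (C - D) + w * (E - F) → A ≈ B → C ≈ D → E ≈ F → X ≈ Y
  lincomb₃ u v w eq h k l = lincomb₂ u v (lincomb₁ w eq l) h k

-- Binomial coefficients and the auxiliary sums

C-absorption : ∀ n k → suc k ℕ.* (suc n C suc k) ≡ suc n ℕ.* (n C k)
C-absorption zero    zero    = ≡.refl
C-absorption zero    (suc k) = ≡.trans (cong (suc (suc k) ℕ.*_) (k>n⇒nCk≡0 {1} {suc (suc k)} (s≤s (s≤s z≤n)))) (ℕ.*-zeroʳ (suc (suc k)))
C-absorption (suc n) zero    = ≡.trans (cong (1 ℕ.*_) (nC1≡n (suc (suc n)))) (ℕ.*-comm 1 (suc (suc n)))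
C-absorption (suc n) (suc k) = begin
  suc (suc k) ℕ.* (suc (suc n) C suc (suc k))
    ≡⟨ cong (suc (suc k) ℕ.*_) (≡.sym (nCk+nC[k+1]≡[n+1]C[k+1] (suc n) (suc k))) ⟩
  suc (suc k) ℕ.* (X ℕ.+ (suc n C suc (suc k)))
    ≡⟨ lemma₁ k X (suc n C suc (suc k)) ⟩
  suc k ℕ.* X ℕ.+ X ℕ.+ suc (suc k) ℕ.* (suc n C suc (suc k))
    ≡⟨ cong₂ (λ u v → u ℕ.+ X ℕ.+ v) (C-absorption n k) (C-absorption n (suc k)) ⟩
  suc n ℕ.* (n C k) ℕ.+ X ℕ.+ suc n ℕ.* (n C suc k)
    ≡⟨ lemma₂ n (n C k) (n C suc k) X ⟩
  X ℕ.+ suc n ℕ.* (n C k ℕ.+ n C suc k)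
    ≡⟨ cong (λ u → X ℕ.+ suc n ℕ.* u) (nCk+nC[k+1]≡[n+1]C[k+1] n k) ⟩
  suc (suc n) ℕ.* X ∎
  where
  open ≡-Reasoning
  X = suc n C suc k
  lemma₁ : ∀ k a b → suc (suc k) ℕ.* (a ℕ.+ b) ≡ suc k ℕ.* a ℕ.+ a ℕ.+ suc (suc k) ℕ.* b
  lemma₁ = ℕ-Tactic.solve-∀
  lemma₂ : ∀ n a b x → suc n ℕ.* a ℕ.+ x ℕ.+ suc n ℕ.* b ≡ x ℕ.+ suc n ℕ.* (a ℕ.+ b)
  lemma₂ = ℕ-Tactic.solve-∀

-- The ratio of neighbouring binomials, (k+1) C(n,k+1) = (n-k) C(n,k), rearranged to avoid
-- subtraction. It is what evaluates `C2`.
C-neighbours : ∀ n k → k ℕ.* (n C k) ℕ.+ suc k ℕ.* (n C suc k) ≡ n ℕ.* (n C k)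
C-neighbours n k = ℕ.+-cancelˡ-≡ (n C k) _ _ (begin
  n C k ℕ.+ (k ℕ.* (n C k) ℕ.+ suc k ℕ.* (n C suc k)) ≡⟨ lemma k (n C k) (n C suc k) ⟩
  suc k ℕ.* (n C k ℕ.+ n C suc k) ≡⟨ cong (suc k ℕ.*_) (nCk+nC[k+1]≡[n+1]C[k+1] n k) ⟩
  suc k ℕ.* (suc n C suc k) ≡⟨ C-absorption n k ⟩
  suc n ℕ.* (n C k) ∎)
  where
  open ≡-Reasoning
  lemma : ∀ k a b → a ℕ.+ (k ℕ.* a ℕ.+ suc k ℕ.* b) ≡ suc k ℕ.* (a ℕ.+ b)
  lemma = ℕ-Tactic.solve-∀

-- By absorption k · C(n,k) = n · C(n-1,k-1) is divisible by p, and Euclid's lemma leaves only the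
-- binomial.
prime∣C : ∀ {p} → Prime p → ∀ n k → p ∣ n → ¬ (p ∣ k) → p ∣ (n C k)
prime∣C {p} pr n       zero    _   p∤k = contradiction (p ∣0) p∤k
prime∣C {p} pr zero    (suc k) _   p∤k = p ∣0
prime∣C {p} pr (suc n) (suc k) p∣n p∤k
  with euclidsLemma (suc k) (suc n C suc k) pr (subst (p ∣_) (≡.sym (C-absorption n k)) (∣m⇒∣m*n (n C k) p∣n))
... | inj₁ p∣k = contradiction p∣k p∤k
... | inj₂ p∣C = p∣C

-- Comparison of coefficients in (1+z)^(n+3) = (1+z)³ (1+z)^n; the cube in the characteristic
-- equation originates here.
C-pascal³ : ∀ n k → (3 ℕ.+ n) C (3 ℕ.+ k) ≡ n C (3 ℕ.+ k) ℕ.+ 3 ℕ.* (n C (2 ℕ.+ k)) ℕ.+ 3 ℕ.* (n C (1 ℕ.+ k)) ℕ.+ n C k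
C-pascal³ n k = begin
  (3 ℕ.+ n) C (3 ℕ.+ k) ≡⟨ P (2 ℕ.+ n) (2 ℕ.+ k) ⟨
  (2 ℕ.+ n) C (2 ℕ.+ k) ℕ.+ (2 ℕ.+ n) C (3 ℕ.+ k)
    ≡⟨ cong₂ ℕ._+_ (P (1 ℕ.+ n) (1 ℕ.+ k)) (P (1 ℕ.+ n) (2 ℕ.+ k)) ⟨
  ((1 ℕ.+ n) C (1 ℕ.+ k) ℕ.+ (1 ℕ.+ n) C (2 ℕ.+ k)) ℕ.+ ((1 ℕ.+ n) C (2 ℕ.+ k) ℕ.+ (1 ℕ.+ n) C (3 ℕ.+ k))
    ≡⟨ cong₂ ℕ._+_ (cong₂ ℕ._+_ (P n k) (P n (1 ℕ.+ k))) (cong₂ ℕ._+_ (P n (1 ℕ.+ k)) (P n (2 ℕ.+ k))) ⟨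
  ((n C k ℕ.+ n C (1 ℕ.+ k)) ℕ.+ (n C (1 ℕ.+ k) ℕ.+ n C (2 ℕ.+ k))) ℕ.+ ((n C (1 ℕ.+ k) ℕ.+ n C (2 ℕ.+ k)) ℕ.+
      (n C (2 ℕ.+ k) ℕ.+ n C (3 ℕ.+ k)))
    ≡⟨ lemma (n C k) (n C (1 ℕ.+ k)) (n C (2 ℕ.+ k)) (n C (3 ℕ.+ k)) ⟩
  n C (3 ℕ.+ k) ℕ.+ 3 ℕ.* (n C (2 ℕ.+ k)) ℕ.+ 3 ℕ.* (n C (1 ℕ.+ k)) ℕ.+ n C k ∎
  where
  open ≡-Reasoning
  P = nCk+nC[k+1]≡[n+1]C[k+1]
  lemma : ∀ a b c d → ((a ℕ.+ b) ℕ.+ (b ℕ.+ c)) ℕ.+ ((b ℕ.+ c) ℕ.+ (c ℕ.+ d)) ≡ d ℕ.+ 3 ℕ.* c ℕ.+ 3 ℕ.* b ℕ.+ a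
  lemma = ℕ-Tactic.solve-∀

term : ℤ → ℕ → ℕ → ℤ
term x m k = x ℤ.^ k ℤ.* + ((3 ℕ.* k) C (2 ℕ.* k ℕ.+ m))

-- The coefficient of z^{n-1-m} in Σ_{k<n} x^k (1+z)^{3k} z^{n-1-k}; the binomials are written
-- (3k choose 2k+m) instead of (3k choose k-m) to avoid truncated subtraction.
g : ℤ → ℕ → ℕ → ℤ
g x zero    m = + 0
g x (suc n) m = g x n m ℤ.+ term x m n

-- Passing from k to k+1 multiplies x^k (1+z)^(3k) by x (1+z)³, while the part 2k of the lower index
-- grows by 2.
term-suc : ∀ x m k → term x (suc m) (suc k) ≡
  x ℤ.* (term x (3 ℕ.+ m) k ℤ.+ + 3 ℤ.* term x (2 ℕ.+ m) k ℤ.+ + 3 ℤ.* term x (1 ℕ.+ m) k ℤ.+ term x m k)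
term-suc x m k = ≡.trans (cong (λ b → x ℤ.* y ℤ.* + b) eq) (≡.trans (cong (x ℤ.* y ℤ.*_) push) (lemma x y (+ A) (+ B) (+ D) (+ E)))
  where
  y = x ℤ.^ k
  A = (3 ℕ.* k) C (2 ℕ.* k ℕ.+ (3 ℕ.+ m))
  B = (3 ℕ.* k) C (2 ℕ.* k ℕ.+ (2 ℕ.+ m))
  D = (3 ℕ.* k) C (2 ℕ.* k ℕ.+ (1 ℕ.+ m))
  E = (3 ℕ.* k) C (2 ℕ.* k ℕ.+ m)
  i₁ : ∀ k → 3 ℕ.* suc k ≡ 3 ℕ.+ 3 ℕ.* k
  i₁ = ℕ-Tactic.solve-∀
  i₂ : ∀ k m → 2 ℕ.* suc k ℕ.+ suc m ≡ 3 ℕ.+ (2 ℕ.* k ℕ.+ m)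
  i₂ = ℕ-Tactic.solve-∀
  i₃ : ∀ j k m → j ℕ.+ (2 ℕ.* k ℕ.+ m) ≡ 2 ℕ.* k ℕ.+ (j ℕ.+ m)
  i₃ = ℕ-Tactic.solve-∀
  eq : (3 ℕ.* suc k) C (2 ℕ.* suc k ℕ.+ suc m) ≡ A ℕ.+ 3 ℕ.* B ℕ.+ 3 ℕ.* D ℕ.+ E
  r : ∀ j → (3 ℕ.* k) C (j ℕ.+ (2 ℕ.* k ℕ.+ m)) ≡ (3 ℕ.* k) C (2 ℕ.* k ℕ.+ (j ℕ.+ m))
  r j = cong ((3 ℕ.* k) C_) (i₃ j k m)
  eq = ≡.trans (cong₂ _C_ (i₁ k) (i₂ k m)) (≡.trans (C-pascal³ (3 ℕ.* k) (2 ℕ.* k ℕ.+ m))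
    (cong (ℕ._+ E) (cong₂ ℕ._+_ (cong₂ ℕ._+_ (r 3) (cong (3 ℕ.*_) (r 2))) (cong (3 ℕ.*_) (r 1)))))
  push : + (A ℕ.+ 3 ℕ.* B ℕ.+ 3 ℕ.* D ℕ.+ E) ≡ + A ℤ.+ + 3 ℤ.* + B ℤ.+ + 3 ℤ.* + D ℤ.+ + E
  push = cong (ℤ._+ + E) (cong₂ (λ u v → + A ℤ.+ u ℤ.+ v) (ℤ.pos-* 3 B) (ℤ.pos-* 3 D))
  lemma : ∀ x y a b d e → x ℤ.* y ℤ.* (a ℤ.+ + 3 ℤ.* b ℤ.+ + 3 ℤ.* d ℤ.+ e) ≡ x
      ℤ.* (y ℤ.* a ℤ.+ + 3 ℤ.* (y ℤ.* b) ℤ.+ + 3 ℤ.* (y ℤ.* d) ℤ.+ y ℤ.* e)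
  lemma = ℤ-Tactic.solve-∀

-- The sum of `term-suc` over k < n. The shifted sum loses nothing at k = 0, where (0 choose m+1)
-- vanishes, and gains the boundary term at k = n.
g-recurrence : ∀ x n m → g x n (suc m) ℤ.+ term x (suc m) n ≡
  x ℤ.* (g x n (3 ℕ.+ m) ℤ.+ + 3 ℤ.* g x n (2 ℕ.+ m) ℤ.+ + 3 ℤ.* g x n (1 ℕ.+ m) ℤ.+ g x n m)
g-recurrence x zero    m = ≡.sym (ℤ.*-zeroʳ x)
g-recurrence x (suc n) m = ≡.trans (cong₂ ℤ._+_ (g-recurrence x n m) (term-suc x m n))
  (lemma x (g x n (3 ℕ.+ m)) (g x n (2 ℕ.+ m)) (g x n (1 ℕ.+ m)) (g x n m) (term x (3 ℕ.+ m) n) (term x (2 ℕ.+ m) n) (term x (1 ℕ.+ m) n)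
      (term x m n))
  where
  lemma : ∀ x a b d e a′ b′ d′ e′ →
    x ℤ.* (a ℤ.+ + 3 ℤ.* b ℤ.+ + 3 ℤ.* d ℤ.+ e) ℤ.+ x ℤ.* (a′ ℤ.+ + 3 ℤ.* b′ ℤ.+ + 3 ℤ.* d′ ℤ.+ e′)
    ≡ x ℤ.* ((a ℤ.+ a′) ℤ.+ + 3 ℤ.* (b ℤ.+ b′) ℤ.+ + 3 ℤ.* (d ℤ.+ d′) ℤ.+ (e ℤ.+ e′))
  lemma = ℤ-Tactic.solve-∀

3k≡2k+k : ∀ k → 3 ℕ.* k ≡ 2 ℕ.* k ℕ.+ k
3k≡2k+k = ℕ-Tactic.solve-∀

-- Together with `g-top` this supplies the initial values of the recurrence, which is run downwards
-- from m = p-1.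
g-vanishes : ∀ x n m → n ℕ.≤ m → g x n m ≡ + 0
g-vanishes x zero    m _   = ≡.refl
g-vanishes x (suc n) m n<m = cong₂ ℤ._+_ (g-vanishes x n m (ℕ.<⇒≤ n<m))
  (≡.trans (cong (λ b → x ℤ.^ n ℤ.* + b) (k>n⇒nCk≡0 bound)) (ℤ.*-zeroʳ (x ℤ.^ n)))
  where
  bound : 3 ℕ.* n ℕ.< 2 ℕ.* n ℕ.+ m
  bound = subst (ℕ._< 2 ℕ.* n ℕ.+ m) (≡.sym (3k≡2k+k n)) (ℕ.+-monoʳ-< (2 ℕ.* n) n<m)

g-top : ∀ x n → g x (suc n) n ≡ x ℤ.^ n
g-top x n = ≡.trans (cong₂ ℤ._+_ (g-vanishes x n n ℕ.≤-refl)
  (cong (λ b → x ℤ.^ n ℤ.* + b) (≡.trans (cong ((3 ℕ.* n) C_) (≡.sym (3k≡2k+k n))) (nCn≡1 (3 ℕ.* n)))))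
  (≡.trans (ℤ.+-identityˡ _) (ℤ.*-identityʳ _))

-- For 0 < m+1 < p the lower index 2p+m+1 is prime to p while the upper index 3p is a multiple of
-- it. So the boundary term of `g-recurrence` at n = p dies modulo p and the recurrence becomes
-- homogeneous.
prime∣term : ∀ {p} → Prime p → ∀ m → suc m ℕ.< p → p ∣ ((3 ℕ.* p) C (2 ℕ.* p ℕ.+ suc m))
prime∣term {p} pr m m<p = prime∣C pr (3 ℕ.* p) (2 ℕ.* p ℕ.+ suc m) (n∣m*n 3)
  (λ d → >⇒∤ {suc m} m<p (∣m+n∣m⇒∣n d (n∣m*n 2)))

-- Algebras of characteristic p

module AlgebraProperties (K : ℤAlgebra) where
  open ℤAlgebra K
  open AlgebraSolver K public
  open Algebra.Properties.CommutativeSemiring.Exp commutativeSemiring public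
  open Algebra.Properties.Semiring.Mult semiring using (×-homo-1) renaming (_×_ to _·_)
  open Relation.Binary.Reasoning.Setoid setoid

  ·≈η* : ∀ n x → n · x ≈ η (+ n) * x
  ·≈η* zero    x = sym (trans (*-congʳ η-0) (zeroˡ x))
  ·≈η* (suc n) x = begin
    x + n · x               ≈⟨ +-congˡ (·≈η* n x) ⟩
    x + η (+ n) * x         ≈⟨ solve 2 (λ x y → x :+ y :* x := (con (+ 1) :+ y) :* x) refl x (η (+ n)) ⟩
    (η (+ 1) + η (+ n)) * x ≈⟨ *-congʳ (η-+ (+ 1) (+ n)) ⟨
    η (+ suc n) * x         ∎

  η-^ : ∀ z n → η (z ℤ.^ n) ≈ η z ^ n
  η-^ z zero    = η-1
  η-^ z (suc n) = trans (η-* z (z ℤ.^ n)) (*-congˡ (η-^ z n))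

  1^n≈1 : ∀ n → 1# ^ n ≈ 1#
  1^n≈1 zero    = refl
  1^n≈1 (suc n) = trans (*-identityˡ _) (1^n≈1 n)

  ^-*-inverse : ∀ {x y} n → x * y ≈ 1# → x ^ n * y ^ n ≈ 1#
  ^-*-inverse {x} {y} n xy≈1 = trans (sym (^-distrib-* x y n)) (trans (^-congˡ n xy≈1) (1^n≈1 n))

module CharP (K : ℤAlgebra) (p : ℕ) (p-prime : Prime p) (1<p : 1 ℕ.< p) (ηp≈0 : ℤAlgebra._≈_ K (ℤAlgebra.η K (+ p)) (ℤAlgebra.0# K)) where
  open ℤAlgebra K
  open AlgebraProperties K
  open Algebra.Properties.Semiring.Mult semiring using (×-homo-1) renaming (_×_ to _·_)
  open Algebra.Properties.Semiring.Sum semiring using (sum; sum-cong-≋; sum-init-last; sum-replicate-zero)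
  open Algebra.Properties.CommutativeSemiring.Binomial commutativeSemiring using (binomialTerm; theorem)
  open Relation.Binary.Reasoning.Setoid setoid

  η-∣ : ∀ {n} → p ∣ n → η (+ n) ≈ 0#
  η-∣ (divides q ≡.refl) = begin
    η (+ (q ℕ.* p))     ≡⟨ ≡.cong η (ℤ.pos-* q p) ⟩
    η (+ q ℤ.* + p)     ≈⟨ η-* (+ q) (+ p) ⟩
    η (+ q) * η (+ p)   ≈⟨ *-congˡ ηp≈0 ⟩
    η (+ q) * 0#        ≈⟨ zeroʳ _ ⟩
    0#                  ∎

  -- In the binomial theorem all terms but the first and the last have coefficients divisible by p.
  -- The exponent is a successor so that both ends of the sum can be split off.
  frobenius-suc : ∀ n → p ≡ suc n → ∀ x y → (x + y) ^ suc n ≈ x ^ suc n + y ^ suc n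
  frobenius-suc n p≡ x y = begin
    (x + y) ^ suc n                      ≈⟨ theorem (suc n) x y ⟩
    t Fin.zero + sum (λ i → t (Fin.suc i))   ≈⟨ +-cong first (sum-init-last (λ i → t (Fin.suc i))) ⟩
    y ^ suc n + (sum (λ i → t (Fin.suc (inject₁ i))) + t (Fin.suc (Fin.fromℕ n)))
      ≈⟨ +-congˡ (+-cong (trans (sum-cong-≋ middle) (sum-replicate-zero n)) last) ⟩
    y ^ suc n + (0# + x ^ suc n)         ≈⟨ +-congˡ (+-identityˡ _) ⟩
    y ^ suc n + x ^ suc n                ≈⟨ +-comm _ _ ⟩
    x ^ suc n + y ^ suc n                ∎
    where
    t : Fin (suc (suc n)) → Carrier
    t = binomialTerm x y (suc n)
    first : t Fin.zero ≈ y ^ suc n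
    first = trans (×-homo-1 _) (*-identityˡ _)
    last : t (Fin.suc (Fin.fromℕ n)) ≈ x ^ suc n
    last = begin
      (suc n C suc (toℕ (Fin.fromℕ n))) · (x ^ suc (toℕ (Fin.fromℕ n)) * y ^ (n ℕ.∸ toℕ (Fin.fromℕ n)))
        ≡⟨ ≡.cong (λ k → (suc n C suc k) · (x ^ suc k * y ^ (n ℕ.∸ k))) (Fin.toℕ-fromℕ n) ⟩
      (suc n C suc n) · (x ^ suc n * y ^ (n ℕ.∸ n))
        ≡⟨ ≡.cong₂ (λ k l → k · (x ^ suc n * y ^ l)) (nCn≡1 (suc n)) (ℕ.n∸n≡0 n) ⟩
      1 · (x ^ suc n * 1#) ≈⟨ trans (×-homo-1 _) (*-identityʳ _) ⟩
      x ^ suc n ∎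
    middle : ∀ i → t (Fin.suc (inject₁ i)) ≈ 0#
    middle i = trans (·≈η* (suc n C k) _) (trans (*-congʳ (η-∣ p∣C)) (zeroˡ _))
      where
      k = suc (toℕ (inject₁ i))
      k<p : k ℕ.< p
      k<p = ≡.subst (k ℕ.<_) (≡.sym p≡) (s≤s (≡.subst (ℕ._< n) (≡.sym (Fin.toℕ-inject₁ i)) (Fin.toℕ<n i)))
      p∣C : p ∣ (suc n C k)
      p∣C = prime∣C p-prime (suc n) k (≡.subst (p ∣_) p≡ ∣-refl) (>⇒∤ {k} k<p)

  private
    p-suc : suc (ℕ.pred p) ≡ p
    p-suc = ℕ.suc-pred p {{ℕ.>-nonZero (ℕ.<-trans ℕ.0<1+n 1<p)}}

  frobenius-+ : ∀ x y → (x + y) ^ p ≈ x ^ p + y ^ p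
  frobenius-+ x y = ≡.subst (λ n → (x + y) ^ n ≈ x ^ n + y ^ n) p-suc (frobenius-suc (ℕ.pred p) (≡.sym p-suc) x y)

  0^p≈0 : 0# ^ p ≈ 0#
  0^p≈0 = ≡.subst (λ n → 0# ^ n ≈ 0#) p-suc (zeroˡ _)

  frobenius-neg : ∀ x → (- x) ^ p ≈ - (x ^ p)
  frobenius-neg x = begin
    (- x) ^ p                         ≈⟨ solve 2 (λ a b → a := (a :+ b) :- b) refl _ (x ^ p) ⟩
    ((- x) ^ p + x ^ p) - x ^ p       ≈⟨ +-congʳ (frobenius-+ (- x) x) ⟨
    (- x + x) ^ p - x ^ p             ≈⟨ +-congʳ (trans (^-congˡ p (-‿inverseˡ x)) 0^p≈0) ⟩
    0# - x ^ p                        ≈⟨ +-identityˡ _ ⟩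
    - (x ^ p)                         ∎

  fermat-ℕ : ∀ n → η (+ n) ^ p ≈ η (+ n)
  fermat-ℕ zero    = trans (^-congˡ p η-0) (trans 0^p≈0 (sym η-0))
  fermat-ℕ (suc n) = begin
    η (+ suc n) ^ p             ≈⟨ ^-congˡ p (η-+ (+ 1) (+ n)) ⟩
    (η (+ 1) + η (+ n)) ^ p     ≈⟨ frobenius-+ _ _ ⟩
    η (+ 1) ^ p + η (+ n) ^ p   ≈⟨ +-cong (trans (^-congˡ p η-1) (trans (1^n≈1 p) (sym η-1))) (fermat-ℕ n) ⟩
    η (+ 1) + η (+ n)           ≈⟨ η-+ (+ 1) (+ n) ⟨
    η (+ suc n)                 ∎

  -- Induction through additivity of the Frobenius map. Its main use: Frobenius commutes with every
  -- polynomial whose coefficients come from ℤ, as in `r-frobenius`.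
  fermat : ∀ z → η z ^ p ≈ η z
  fermat (+ n)    = fermat-ℕ n
  fermat -[1+ n ] = trans (^-congˡ p (η-neg (+ suc n))) (trans (frobenius-neg _)
      (trans (-‿cong (fermat-ℕ (suc n))) (sym (η-neg (+ suc n)))))

  fermat-unit : ∀ x a → η a * η x ≈ 1# → ∀ n → p ≡ suc n → η x ^ n ≈ 1#
  fermat-unit x a ax≈1 n p≡ = begin
    η x ^ n                   ≈⟨ *-identityˡ _ ⟨
    1# * η x ^ n              ≈⟨ *-congʳ ax≈1 ⟨
    η a * η x * η x ^ n       ≈⟨ *-assoc _ _ _ ⟩
    η a * η x ^ suc n         ≈⟨ *-congˡ (≡.subst (λ m → η x ^ m ≈ η x) p≡ (fermat x)) ⟩
    η a * η x                 ≈⟨ ax≈1 ⟩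
    1#                        ∎

  G : ℤ → ℕ → Carrier
  G x m = η (g x p m)

  G-recurrence : ∀ x a → η a * η x ≈ 1# → ∀ m → suc m ℕ.< p →
    G x (3 ℕ.+ m) + η (+ 3) * G x (2 ℕ.+ m) + η (+ 3) * G x (1 ℕ.+ m) + G x m ≈ η a * G x (1 ℕ.+ m)
  G-recurrence x a ax≈1 m m<p = sym (begin
    η a * G x (1 ℕ.+ m)                              ≈⟨ *-congˡ (+-identityʳ _) ⟨
    η a * (G x (1 ℕ.+ m) + 0#)                       ≈⟨ *-congˡ (+-congˡ term≈0) ⟨
    η a * (G x (1 ℕ.+ m) + η (term x (suc m) p))     ≈⟨ *-congˡ (η-+ _ _) ⟨
    η a * η (g x p (suc m) ℤ.+ term x (suc m) p)     ≡⟨ ≡.cong (λ z → η a * η z) (g-recurrence x p m) ⟩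
    η a * η (x ℤ.* S)                                ≈⟨ *-congˡ (η-* _ _) ⟩
    η a * (η x * η S)                                ≈⟨ *-assoc _ _ _ ⟨
    η a * η x * η S                                  ≈⟨ *-congʳ ax≈1 ⟩
    1# * η S                                         ≈⟨ *-identityˡ _ ⟩
    η S                                              ≈⟨ η-+ _ _ ⟩
    η (A ℤ.+ + 3 ℤ.* B ℤ.+ + 3 ℤ.* D) + G x m        ≈⟨ +-congʳ (η-+ _ _) ⟩
    η (A ℤ.+ + 3 ℤ.* B) + η (+ 3 ℤ.* D) + G x m      ≈⟨ +-congʳ (+-cong (trans (η-+ _ _) (+-congˡ (η-* _ _))) (η-* _ _)) ⟩
    η A + η (+ 3) * η B + η (+ 3) * η D + G x m      ∎)
    where
    A = g x p (3 ℕ.+ m)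
    B = g x p (2 ℕ.+ m)
    D = g x p (1 ℕ.+ m)
    S = A ℤ.+ + 3 ℤ.* B ℤ.+ + 3 ℤ.* D ℤ.+ g x p m
    term≈0 : η (term x (suc m) p) ≈ 0#
    term≈0 = trans (η-* (x ℤ.^ p) _) (trans (*-congˡ (η-∣ (prime∣term p-prime m m<p))) (zeroʳ _))

  module CubicRoot (x a : ℤ) (ax≈1 : η a * η x ≈ 1#) (ρ : Carrier) (cubic : (η (+ 1) + ρ) ^ 3 ≈ η a * ρ ^ 2) where

    -- The cubic reads ρ³ = (a-3)ρ² - 3ρ - 1. Multiplying by ρ and reducing changes the leading
    -- coefficient exactly as `G-recurrence` leads from index m+1 to m, so powers of ρ and values of
    -- G run in opposite directions, tied by m + n = p-1. The start n = 0 is ρ² itself: G at p-1 is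
    -- x^(p-1), which is 1 by Fermat, and G vanishes beyond p-1.
    ρ-power : ∀ n m → suc (m ℕ.+ n) ≡ p →
      ρ ^ (2 ℕ.+ n) ≈ G x m * ρ ^ 2 - (η (+ 3) * G x (1 ℕ.+ m) + G x (2 ℕ.+ m)) * ρ - G x (1 ℕ.+ m)
    ρ-power zero m m+0≡ = begin
      ρ ^ 2
        ≈⟨ solve 1 (λ r → r :^ 2 := con (+ 1) :* r :^ 2 :- (con (+ 3) :* con (+ 0) :+ con (+ 0)) :* r :- con (+ 0)) refl ρ ⟩
      η (+ 1) * ρ ^ 2 - (η (+ 3) * η (+ 0) + η (+ 0)) * ρ - η (+ 0)
        ≈⟨ +-cong (+-cong (*-congʳ G₀) (-‿cong (*-congʳ (+-cong (*-congˡ G₁) G₂)))) (-‿cong G₁) ⟨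
      G x m * ρ ^ 2 - (η (+ 3) * G x (1 ℕ.+ m) + G x (2 ℕ.+ m)) * ρ - G x (1 ℕ.+ m) ∎
      where
      p≡ : p ≡ suc m
      p≡ = ≡.trans (≡.sym m+0≡) (≡.cong suc (ℕ.+-identityʳ m))
      G₀ : G x m ≈ η (+ 1)
      G₀ = begin
        η (g x p m)        ≡⟨ ≡.cong (λ n → η (g x n m)) p≡ ⟩
        η (g x (suc m) m)  ≡⟨ ≡.cong η (g-top x m) ⟩
        η (x ℤ.^ m)        ≈⟨ η-^ x m ⟩
        η x ^ m            ≈⟨ fermat-unit x a ax≈1 m p≡ ⟩
        1#                 ≈⟨ η-1 ⟨
        η (+ 1)            ∎
      G₁ : G x (1 ℕ.+ m) ≈ η (+ 0)
      G₁ = reflexive (≡.cong η (g-vanishes x p (1 ℕ.+ m) (ℕ.≤-reflexive p≡)))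
      G₂ : G x (2 ℕ.+ m) ≈ η (+ 0)
      G₂ = reflexive (≡.cong η (g-vanishes x p (2 ℕ.+ m) (ℕ.m≤n⇒m≤1+n (ℕ.≤-reflexive p≡))))
    ρ-power (suc n) m m+n≡ = trans (*-congˡ (ρ-power n (suc m) (≡.trans (≡.cong suc (≡.sym (ℕ.+-suc m n))) m+n≡)))
      (lincomb₂ (G x (1 ℕ.+ m)) (- (ρ ^ 2))
        (solve 6 (λ r a g3 g2 g1 g0 → r :* (g1 :* r :^ 2 :- (con (+ 3) :* g2 :+ g3) :* r :- g2)
            := (g0 :* r :^ 2 :- (con (+ 3) :* g1 :+ g2) :* r :- g1)
           :+ g1 :* ((con (+ 1) :+ r) :^ 3 :- a :* r :^ 2) :+ (:- (r :^ 2)) :* ((g3 :+ con (+ 3) :* g2 :+ con (+ 3) :* g1 :+ g0)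
               :- a :* g1)) refl
           ρ (η a) (G x (3 ℕ.+ m)) (G x (2 ℕ.+ m)) (G x (1 ℕ.+ m)) (G x m))
        cubic (G-recurrence x a ax≈1 m (≡.subst (suc m ℕ.<_) m+n≡ (s≤s (≡.subst (suc m ℕ.≤_) (≡.sym (ℕ.+-suc m n)) (s≤s (ℕ.m≤m+n m n)))))))

-- The linear system over the three roots

module ThreeRoots (K : ℤAlgebra) (p : ℕ) (p-prime : Prime p) (1<p : 1 ℕ.< p) (ηp≈0 : ℤAlgebra._≈_ K (ℤAlgebra.η K (+ p)) (ℤAlgebra.0# K))
    where
  open ℤAlgebra K
  open AlgebraProperties K
  open CharP K p p-prime 1<p ηp≈0
  open Relation.Binary.Reasoning.Setoid setoid

  -- Equals (a-b)(b-c)(a-c), the determinant with rows (a², a, 1), (b², b, 1), (c², c, 1), in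
  -- expanded form.
  vandermonde : Carrier → Carrier → Carrier → Carrier
  vandermonde a b c = a ^ 2 * (b - c) + b ^ 2 * (c - a) + c ^ 2 * (a - b)

  -- Substituting q = (1+M)/3 in q³ - q² + x = 0 gives the depressed cubic M³ - 3M - (2 - 27x) = 0,
  -- whose Vieta formulas are `σ₁`, `σ₂`, `σ₃`. They are demanded instead of three root equations,
  -- because with zero divisors the latter would not determine the symmetric functions.
  record CubicRoots (x a t : ℤ) (M₀ M₁ M₂ : Carrier) : Set where
    field
      ax≈1 : η a * η x ≈ 1#
      3t≈1 : η (+ 3) * η t ≈ 1#
      σ₁   : M₀ + M₁ + M₂ ≈ η (+ 0)
      σ₂   : M₀ * M₁ + M₁ * M₂ + M₂ * M₀ ≈ η -[1+ 2 ]
      σ₃   : η (+ 27) * η x ≈ η (+ 2) - M₀ * M₁ * M₂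

  module Roots {x a t : ℤ} {M₀ M₁ M₂ : Carrier} (𝓒 : CubicRoots x a t M₀ M₁ M₂) where
    open CubicRoots 𝓒

    q : Carrier → Carrier
    q m = η t * (η (+ 1) + m)

    -- This is ρ = q/(1-q) without the inverse of 1-q: the relation q²(1-q) = x turns 1/(1-q) into
    -- q²/x.
    r : Carrier → Carrier
    r m = η a * (q m * q m) - η (+ 1)

    ax≈η1 : η a * η x ≈ η (+ 1)
    ax≈η1 = trans ax≈1 (sym η-1)

    3t≈η1 : η (+ 3) * η t ≈ η (+ 1)
    3t≈η1 = trans 3t≈1 (sym η-1)

    27t³≈1 : η (+ 27) * (η t * η t * η t) ≈ η (+ 1)
    27t³≈1 = lincomb₁ (η (+ 9) * η t * η t + η (+ 3) * η t + η (+ 1))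
      (solve 1 (λ t → con (+ 27) :* (t :* t :* t) := con (+ 1) :+ (con (+ 9) :* t :* t :+ con (+ 3) :* t :+ con (+ 1)) :* (con (+ 3) :* t
          :- con (+ 1))) refl (η t)) 3t≈η1

    q-sum : q M₀ + q M₁ + q M₂ ≈ η (+ 1)
    q-sum = lincomb₂ (η t) (η (+ 1))
      (solve 4 (λ t a b c → t :* (con (+ 1) :+ a) :+ t :* (con (+ 1) :+ b) :+ t :* (con (+ 1) :+ c) := con (+ 1)
          :+ t :* ((a :+ b :+ c) :- con (+ 0)) :+ con (+ 1) :* (con (+ 3) :* t :- con (+ 1))) refl (η t) M₀ M₁ M₂)
      σ₁ 3t≈η1

    q-pairs : q M₀ * q M₁ + q M₁ * q M₂ + q M₂ * q M₀ ≈ η (+ 0)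
    q-pairs = lincomb₂ (η (+ 2) * η t * η t) (η t * η t)
      (solve 4 (λ t a b c → (t :* (con (+ 1) :+ a)) :* (t :* (con (+ 1) :+ b)) :+ (t :* (con (+ 1) :+ b)) :* (t :* (con (+ 1) :+ c))
          :+ (t :* (con (+ 1) :+ c)) :* (t :* (con (+ 1) :+ a))
         := con (+ 0) :+ (con (+ 2) :* t :* t) :* ((a :+ b :+ c) :- con (+ 0)) :+ (t :* t) :* ((a :* b :+ b :* c :+ c :* a)
             :- con -[1+ 2 ])) refl (η t) M₀ M₁ M₂)
      σ₁ σ₂

    q-product : q M₀ * q M₁ * q M₂ ≈ - η x
    q-product = lincomb₁ (- η x) (lincomb₃ (η t * η t * η t) (η t * η t * η t) (η t * η t * η t)
      (solve 5 (λ t a b c x → (t :* (con (+ 1) :+ a)) :* (t :* (con (+ 1) :+ b)) :* (t :* (con (+ 1) :+ c))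
         := :- x :+ (:- x) :* (con (+ 27) :* (t :* t :* t) :- con (+ 1)) :+ (t :* t :* t) :* ((a :+ b :+ c) :- con (+ 0))
             :+ (t :* t :* t) :* ((a :* b :+ b :* c :+ c :* a) :- con -[1+ 2 ])
           :+ (t :* t :* t) :* (con (+ 27) :* x :- (con (+ 2) :- a :* b :* c))) refl (η t) M₀ M₁ M₂ (η x))
      σ₁ σ₂ σ₃) 27t³≈1

    -- This and the next two are Vieta's formulas for (1+T)³ - aT² = T³ + (3-a)T² + 3T + 1, derived
    -- from those for q³ - q² + x.
    r-sum : r M₀ + r M₁ + r M₂ ≈ η a - η (+ 3)
    r-sum = lincomb₁ (η (+ 0)) (lincomb₃ (η a * ((q M₀ + q M₁ + q M₂) + η (+ 1))) (- (η (+ 2) * η a)) (η (+ 0))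
      (solve 5 (λ u v w a x → (a :* (u :* u) :- con (+ 1)) :+ (a :* (v :* v) :- con (+ 1)) :+ (a :* (w :* w) :- con (+ 1))
          := (a :- con (+ 3)) :+ (con (+ 0)) :* ((a :* x) :- con (+ 1)) :+ (a :* ((u :+ v :+ w) :+ con (+ 1))) :* ((u :+ v :+ w)
          :- con (+ 1)) :+ (:- (con (+ 2) :* a)) :* ((u :* v :+ v :* w :+ w :* u) :- con (+ 0)) :+ (con (+ 0)) :* ((u :* v :* w) :- (:- x)))
          refl (q M₀) (q M₁) (q M₂) (η a) (η x))
      q-sum q-pairs q-product) ax≈η1

    r-pairs : r M₀ * r M₁ + r M₁ * r M₂ + r M₂ * r M₀ ≈ η (+ 3)
    r-pairs = lincomb₁ (η (+ 2) * η a * (q M₀ + q M₁ + q M₂)) (lincomb₃ (- (η (+ 2) * η a * (q M₀ + q M₁ + q M₂)))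
        (η a * η a * (q M₀ * q M₁ + q M₁ * q M₂ + q M₂ * q M₀) + η (+ 4) * η a) (- (η (+ 2) * η a * η a * (q M₀ + q M₁ + q M₂)))
      (solve 5 (λ u v w a x → (a :* (u :* u) :- con (+ 1)) :* (a :* (v :* v) :- con (+ 1))
          :+ (a :* (v :* v) :- con (+ 1)) :* (a :* (w :* w) :- con (+ 1)) :+ (a :* (w :* w) :- con (+ 1)) :* (a :* (u :* u) :- con (+ 1))
          := con (+ 3) :+ (con (+ 2) :* a :* (u :+ v :+ w)) :* ((a :* x) :- con (+ 1))
          :+ (:- (con (+ 2) :* a :* (u :+ v :+ w))) :* ((u :+ v :+ w) :- con (+ 1)) :+ (a :* a :* (u :* v :+ v :* w :+ w :* u)
          :+ con (+ 4) :* a) :* ((u :* v :+ v :* w :+ w :* u) :- con (+ 0)) :+ (:- (con (+ 2) :* a :* a :* (u :+ v :+ w))) :* ((u :* v :* w)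
          :- (:- x))) refl (q M₀) (q M₁) (q M₂) (η a) (η x))
      q-sum q-pairs q-product) ax≈η1

    r-product : r M₀ * r M₁ * r M₂ ≈ η -[1+ 0 ]
    r-product = lincomb₁ (- (η a * (η a * (q M₀ * q M₁ * q M₂) + (q M₀ + q M₁ + q M₂))))
        (lincomb₃ ((η a * (η a * (q M₀ * q M₁ * q M₂) + (q M₀ + q M₁ + q M₂)))) (- (η a * η a * (q M₀ * q M₁ + q M₁ * q M₂ + q M₂ * q M₀)
        + η (+ 2) * η a)) (η a * (η a * (η a * (q M₀ * q M₁ * q M₂) + (q M₀ + q M₁ + q M₂))))
      (solve 5 (λ u v w a x → (a :* (u :* u) :- con (+ 1)) :* (a :* (v :* v) :- con (+ 1)) :* (a :* (w :* w) :- con (+ 1)) := con -[1+ 0 ]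
          :+ (:- (a :* (a :* (u :* v :* w) :+ (u :+ v :+ w)))) :* ((a :* x) :- con (+ 1))
          :+ ((a :* (a :* (u :* v :* w) :+ (u :+ v :+ w)))) :* ((u :+ v :+ w) :- con (+ 1))
          :+ (:- (a :* a :* (u :* v :+ v :* w :+ w :* u) :+ con (+ 2) :* a)) :* ((u :* v :+ v :* w :+ w :* u) :- con (+ 0))
          :+ (a :* (a :* (a :* (u :* v :* w) :+ (u :+ v :+ w)))) :* ((u :* v :* w) :- (:- x))) refl (q M₀) (q M₁) (q M₂) (η a) (η x))
      q-sum q-pairs q-product) ax≈η1

    -- Since the q's sum to 1, a difference of two r's is a times the difference of the q's times 1
    -- minus the third q. The product of the factors 1-q is the value of T³ - T² + x at 1, namely x,
    -- and a³x = a².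
    r-vandermonde : vandermonde (r M₀) (r M₁) (r M₂) ≈ η a * η a * vandermonde (q M₀) (q M₁) (q M₂)
    r-vandermonde = lincomb₁ (η a * η a * (q M₀ ^ 2 * (q M₁ - q M₂) + q M₁ ^ 2 * (q M₂ - q M₀) + q M₂ ^ 2 * (q M₀ - q M₁)))
        (lincomb₃ (η (+ 0)) (η a * η a * η a * (q M₀ ^ 2 * (q M₁ - q M₂) + q M₁ ^ 2 * (q M₂ - q M₀) + q M₂ ^ 2 * (q M₀ - q M₁)) * (q M₀
        + q M₁ + q M₂)) (- (η a * η a * η a * (q M₀ ^ 2 * (q M₁ - q M₂) + q M₁ ^ 2 * (q M₂ - q M₀) + q M₂ ^ 2 * (q M₀ - q M₁))))
      (solve 5 (λ u v w a x → ((a :* (u :* u) :- con (+ 1)) :^ 2 :* ((a :* (v :* v) :- con (+ 1)) :- (a :* (w :* w) :- con (+ 1)))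
          :+ (a :* (v :* v) :- con (+ 1)) :^ 2 :* ((a :* (w :* w) :- con (+ 1)) :- (a :* (u :* u) :- con (+ 1)))
          :+ (a :* (w :* w) :- con (+ 1)) :^ 2 :* ((a :* (u :* u) :- con (+ 1)) :- (a :* (v :* v) :- con (+ 1))))
          := a :* a :* (u :^ 2 :* (v :- w) :+ v :^ 2 :* (w :- u) :+ w :^ 2 :* (u :- v))
          :+ (a :* a :* (u :^ 2 :* (v :- w) :+ v :^ 2 :* (w :- u) :+ w :^ 2 :* (u :- v))) :* ((a :* x) :- con (+ 1))
          :+ (con (+ 0)) :* ((u :+ v :+ w) :- con (+ 1)) :+ (a :* a :* a :* (u :^ 2 :* (v :- w) :+ v :^ 2 :* (w :- u)
          :+ w :^ 2 :* (u :- v)) :* (u :+ v :+ w)) :* ((u :* v :+ v :* w :+ w :* u) :- con (+ 0))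
          :+ (:- (a :* a :* a :* (u :^ 2 :* (v :- w) :+ v :^ 2 :* (w :- u) :+ w :^ 2 :* (u :- v)))) :* ((u :* v :* w) :- (:- x))) refl
          (q M₀) (q M₁) (q M₂) (η a) (η x))
      q-sum q-pairs q-product) ax≈η1

    q-vandermonde : vandermonde (q M₀) (q M₁) (q M₂) ≈ η t * η t * η t * vandermonde M₀ M₁ M₂
    q-vandermonde =
      solve 4 (λ t a b c → (t :* (con (+ 1) :+ a)) :^ 2 :* (t :* (con (+ 1) :+ b) :- t :* (con (+ 1) :+ c))
          :+ (t :* (con (+ 1) :+ b)) :^ 2 :* (t :* (con (+ 1) :+ c) :- t :* (con (+ 1) :+ a))
          :+ (t :* (con (+ 1) :+ c)) :^ 2 :* (t :* (con (+ 1) :+ a) :- t :* (con (+ 1) :+ b))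
        := t :* t :* t :* (a :^ 2 :* (b :- c) :+ b :^ 2 :* (c :- a) :+ c :^ 2 :* (a :- b))) refl (η t) M₀ M₁ M₂

    -- A root satisfies T³ - e₁T² + e₂T - e₃ = 0, with the symmetric functions from `r-sum`,
    -- `r-pairs` and `r-product`; likewise for the other two.
    cubic₀ : (η (+ 1) + r M₀) ^ 3 ≈ η a * r M₀ ^ 2
    cubic₀ = lincomb₃ (r M₀ ^ 2) (- r M₀) (η (+ 1))
      (solve 4 (λ a u v w → (con (+ 1) :+ u) :^ 3 := a :* u :^ 2 :+ u :^ 2 :* ((u :+ v :+ w) :- (a :- con (+ 3)))
          :+ (:- u) :* ((u :* v :+ v :* w :+ w :* u) :- con (+ 3)) :+ con (+ 1) :* (u :* v :* w :- con -[1+ 0 ])) refl (η a) (r M₀) (r M₁)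
          (r M₂))
      r-sum r-pairs r-product

    cubic₁ : (η (+ 1) + r M₁) ^ 3 ≈ η a * r M₁ ^ 2
    cubic₁ = lincomb₃ (r M₁ ^ 2) (- r M₁) (η (+ 1))
      (solve 4 (λ a u v w → (con (+ 1) :+ v) :^ 3 := a :* v :^ 2 :+ v :^ 2 :* ((u :+ v :+ w) :- (a :- con (+ 3)))
          :+ (:- v) :* ((u :* v :+ v :* w :+ w :* u) :- con (+ 3)) :+ con (+ 1) :* (u :* v :* w :- con -[1+ 0 ])) refl (η a) (r M₀) (r M₁)
          (r M₂))
      r-sum r-pairs r-product

    cubic₂ : (η (+ 1) + r M₂) ^ 3 ≈ η a * r M₂ ^ 2
    cubic₂ = lincomb₃ (r M₂ ^ 2) (- r M₂) (η (+ 1))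
      (solve 4 (λ a u v w → (con (+ 1) :+ w) :^ 3 := a :* w :^ 2 :+ w :^ 2 :* ((u :+ v :+ w) :- (a :- con (+ 3)))
          :+ (:- w) :* ((u :* v :+ v :* w :+ w :* u) :- con (+ 3)) :+ con (+ 1) :* (u :* v :* w :- con -[1+ 0 ])) refl (η a) (r M₀) (r M₁)
          (r M₂))
      r-sum r-pairs r-product

    -- Cramer's rule for the quadratic polynomial that interpolates the values yᵢ at the roots r Mᵢ.
    cramer : ∀ {v b c y₀ y₁ y₂} → y₀ ≈ v * r M₀ ^ 2 - b * r M₀ - c → y₁ ≈ v * r M₁ ^ 2 - b * r M₁ - c → y₂ ≈ v * r M₂ ^ 2 - b * r M₂ - c →
      v * vandermonde (r M₀) (r M₁) (r M₂) ≈ y₀ * (r M₁ - r M₂) + y₁ * (r M₂ - r M₀) + y₂ * (r M₀ - r M₁)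
    cramer {v} {b} {c} h₀ h₁ h₂ = trans
      (solve 6 (λ v b c r s t → v :* (r :^ 2 :* (s :- t) :+ s :^ 2 :* (t :- r) :+ t :^ 2 :* (r :- s))
          := (v :* r :^ 2 :- b :* r :- c) :* (s :- t) :+ (v :* s :^ 2 :- b :* s :- c) :* (t :- r)
          :+ (v :* t :^ 2 :- b :* t :- c) :* (r :- s)) refl v b c (r M₀) (r M₁) (r M₂))
      (sym (+-cong (+-cong (*-congʳ h₀) (*-congʳ h₁)) (*-congʳ h₂)))

    private
      p≡₁ : suc (ℕ.pred p) ≡ p
      p≡₁ = ℕ.suc-pred p {{ℕ.>-nonZero (ℕ.<-trans ℕ.0<1+n 1<p)}}
      p≡₂ : 2 ℕ.+ (p ℕ.∸ 2) ≡ p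
      p≡₂ = ℕ.m+[n∸m]≡n 1<p

      -- In `ρ-power` the index m = 0 belongs to the exponent p+1 and m = 1 to the exponent p, with
      -- leading coefficients `G x 0` and `G x 1`. `cramer` isolates precisely the leading
      -- coefficient.
      power₀ : ∀ ρ → (η (+ 1) + ρ) ^ 3 ≈ η a * ρ ^ 2 → ρ * ρ ^ p ≈ G x 0 * ρ ^ 2 - (η (+ 3) * G x 1 + G x 2) * ρ - G x 1
      power₀ ρ cub = trans (*-congˡ (^-congʳ ρ (≡.sym p≡₁))) (CubicRoot.ρ-power x a ax≈1 ρ cub (ℕ.pred p) 0 p≡₁)

      power₁ : ∀ ρ → (η (+ 1) + ρ) ^ 3 ≈ η a * ρ ^ 2 → ρ ^ p ≈ G x 1 * ρ ^ 2 - (η (+ 3) * G x 2 + G x 3) * ρ - G x 2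
      power₁ ρ cub = trans (^-congʳ ρ (≡.sym p≡₂)) (CubicRoot.ρ-power x a ax≈1 ρ cub (p ℕ.∸ 2) 1 p≡₂)

    r-frobenius : ∀ {m m′} → m ^ p ≈ m′ → r m ^ p ≈ r m′
    r-frobenius {m} {m′} h = begin
      (η a * (q m * q m) - η (+ 1)) ^ p           ≈⟨ frobenius-+ _ _ ⟩
      (η a * (q m * q m)) ^ p + (- η (+ 1)) ^ p   ≈⟨ +-cong (^-distrib-* _ _ p) (frobenius-neg _) ⟩
      η a ^ p * (q m * q m) ^ p - η (+ 1) ^ p     ≈⟨ +-cong (*-cong (fermat a) (trans (^-distrib-* _ _ p) (*-cong q-frob q-frob)))
          (-‿cong (fermat (+ 1))) ⟩
      η a * (q m′ * q m′) - η (+ 1)               ∎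
      where
      q-frob : q m ^ p ≈ q m′
      q-frob = trans (^-distrib-* _ _ p) (*-cong (fermat t) (trans (frobenius-+ _ _) (+-cong (fermat (+ 1)) h)))

    -- The Vandermonde determinant of the r's is a² t³ times that of the M's. Multiplying it by 27x
    -- clears t³ and one factor a, which gives this quantity.
    Γ : Carrier
    Γ = η a * vandermonde M₀ M₁ M₂

    private
      scale : η (+ 27) * η x * vandermonde (r M₀) (r M₁) (r M₂) ≈ Γ
      scale = trans (*-congˡ (trans r-vandermonde (*-congˡ q-vandermonde)))
        (lincomb₂ (η a * vandermonde M₀ M₁ M₂) (η (+ 27) * (η t * η t * η t) * η a * vandermonde M₀ M₁ M₂)
        (solve 4 (λ x a t v → con (+ 27) :* x :* (a :* a :* (t :* t :* t :* v)) := a :* v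
            :+ (a :* v) :* (con (+ 27) :* (t :* t :* t) :- con (+ 1)) :+ (con (+ 27) :* (t :* t :* t) :* a :* v) :* (a :* x :- con (+ 1)))
            refl (η x) (η a) (η t) (vandermonde M₀ M₁ M₂))
        27t³≈1 ax≈η1)

      rescale : ∀ {v y} → v * vandermonde (r M₀) (r M₁) (r M₂) ≈ y → v * Γ ≈ η (+ 27) * η x * y
      rescale {v} {y} h = begin
        v * Γ                                  ≈⟨ *-congˡ scale ⟨
        v * (η (+ 27) * η x * vandermonde (r M₀) (r M₁) (r M₂)) ≈⟨ solve 3 (λ v u w → v :* (u :* w) := u :* (v :* w)) refl v
            (η (+ 27) * η x) _ ⟩
        η (+ 27) * η x * (v * vandermonde (r M₀) (r M₁) (r M₂)) ≈⟨ *-congˡ h ⟩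
        η (+ 27) * η x * y                     ∎

    module Fixed (F₀ : M₀ ^ p ≈ M₀) (F₁ : M₁ ^ p ≈ M₁) (F₂ : M₂ ^ p ≈ M₂) where

      -- With every root fixed by Frobenius, ρ^(p+1) = ρ² and ρ^p = ρ, so the interpolating
      -- polynomials have leading coefficients 1 and 0. The factor Γ stays until it is known to be a
      -- unit.
      G₀Γ : G x 0 * Γ ≈ Γ
      G₀Γ = trans (rescale (trans
        (cramer (power₀ _ cubic₀) (power₀ _ cubic₁) (power₀ _ cubic₂))
        (trans (+-cong (+-cong (*-congʳ (*-congˡ (r-frobenius F₀))) (*-congʳ (*-congˡ (r-frobenius F₁))))
            (*-congʳ (*-congˡ (r-frobenius F₂))))
          (solve 3 (λ r s t → r :* r :* (s :- t) :+ s :* s :* (t :- r) :+ t :* t :* (r :- s) := r :^ 2 :* (s :- t) :+ s :^ 2 :* (t :- r)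
              :+ t :^ 2 :* (r :- s)) refl (r M₀) (r M₁) (r M₂)))))
        scale

      G₁Γ : G x 1 * Γ ≈ η (+ 0)
      G₁Γ = trans (rescale (trans
        (cramer (power₁ _ cubic₀) (power₁ _ cubic₁) (power₁ _ cubic₂))
        (trans (+-cong (+-cong (*-congʳ (r-frobenius F₀)) (*-congʳ (r-frobenius F₁))) (*-congʳ (r-frobenius F₂)))
          (solve 3 (λ r s t → r :* (s :- t) :+ s :* (t :- r) :+ t :* (r :- s) := con (+ 0)) refl (r M₀) (r M₁) (r M₂)))))
        (solve 1 (λ x → x :* con (+ 0) := con (+ 0)) refl (η (+ 27) * η x))

    module Cyclic (F₀ : M₀ ^ p ≈ M₁) (F₁ : M₁ ^ p ≈ M₂) (F₂ : M₂ ^ p ≈ M₀) where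

      -- Now ρ^(p+1) is the product of a root and its successor. The resulting numerator is
      -- invariant only under cyclic permutations; twice it equals e₁e₂ - 9e₃ minus the Vandermonde
      -- determinant, whence the factor 2 and the summand -Γ. Here e₁e₂ - 9e₃ = 3a, and 27x · 3a =
      -- 81.
      G₀Γ : η (+ 2) * G x 0 * Γ ≈ η (+ 81) - Γ
      G₀Γ = begin
        η (+ 2) * G x 0 * Γ  ≈⟨ *-assoc _ _ _ ⟩
        η (+ 2) * (G x 0 * Γ)  ≈⟨ *-congˡ (rescale (trans
            (cramer (power₀ _ cubic₀) (power₀ _ cubic₁) (power₀ _ cubic₂))
            (+-cong (+-cong (*-congʳ (*-congˡ (r-frobenius F₀))) (*-congʳ (*-congˡ (r-frobenius F₁))))
                (*-congʳ (*-congˡ (r-frobenius F₂)))))) ⟩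
        η (+ 2) * (η (+ 27) * η x * (r M₀ * r M₁ * (r M₁ - r M₂) + r M₁ * r M₂ * (r M₂ - r M₀) + r M₂ * r M₀ * (r M₀ - r M₁)))
          ≈⟨ solve 4 (λ y u v w → con (+ 2) :* (y :* (u :* v :* (v :- w) :+ v :* w :* (w :- u) :+ w :* u :* (u :- v)))
                := y :* ((u :+ v :+ w) :* (u :* v :+ v :* w :+ w :* u) :- con (+ 9) :* (u :* v :* w))
                    :- y :* (u :^ 2 :* (v :- w) :+ v :^ 2 :* (w :- u) :+ w :^ 2 :* (u :- v))) refl (η (+ 27) * η x) (r M₀) (r M₁) (r M₂) ⟩
        η (+ 27) * η x * ((r M₀ + r M₁ + r M₂) * (r M₀ * r M₁ + r M₁ * r M₂ + r M₂ * r M₀) - η (+ 9) * (r M₀ * r M₁ * r M₂))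
            - η (+ 27) * η x * vandermonde (r M₀) (r M₁) (r M₂)
          ≈⟨ +-cong (*-congˡ (+-cong (*-cong r-sum r-pairs) (-‿cong (*-congˡ r-product)))) (-‿cong scale) ⟩
        η (+ 27) * η x * ((η a - η (+ 3)) * η (+ 3) - η (+ 9) * η -[1+ 0 ]) - Γ
          ≈⟨ lincomb₁ (η (+ 81)) (solve 3 (λ x a g → con (+ 27) :* x :* ((a :- con (+ 3)) :* con (+ 3) :- con (+ 9) :* con -[1+ 0 ]) :- g
              := con (+ 81) :- g :+ con (+ 81) :* (a :* x :- con (+ 1))) refl (η x) (η a) Γ) ax≈η1 ⟩
        η (+ 81) - Γ ∎

      -- For ρ^p the numerator is the symmetric function e₁² - 3e₂ = a(a-6), and 27x · a(a-6) =
      -- 27(a-6).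
      G₁Γ : G x 1 * Γ ≈ η (+ 27) * (η a - η (+ 6))
      G₁Γ = begin
        G x 1 * Γ  ≈⟨ rescale (trans
            (cramer (power₁ _ cubic₀) (power₁ _ cubic₁) (power₁ _ cubic₂))
            (+-cong (+-cong (*-congʳ (r-frobenius F₀)) (*-congʳ (r-frobenius F₁))) (*-congʳ (r-frobenius F₂)))) ⟩
        η (+ 27) * η x * (r M₁ * (r M₁ - r M₂) + r M₂ * (r M₂ - r M₀) + r M₀ * (r M₀ - r M₁))
          ≈⟨ *-congˡ (solve 3 (λ u v w → v :* (v :- w) :+ w :* (w :- u) :+ u :* (u :- v) := (u :+ v :+ w) :* (u :+ v :+ w)
              :- con (+ 3) :* (u :* v :+ v :* w :+ w :* u)) refl (r M₀) (r M₁) (r M₂)) ⟩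
        η (+ 27) * η x * ((r M₀ + r M₁ + r M₂) * (r M₀ + r M₁ + r M₂) - η (+ 3) * (r M₀ * r M₁ + r M₁ * r M₂ + r M₂ * r M₀))
          ≈⟨ *-congˡ (+-cong (*-cong r-sum r-sum) (-‿cong (*-congˡ r-pairs))) ⟩
        η (+ 27) * η x * ((η a - η (+ 3)) * (η a - η (+ 3)) - η (+ 3) * η (+ 3))
          ≈⟨ lincomb₁ (η (+ 27) * (η a - η (+ 6))) (solve 2 (λ x a → con (+ 27) :* x :* ((a :- con (+ 3)) :* (a :- con (+ 3))
              :- con (+ 3) :* con (+ 3)) := con (+ 27) :* (a :- con (+ 6)) :+ (con (+ 27) :* (a :- con (+ 6))) :* (a :* x :- con (+ 1)))
              refl (η x) (η a)) ax≈η1 ⟩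
        η (+ 27) * (η a - η (+ 6)) ∎

-- Solution of the cubic by radicals and the action of Frobenius

module Kummer (K : ℤAlgebra) (p : ℕ) (p-prime : Prime p) (1<p : 1 ℕ.< p) (ηp≈0 : ℤAlgebra._≈_ K (ℤAlgebra.η K (+ p)) (ℤAlgebra.0# K)) where
  open ℤAlgebra K
  open AlgebraProperties K
  open CharP K p p-prime 1<p ηp≈0
  open ThreeRoots K p p-prime 1<p ηp≈0
  open Relation.Binary.Reasoning.Setoid setoid

  -- √-3 is represented by 1 + 2ω. As (c+√-3)(c-√-3) = c²+3, the quotient (c+√-3)/(c-√-3) can be
  -- written w (c+√-3)², without inverting in the ring; ν is the inverse of μ.
  record Radicals (c w t i : ℤ) : Set where
    field
      ω μ ν  : Carrier
      ω-root : η (+ 1) + ω + ω ^ 2 ≈ η (+ 0)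
      μν≈1   : μ * ν ≈ η (+ 1)
      wc≈1   : η w * (η c * η c + η (+ 3)) ≈ η (+ 1)
      3t≈1   : η (+ 3) * η t ≈ η (+ 1)
      2ci≈1  : η (+ 2) * η c * η i ≈ η (+ 1)
      μ³     : μ ^ 3 ≈ η w * (η c + (η (+ 1) + η (+ 2) * ω)) ^ 2
      ν³     : ν ^ 3 ≈ η w * (η c - (η (+ 1) + η (+ 2) * ω)) ^ 2

  module RadicalProperties {c w t i : ℤ} (𝓡 : Radicals c w t i) where
    open Radicals 𝓡

    M : ℕ → Carrier
    M k = ω ^ k * μ + ω ^ (2 ℕ.* k) * ν

    -- The same elements as `M 0`, `M 1`, `M 2` with ω² replaced by -(1+ω), which keeps the
    -- polynomial identities small; the form `M k` suits the Frobenius shifts.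
    M₀ M₁ M₂ : Carrier
    M₀ = μ + ν
    M₁ = ω * μ + (- (η (+ 1) + ω)) * ν
    M₂ = (- (η (+ 1) + ω)) * μ + ω * ν

    M0≈M₀ : M 0 ≈ M₀
    M0≈M₀ = +-cong (*-identityˡ μ) (*-identityˡ ν)

    M1≈M₁ : M 1 ≈ M₁
    M1≈M₁ = lincomb₁ ν (solve 3 (λ o m n → o :^ 1 :* m :+ o :^ 2 :* n := o :* m :+ (:- (con (+ 1) :+ o)) :* n
        :+ n :* (con (+ 1) :+ o :+ o :^ 2 :- con (+ 0))) refl ω μ ν) ω-root

    M2≈M₂ : M 2 ≈ M₂
    M2≈M₂ = lincomb₁ (μ + (ω ^ 2 - ω) * ν)
      (solve 3 (λ o m n → o :^ 2 :* m :+ o :^ 4 :* n := (:- (con (+ 1) :+ o)) :* m :+ o :* n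
          :+ (m :+ (o :^ 2 :- o) :* n) :* (con (+ 1) :+ o :+ o :^ 2 :- con (+ 0))) refl ω μ ν) ω-root

    ω³≈1 : ω ^ 3 ≈ 1#
    ω³≈1 = trans (lincomb₁ (ω - η (+ 1)) (solve 1 (λ o → o :^ 3 := con (+ 1) :+ (o :- con (+ 1)) :* (con (+ 1) :+ o :+ o :^ 2 :- con (+ 0)))
        refl ω) ω-root) η-1

    ω^[3+n] : ∀ n → ω ^ (3 ℕ.+ n) ≈ ω ^ n
    ω^[3+n] n = trans (^-homo-* ω 3 n) (trans (*-congʳ ω³≈1) (*-identityˡ _))

    M[3+k]≈Mk : ∀ k → M (3 ℕ.+ k) ≈ M k
    M[3+k]≈Mk k = +-cong (*-congʳ (ω^[3+n] k)) (*-congʳ (begin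
      ω ^ (2 ℕ.* (3 ℕ.+ k))         ≈⟨ ^-congʳ ω (ℕ.*-distribˡ-+ 2 3 k) ⟩
      ω ^ (3 ℕ.+ (3 ℕ.+ 2 ℕ.* k))   ≈⟨ ω^[3+n] (3 ℕ.+ 2 ℕ.* k) ⟩
      ω ^ (3 ℕ.+ 2 ℕ.* k)           ≈⟨ ω^[3+n] (2 ℕ.* k) ⟩
      ω ^ (2 ℕ.* k)                 ∎))

    M-sum : M₀ + M₁ + M₂ ≈ η (+ 0)
    M-sum = solve 3 (λ o m n → m :+ n :+ (o :* m :+ (:- (con (+ 1) :+ o)) :* n) :+ ((:- (con (+ 1) :+ o)) :* m :+ o :* n) := con (+ 0)) refl
        ω μ ν

    M-pairs : M₀ * M₁ + M₁ * M₂ + M₂ * M₀ ≈ η -[1+ 2 ]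
    M-pairs = lincomb₂ (- ((μ - ν) ^ 2)) (η -[1+ 2 ])
      (solve 3 (λ o m n → (m :+ n) :* (o :* m :+ (:- (con (+ 1) :+ o)) :* n) :+ (o :* m :+ (:- (con (+ 1) :+ o)) :* n) :*
          ((:- (con (+ 1) :+ o)) :* m :+ o :* n) :+ ((:- (con (+ 1) :+ o)) :* m :+ o :* n) :* (m :+ n)
         := con -[1+ 2 ] :+ (:- ((m :- n) :^ 2)) :* (con (+ 1) :+ o :+ o :^ 2 :- con (+ 0)) :+ con -[1+ 2 ] :* (m :* n :- con (+ 1))) refl ω
             μ ν)
      ω-root μν≈1

    -- The product is μ³ + ν³ = w(2c² - 6), and w(c²+3) = 1 turns it into 2 - 12w.
    M-product : M₀ * M₁ * M₂ ≈ η (+ 2) - η (+ 12) * η w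
    M-product = lincomb₁ (η (+ 2)) (lincomb₃ (η (+ 8) * η w - (μ + ν) * (μ - ν) ^ 2) (η (+ 1)) (η (+ 1))
      (solve 5 (λ o m n c w → (m :+ n) :* (o :* m :+ (:- (con (+ 1) :+ o)) :* n) :* ((:- (con (+ 1) :+ o)) :* m :+ o :* n)
         := con (+ 2) :- con (+ 12) :* w :+ con (+ 2) :* (w :* (c :* c :+ con (+ 3)) :- con (+ 1))
             :+ (con (+ 8) :* w :- (m :+ n) :* (m :- n) :^ 2) :* (con (+ 1) :+ o :+ o :^ 2 :- con (+ 0))
          :+ con (+ 1) :* (m :^ 3 :- w :* (c :+ (con (+ 1) :+ con (+ 2) :* o)) :^ 2) :+ con (+ 1) :* (n :^ 3
              :- w :* (c :- (con (+ 1) :+ con (+ 2) :* o)) :^ 2)) refl ω μ ν (η c) (η w))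
      ω-root μ³ ν³) wc≈1

    -- The determinant is 3√-3 (μ³ - ν³), and μ³ - ν³ = 4cw√-3.
    M-vandermonde : vandermonde M₀ M₁ M₂ ≈ - (η (+ 36) * η c * η w)
    M-vandermonde = lincomb₃ (η (+ 48) * η c * η w - (η (+ 1) + η (+ 2) * ω) * (μ - ν) ^ 3) (η (+ 3) * (η (+ 1) + η (+ 2) * ω))
        (- (η (+ 3) * (η (+ 1) + η (+ 2) * ω)))
      (solve 5 (λ o m n c w → (m :+ n) :^ 2 :* ((o :* m :+ (:- (con (+ 1) :+ o)) :* n) :- ((:- (con (+ 1) :+ o)) :* m :+ o :* n))
          :+ (o :* m :+ (:- (con (+ 1) :+ o)) :* n) :^ 2 :* (((:- (con (+ 1) :+ o)) :* m :+ o :* n) :- (m :+ n))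
          :+ ((:- (con (+ 1) :+ o)) :* m :+ o :* n) :^ 2 :* ((m :+ n) :- (o :* m :+ (:- (con (+ 1) :+ o)) :* n))
         := (:- (con (+ 36) :* c :* w)) :+ (con (+ 48) :* c :* w :- (con (+ 1) :+ con (+ 2) :* o) :* (m :- n) :^ 3) :* (con (+ 1) :+ o
             :+ o :^ 2 :- con (+ 0))
          :+ (con (+ 3) :* (con (+ 1) :+ con (+ 2) :* o)) :* (m :^ 3 :- w :* (c :+ (con (+ 1) :+ con (+ 2) :* o)) :^ 2)
              :+ (:- (con (+ 3) :* (con (+ 1) :+ con (+ 2) :* o))) :* (n :^ 3 :- w :* (c :- (con (+ 1) :+ con (+ 2) :* o)) :^ 2)) refl ω μ ν
              (η c) (η w))
      ω-root μ³ ν³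

    cancel-3 : ∀ {X Y} → η (+ 3) * X ≈ η (+ 3) * Y → X ≈ Y
    cancel-3 {X} {Y} h = lincomb₂ (η t) (Y - X) (solve 3 (λ t x y → x := y :+ t :* (con (+ 3) :* x :- con (+ 3) :* y)
        :+ (y :- x) :* (con (+ 3) :* t :- con (+ 1))) refl (η t) X Y) h 3t≈1

    cancel-81 : ∀ {X Y} → η (+ 81) * X ≈ η (+ 81) * Y → X ≈ Y
    cancel-81 {X} {Y} h = cancel-3 (cancel-3 (cancel-3 (cancel-3 (trans (sym (lemma X)) (trans h (lemma Y))))))
      where
      lemma : ∀ x → η (+ 81) * x ≈ η (+ 3) * (η (+ 3) * (η (+ 3) * (η (+ 3) * x)))
      lemma = solve 1 (λ x → con (+ 81) :* x := con (+ 3) :* (con (+ 3) :* (con (+ 3) :* (con (+ 3) :* x)))) refl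

    divide-2c : ∀ {X Y} → η (+ 2) * η c * X ≈ Y → X ≈ Y * η i
    divide-2c {X} {Y} h = lincomb₂ (η i) (- X) (solve 4 (λ c i x y → x := y :* i :+ i :* (con (+ 2) :* c :* x :- y)
        :+ (:- x) :* (con (+ 2) :* c :* i :- con (+ 1))) refl (η c) (η i) X Y) h 2ci≈1

    FrobeniusShift : ℕ → Set
    FrobeniusShift j = ∀ k → M k ^ p ≈ M (j ℕ.+ k)

    module _ (frob : FrobeniusShift 0) where
      fixed₀ : M₀ ^ p ≈ M₀
      fixed₀ = trans (^-congˡ p (sym M0≈M₀)) (trans (frob 0) M0≈M₀)
      fixed₁ : M₁ ^ p ≈ M₁
      fixed₁ = trans (^-congˡ p (sym M1≈M₁)) (trans (frob 1) M1≈M₁)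
      fixed₂ : M₂ ^ p ≈ M₂
      fixed₂ = trans (^-congˡ p (sym M2≈M₂)) (trans (frob 2) M2≈M₂)

    module _ (frob : FrobeniusShift 1) where
      shift₀ : M₀ ^ p ≈ M₁
      shift₀ = trans (^-congˡ p (sym M0≈M₀)) (trans (frob 0) M1≈M₁)
      shift₁ : M₁ ^ p ≈ M₂
      shift₁ = trans (^-congˡ p (sym M1≈M₁)) (trans (frob 1) M2≈M₂)
      shift₂ : M₂ ^ p ≈ M₀
      shift₂ = trans (^-congˡ p (sym M2≈M₂)) (trans (frob 2) (trans (M[3+k]≈Mk 0) M0≈M₀))

    module _ (frob : FrobeniusShift 2) where
      back₀ : M₀ ^ p ≈ M₂
      back₀ = trans (^-congˡ p (sym M0≈M₀)) (trans (frob 0) M2≈M₂)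
      back₁ : M₂ ^ p ≈ M₁
      back₁ = trans (^-congˡ p (sym M2≈M₂)) (trans (frob 2) (trans (M[3+k]≈Mk 1) M1≈M₁))
      back₂ : M₁ ^ p ≈ M₀
      back₂ = trans (^-congˡ p (sym M1≈M₁)) (trans (frob 1) (trans (M[3+k]≈Mk 0) M0≈M₀))

    module FirstSum (x a : ℤ) (ax≈1 : η a * η x ≈ η (+ 1)) (hx : η (+ 9) * η x ≈ η (+ 4) * η w) where

      private
        σ₃ : η (+ 27) * η x ≈ η (+ 2) - M₀ * M₁ * M₂
        σ₃ = lincomb₂ (η (+ 3)) (η (+ 1)) (solve 3 (λ x w m → con (+ 27) :* x := (con (+ 2) :- m)
            :+ con (+ 3) :* (con (+ 9) :* x :- con (+ 4) :* w) :+ con (+ 1) :* (m :- (con (+ 2) :- con (+ 12) :* w))) refl (η x) (η w)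
            (M₀ * M₁ * M₂)) hx M-product

        roots : CubicRoots x a t M₀ M₁ M₂
        roots = record { ax≈1 = trans ax≈1 η-1 ; 3t≈1 = trans 3t≈1 η-1 ; σ₁ = M-sum ; σ₂ = M-pairs ; σ₃ = σ₃ }

        -- A shift by 2 is a shift by 1 once M₁ and M₂ are exchanged. The exchange is odd and
        -- negates Γ, which is why the values for j = 1 and j = 2 differ by c ↦ -c.
        roots′ : CubicRoots x a t M₀ M₂ M₁
        roots′ = record
          { ax≈1 = trans ax≈1 η-1 ; 3t≈1 = trans 3t≈1 η-1
          ; σ₁ = trans (solve 3 (λ a b c → a :+ c :+ b := a :+ b :+ c) refl M₀ M₁ M₂) M-sum
          ; σ₂ = trans (solve 3 (λ a b c → a :* c :+ c :* b :+ b :* a := a :* b :+ b :* c :+ c :* a) refl M₀ M₁ M₂) M-pairs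
          ; σ₃ = trans σ₃ (solve 3 (λ a b c → con (+ 2) :- a :* b :* c := con (+ 2) :- a :* c :* b) refl M₀ M₁ M₂) }

        -- From -36acw with 36w = 81x and ax = 1. So Γ can be cancelled by means of the inverses of
        -- 3 and 2c.
        Γ≈ : (Roots.Γ roots) ≈ - (η (+ 81) * η c)
        Γ≈ = lincomb₃ (η a) (η (+ 9) * η c * η a) (- (η (+ 81) * η c))
          (solve 5 (λ x a c w v → a :* v := (:- (con (+ 81) :* c)) :+ a :* (v :- (:- (con (+ 36) :* c :* w)))
              :+ (con (+ 9) :* c :* a) :* (con (+ 9) :* x :- con (+ 4) :* w) :+ (:- (con (+ 81) :* c)) :* (a :* x :- con (+ 1))) refl
             (η x) (η a) (η c) (η w) (vandermonde M₀ M₁ M₂))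
          M-vandermonde hx ax≈1

        Γ′≈ : (Roots.Γ roots′) ≈ η (+ 81) * η c
        Γ′≈ = trans (solve 4 (λ a u v w → a :* (u :^ 2 :* (w :- v) :+ w :^ 2 :* (v :- u) :+ v :^ 2 :* (u :- w))
            := :- (a :* (u :^ 2 :* (v :- w) :+ v :^ 2 :* (w :- u) :+ w :^ 2 :* (u :- v)))) refl (η a) M₀ M₁ M₂)
          (trans (-‿cong Γ≈) (solve 1 (λ y → :- (:- y) := y) refl (η (+ 81) * η c)))

      value₀ : FrobeniusShift 0 → G x 0 ≈ η (+ 1)
      value₀ frob = trans (divide-2c (cancel-81 (lincomb₂ (η (+ 2) * G x 0 - η (+ 2)) (- η (+ 2))
        (solve 3 (λ c g Γ → con (+ 81) :* (con (+ 2) :* c :* g) := con (+ 81) :* (con (+ 2) :* c)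
            :+ (con (+ 2) :* g :- con (+ 2)) :* (Γ :- (:- (con (+ 81) :* c))) :+ (:- con (+ 2)) :* (g :* Γ :- Γ)) refl (η c) (G x 0)
            (Roots.Γ roots))
        Γ≈ (Roots.Fixed.G₀Γ roots (fixed₀ frob) (fixed₁ frob) (fixed₂ frob))))) 2ci≈1

      value₁ : FrobeniusShift 1 → G x 0 ≈ (- (η (+ 1) + η c)) * η i
      value₁ frob = divide-2c (cancel-81 (lincomb₂ (η (+ 2) * G x 0 + η (+ 1)) (- η (+ 1))
        (solve 3 (λ c g Γ → con (+ 81) :* (con (+ 2) :* c :* g) := con (+ 81) :* (:- (con (+ 1) :+ c))
            :+ (con (+ 2) :* g :+ con (+ 1)) :* (Γ :- (:- (con (+ 81) :* c))) :+ (:- con (+ 1)) :* (con (+ 2) :* g :* Γ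
            :- (con (+ 81) :- Γ))) refl (η c) (G x 0) (Roots.Γ roots))
        Γ≈ (Roots.Cyclic.G₀Γ roots (shift₀ frob) (shift₁ frob) (shift₂ frob))))

      value₂ : FrobeniusShift 2 → G x 0 ≈ (η (+ 1) - η c) * η i
      value₂ frob = divide-2c (cancel-81 (lincomb₂ (- (η (+ 2) * G x 0 + η (+ 1))) (η (+ 1))
        (solve 3 (λ c g Γ → con (+ 81) :* (con (+ 2) :* c :* g) := con (+ 81) :* (con (+ 1) :- c)
            :+ (:- (con (+ 2) :* g :+ con (+ 1))) :* (Γ :- con (+ 81) :* c) :+ con (+ 1) :* (con (+ 2) :* g :* Γ :- (con (+ 81) :- Γ))) refl
            (η c) (G x 0) (Roots.Γ roots′))
        Γ′≈ (Roots.Cyclic.G₀Γ roots′ (back₀ frob) (back₁ frob) (back₂ frob))))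

    module SecondSum (x a : ℤ) (ax≈1 : η a * η x ≈ η (+ 1)) (hx : η (+ 27) * η x ≈ η (+ 4) * (η c * η c) * η w) where

      private
        neg-frob : ∀ {m m′} → m ^ p ≈ m′ → (- m) ^ p ≈ - m′
        neg-frob h = trans (frobenius-neg _) (-‿cong h)

        neg-sum : - M₀ + - M₁ + - M₂ ≈ η (+ 0)
        neg-sum = lincomb₁ (η -[1+ 0 ]) (solve 3 (λ a b c → :- a :+ :- b :+ :- c := con (+ 0)
            :+ con -[1+ 0 ] :* ((a :+ b :+ c) :- con (+ 0))) refl M₀ M₁ M₂) M-sum

        neg-pairs : (- M₀) * (- M₁) + (- M₁) * (- M₂) + (- M₂) * (- M₀) ≈ η -[1+ 2 ]
        neg-pairs = trans (solve 3 (λ a b c → (:- a) :* (:- b) :+ (:- b) :* (:- c) :+ (:- c) :* (:- a) := a :* b :+ b :* c :+ c :* a) refl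
            M₀ M₁ M₂) M-pairs

        -- With negated roots the right-hand side is 2 + M₀M₁M₂ = 4 - 12w = 4c²w, again by w(c²+3) =
        -- 1; this is what ties -M to the second argument.
        σ₃ : η (+ 27) * η x ≈ η (+ 2) - (- M₀) * (- M₁) * (- M₂)
        σ₃ = lincomb₃ (η (+ 1)) (η -[1+ 0 ]) (η (+ 4))
          (solve 6 (λ x c w m n l → con (+ 27) :* x := (con (+ 2) :- (:- m) :* (:- n) :* (:- l))
              :+ con (+ 1) :* (con (+ 27) :* x :- con (+ 4) :* (c :* c) :* w) :+ con -[1+ 0
              ] :* (m :* n :* l :- (con (+ 2) :- con (+ 12) :* w)) :+ con (+ 4) :* (w :* (c :* c :+ con (+ 3)) :- con (+ 1))) refl
            (η x) (η c) (η w) M₀ M₁ M₂) hx M-product wc≈1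

        roots : CubicRoots x a t (- M₀) (- M₁) (- M₂)
        roots = record { ax≈1 = trans ax≈1 η-1 ; 3t≈1 = trans 3t≈1 η-1 ; σ₁ = neg-sum ; σ₂ = neg-pairs ; σ₃ = σ₃ }

        roots′ : CubicRoots x a t (- M₀) (- M₂) (- M₁)
        roots′ = record
          { ax≈1 = trans ax≈1 η-1 ; 3t≈1 = trans 3t≈1 η-1
          ; σ₁ = trans (solve 3 (λ a b c → a :+ c :+ b := a :+ b :+ c) refl (- M₀) (- M₁) (- M₂)) neg-sum
          ; σ₂ = trans (solve 3 (λ a b c → a :* c :+ c :* b :+ b :* a := a :* b :+ b :* c :+ c :* a) refl (- M₀) (- M₁) (- M₂)) neg-pairs
          ; σ₃ = trans σ₃ (solve 3 (λ a b c → con (+ 2) :- a :* b :* c := con (+ 2) :- a :* c :* b) refl (- M₀) (- M₁) (- M₂)) }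

        -- Γ is 36acw here, so cΓ = 9a · 4c²w = 9a · 27x = 243.
        Γ≈ : η c * (Roots.Γ roots) ≈ η (+ 243)
        Γ≈ = lincomb₃ (- (η c * η a)) (- (η (+ 9) * η a)) (η (+ 243))
          (solve 7 (λ x a c w m n l → c :* (a :* ((:- m) :^ 2 :* (:- n :- :- l) :+ (:- n) :^ 2 :* (:- l :- :- m)
              :+ (:- l) :^ 2 :* (:- m :- :- n)))
             := con (+ 243) :+ (:- (c :* a)) :* ((m :^ 2 :* (n :- l) :+ n :^ 2 :* (l :- m) :+ l :^ 2 :* (m :- n))
                 :- (:- (con (+ 36) :* c :* w)))
               :+ (:- (con (+ 9) :* a)) :* (con (+ 27) :* x :- con (+ 4) :* (c :* c) :* w) :+ con (+ 243) :* (a :* x :- con (+ 1))) refl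
             (η x) (η a) (η c) (η w) M₀ M₁ M₂)
          M-vandermonde hx ax≈1

        Γ′≈ : η c * (Roots.Γ roots′) ≈ η -[1+ 242 ]
        Γ′≈ = trans (solve 5 (λ d a u v w → d :* (a :* (u :^ 2 :* (w :- v) :+ w :^ 2 :* (v :- u) :+ v :^ 2 :* (u :- w)))
            := :- (d :* (a :* (u :^ 2 :* (v :- w) :+ v :^ 2 :* (w :- u) :+ w :^ 2 :* (u :- v))))) refl (η c) (η a) (- M₀) (- M₁) (- M₂))
          (trans (-‿cong Γ≈) (sym (η-neg (+ 243))))

        4c²a≈ : η (+ 4) * (η c * η c) * η a ≈ η (+ 27) * (η c * η c + η (+ 3))
        4c²a≈ = lincomb₃ (- (η a * (η c * η c + η (+ 3)))) (η (+ 27) * (η c * η c + η (+ 3))) (- (η (+ 4) * (η c * η c) * η a))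
          (solve 4 (λ x a c w → con (+ 4) :* (c :* c) :* a := con (+ 27) :* (c :* c :+ con (+ 3))
              :+ (:- (a :* (c :* c :+ con (+ 3)))) :* (con (+ 27) :* x :- con (+ 4) :* (c :* c) :* w)
             :+ (con (+ 27) :* (c :* c :+ con (+ 3))) :* (a :* x :- con (+ 1)) :+ (:- (con (+ 4) :* (c :* c) :* a)) :*
                 (w :* (c :* c :+ con (+ 3)) :- con (+ 1))) refl (η x) (η a) (η c) (η w))
          hx ax≈1 wc≈1

        cancel-243 : ∀ {X Y} → η (+ 243) * X ≈ η (+ 243) * Y → X ≈ Y
        cancel-243 {X} {Y} h = cancel-3 (cancel-81 (trans (sym (lemma X)) (trans h (lemma Y))))
          where
          lemma : ∀ x → η (+ 243) * x ≈ η (+ 81) * (η (+ 3) * x)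
          lemma = solve 1 (λ x → con (+ 243) :* x := con (+ 81) :* (con (+ 3) :* x)) refl

      S : Carrier
      S = G x 0 - η (+ 2) * G x 1

      value₀ : FrobeniusShift 0 → S ≈ η (+ 1)
      value₀ frob = cancel-243 (lincomb₃ (η c) (- (η (+ 2) * η c)) (- (S - η (+ 1)))
        (solve 4 (λ c g h Γ → con (+ 243) :* (g :- con (+ 2) :* h) := con (+ 243) :* con (+ 1) :+ c :* (g :* Γ :- Γ)
            :+ (:- (con (+ 2) :* c)) :* (h :* Γ :- con (+ 0)) :+ (:- ((g :- con (+ 2) :* h) :- con (+ 1))) :* (c :* Γ :- con (+ 243))) refl
            (η c) (G x 0) (G x 1) (Roots.Γ roots))
        (Roots.Fixed.G₀Γ roots (neg-frob (fixed₀ frob)) (neg-frob (fixed₁ frob)) (neg-frob (fixed₂ frob)))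
            (Roots.Fixed.G₁Γ roots (neg-frob (fixed₀ frob)) (neg-frob (fixed₁ frob)) (neg-frob (fixed₂ frob))) Γ≈)

      -- The two Cramer values give 2SΓ = 729 - 108a - Γ. After multiplication by c², the relations
      -- 4c²a = 27(c²+3) and cΓ = 243 cancel the terms in c² and leave 243 · 2cS = -243(9+c).
      value₁ : FrobeniusShift 1 → S ≈ (- (η (+ 9) + η c)) * η i
      value₁ frob = divide-2c (cancel-243 (lincomb₁ (- η (+ 27)) (lincomb₃ (η c * η c) (- (η (+ 4) * (η c * η c)))
          (- (η (+ 2) * η c * S + η c))
        (solve 5 (λ c a g h Γ → con (+ 243) :* (con (+ 2) :* c :* (g :- con (+ 2) :* h)) := con (+ 243) :* (:- (con (+ 9) :+ c))
            :+ (:- con (+ 27)) :* (con (+ 4) :* (c :* c) :* a :- con (+ 27) :* (c :* c :+ con (+ 3)))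
            :+ (c :* c) :* (con (+ 2) :* g :* Γ :- (con (+ 81) :- Γ)) :+ (:- (con (+ 4) :* (c :* c))) :* (h :* Γ
                :- con (+ 27) :* (a :- con (+ 6)))
            :+ (:- (con (+ 2) :* c :* (g :- con (+ 2) :* h) :+ c)) :* (c :* Γ :- con (+ 243))) refl (η c) (η a) (G x 0) (G x 1)
                (Roots.Γ roots))
        (Roots.Cyclic.G₀Γ roots (neg-frob (shift₀ frob)) (neg-frob (shift₁ frob)) (neg-frob (shift₂ frob)))
            (Roots.Cyclic.G₁Γ roots (neg-frob (shift₀ frob)) (neg-frob (shift₁ frob)) (neg-frob (shift₂ frob))) Γ≈) 4c²a≈))

      value₂ : FrobeniusShift 2 → S ≈ (η (+ 9) - η c) * η i
      value₂ frob = divide-2c (cancel-243 (lincomb₁ (η (+ 27)) (lincomb₃ (- (η c * η c)) (η (+ 4) * (η c * η c)) (η (+ 2) * η c * S + η c)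
        (solve 5 (λ c a g h Γ → con (+ 243) :* (con (+ 2) :* c :* (g :- con (+ 2) :* h)) := con (+ 243) :* (con (+ 9) :- c)
            :+ con (+ 27) :* (con (+ 4) :* (c :* c) :* a :- con (+ 27) :* (c :* c :+ con (+ 3)))
            :+ (:- (c :* c)) :* (con (+ 2) :* g :* Γ :- (con (+ 81) :- Γ)) :+ (con (+ 4) :* (c :* c)) :* (h :* Γ
                :- con (+ 27) :* (a :- con (+ 6)))
            :+ (con (+ 2) :* c :* (g :- con (+ 2) :* h) :+ c) :* (c :* Γ :- con -[1+ 242 ])) refl (η c) (η a) (G x 0) (G x 1)
                (Roots.Γ roots′))
        (Roots.Cyclic.G₀Γ roots′ (neg-frob (back₀ frob)) (neg-frob (back₁ frob)) (neg-frob (back₂ frob)))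
            (Roots.Cyclic.G₁Γ roots′ (neg-frob (back₀ frob)) (neg-frob (back₁ frob)) (neg-frob (back₂ frob))) Γ′≈) 4c²a≈))

    l l′ : Carrier
    l  = η c + (η (+ 1) + η (+ 2) * ω)
    l′ = η c - (η (+ 1) + η (+ 2) * ω)

    l′wl≈1 : l′ * (η w * l) ≈ 1#
    l′wl≈1 = trans (lincomb₂ (η (+ 1)) (- (η (+ 4) * η w))
      (solve 3 (λ c w o → (c :- (con (+ 1) :+ con (+ 2) :* o)) :* (w :* (c :+ (con (+ 1) :+ con (+ 2) :* o))) := con (+ 1)
          :+ con (+ 1) :* (w :* (c :* c :+ con (+ 3)) :- con (+ 1)) :+ (:- (con (+ 4) :* w)) :* (con (+ 1) :+ o :+ o :^ 2 :- con (+ 0)))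
          refl (η c) (η w) ω)
      wc≈1 ω-root) η-1

    -- μ³ = l · (w l), and w l is the inverse of `l′` by `l′wl≈1`; the right-hand side is (l/l′)^n.
    μ^[3*n] : ∀ n → μ ^ (3 ℕ.* n) ≈ l ^ n * (η w * l) ^ n
    μ^[3*n] n = begin
      μ ^ (3 ℕ.* n)          ≈⟨ ^-assocʳ μ 3 n ⟨
      (μ ^ 3) ^ n            ≈⟨ ^-congˡ n (trans μ³ (solve 2 (λ w l → w :* l :^ 2 := l :* (w :* l)) refl (η w) l)) ⟩
      (l * (η w * l)) ^ n    ≈⟨ ^-distrib-* _ _ n ⟩
      l ^ n * (η w * l) ^ n  ∎

    ω^[3*n]≈1 : ∀ n → ω ^ (3 ℕ.* n) ≈ 1#
    ω^[3*n]≈1 n = trans (sym (^-assocʳ ω 3 n)) (trans (^-congˡ n ω³≈1) (1^n≈1 n))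

    ω^j*ω^2j≈1 : ∀ j → ω ^ j * ω ^ (2 ℕ.* j) ≈ 1#
    ω^j*ω^2j≈1 j = trans (sym (^-homo-* ω j (2 ℕ.* j))) (ω^[3*n]≈1 j)

    μ^p*ν^p≈1 : μ ^ p * ν ^ p ≈ 1#
    μ^p*ν^p≈1 = ^-*-inverse p (trans μν≈1 η-1)

    inverse-unique : ∀ {x y z} → x * y ≈ 1# → y * z ≈ 1# → x ≈ z
    inverse-unique {x} {y} {z} xy yz = begin
      x            ≈⟨ *-identityʳ x ⟨
      x * 1#       ≈⟨ *-congˡ yz ⟨
      x * (y * z)  ≈⟨ *-assoc x y z ⟨
      x * y * z    ≈⟨ *-congʳ xy ⟩
      1# * z       ≈⟨ *-identityˡ z ⟩
      z            ∎

    twisted-inverse : ∀ j → (ω ^ j * μ) * (ω ^ (2 ℕ.* j) * ν) ≈ 1#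
    twisted-inverse j = trans (solve 4 (λ a m b n → (a :* m) :* (b :* n) := (a :* b) :* (m :* n)) refl (ω ^ j) μ (ω ^ (2 ℕ.* j)) ν)
      (trans (*-cong (ω^j*ω^2j≈1 j) (trans μν≈1 η-1)) (*-identityʳ 1#))

    swap-powers : ∀ x m n → (x ^ m) ^ n ≈ (x ^ n) ^ m
    swap-powers x m n = trans (^-assocʳ x m n) (trans (^-congʳ x (ℕ.*-comm m n)) (sym (^-assocʳ x n m)))

    M-frobenius : ∀ k → M k ^ p ≈ (ω ^ p) ^ k * μ ^ p + (ω ^ p) ^ (2 ℕ.* k) * ν ^ p
    M-frobenius k = trans (frobenius-+ _ _) (+-cong
      (trans (^-distrib-* _ _ p) (*-congʳ (swap-powers ω k p)))
      (trans (^-distrib-* _ _ p) (*-congʳ (swap-powers ω (2 ℕ.* k) p))))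

    M-shift : ∀ j k → ω ^ k * (ω ^ j * μ) + ω ^ (2 ℕ.* k) * (ω ^ (2 ℕ.* j) * ν) ≈ M (j ℕ.+ k)
    M-shift j k = +-cong
      (trans (solve 3 (λ a b m → a :* (b :* m) := (b :* a) :* m) refl (ω ^ k) (ω ^ j) μ) (*-congʳ (sym (^-homo-* ω j k))))
      (trans (solve 3 (λ a b m → a :* (b :* m) := (b :* a) :* m) refl (ω ^ (2 ℕ.* k)) (ω ^ (2 ℕ.* j)) ν)
        (*-congʳ (trans (sym (^-homo-* ω (2 ℕ.* j) (2 ℕ.* k))) (^-congʳ ω (≡.sym (ℕ.*-distribˡ-+ 2 j k))))))

    -- Here μ^p = μ (μ³)^n = μ (l/l′)^n = ω^j μ, its inverse gives ν^p, and ω^p = ω.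
    frobeniusShift-1mod3 : ∀ n → p ≡ suc (3 ℕ.* n) → ∀ j → l ^ n ≈ ω ^ j * l′ ^ n → FrobeniusShift j
    frobeniusShift-1mod3 n p≡ j h k = begin
      M k ^ p                                                          ≈⟨ M-frobenius k ⟩
      (ω ^ p) ^ k * μ ^ p + (ω ^ p) ^ (2 ℕ.* k) * ν ^ p                ≈⟨ +-cong (*-cong (^-congˡ k ω^p) μ^p)
          (*-cong (^-congˡ (2 ℕ.* k) ω^p) ν^p) ⟩
      ω ^ k * (ω ^ j * μ) + ω ^ (2 ℕ.* k) * (ω ^ (2 ℕ.* j) * ν)        ≈⟨ M-shift j k ⟩
      M (j ℕ.+ k)                                                      ∎
      where
      ω^p : ω ^ p ≈ ω
      ω^p = trans (^-congʳ ω p≡) (trans (*-congˡ (ω^[3*n]≈1 n)) (*-identityʳ ω))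
      μ^p : μ ^ p ≈ ω ^ j * μ
      μ^p = begin
        μ ^ p                                    ≈⟨ ^-congʳ μ p≡ ⟩
        μ * μ ^ (3 ℕ.* n)                        ≈⟨ *-congˡ (trans (μ^[3*n] n) (*-congʳ h)) ⟩
        μ * (ω ^ j * l′ ^ n * (η w * l) ^ n)     ≈⟨ solve 4 (λ m a b c → m :* (a :* b :* c) := a :* m :* (b :* c)) refl μ (ω ^ j) (l′ ^ n)
            ((η w * l) ^ n) ⟩
        ω ^ j * μ * (l′ ^ n * (η w * l) ^ n)     ≈⟨ *-congˡ (^-*-inverse n l′wl≈1) ⟩
        ω ^ j * μ * 1#                           ≈⟨ *-identityʳ _ ⟩
        ω ^ j * μ                                ∎
      ν^p : ν ^ p ≈ ω ^ (2 ℕ.* j) * ν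
      ν^p = inverse-unique (trans (*-congˡ (sym μ^p)) (trans (*-comm _ _) μ^p*ν^p≈1)) (twisted-inverse j)

    -- Now p+1 = 3(n+1), so μ^(p+1) = (l/l′)^(n+1) is the inverse of ω^j. Hence μ^p is a multiple of
    -- ν, ν^p is a multiple of μ, and ω^p = ω² is the inverse of ω: the two summands of `M k` trade
    -- places and the same shift results.
    frobeniusShift-2mod3 : ∀ n → p ≡ 2 ℕ.+ 3 ℕ.* n → ∀ j → l′ ^ suc n ≈ ω ^ j * l ^ suc n → FrobeniusShift j
    frobeniusShift-2mod3 n p≡ j h k = begin
      M k ^ p                                                          ≈⟨ M-frobenius k ⟩
      (ω ^ p) ^ k * μ ^ p + (ω ^ p) ^ (2 ℕ.* k) * ν ^ p                ≈⟨ +-cong (*-cong (trans (^-congˡ k ω^p) (^-assocʳ ω 2 k)) μ^p)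
          (*-cong ω^4k ν^p) ⟩
      ω ^ (2 ℕ.* k) * (ω ^ (2 ℕ.* j) * ν) + ω ^ k * (ω ^ j * μ)        ≈⟨ +-comm _ _ ⟩
      ω ^ k * (ω ^ j * μ) + ω ^ (2 ℕ.* k) * (ω ^ (2 ℕ.* j) * ν)        ≈⟨ M-shift j k ⟩
      M (j ℕ.+ k)                                                      ∎
      where
      ω^p : ω ^ p ≈ ω ^ 2
      ω^p = trans (^-congʳ ω p≡) (trans (^-homo-* ω 2 (3 ℕ.* n)) (trans (*-congˡ (ω^[3*n]≈1 n)) (*-identityʳ _)))
      ω^4k : (ω ^ p) ^ (2 ℕ.* k) ≈ ω ^ k
      ω^4k = begin
        (ω ^ p) ^ (2 ℕ.* k)     ≈⟨ ^-congˡ (2 ℕ.* k) ω^p ⟩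
        (ω ^ 2) ^ (2 ℕ.* k)     ≈⟨ ^-assocʳ (ω ^ 2) 2 k ⟨
        ((ω ^ 2) ^ 2) ^ k       ≈⟨ ^-congˡ k (trans (^-assocʳ ω 2 2) (trans (ω^[3+n] 1) (*-identityʳ ω))) ⟩
        ω ^ k                   ∎
      μ^p⁺ : (ω ^ j * μ) * μ ^ p ≈ 1#
      μ^p⁺ = begin
        (ω ^ j * μ) * μ ^ p                              ≈⟨ *-assoc _ _ _ ⟩
        ω ^ j * μ ^ suc p                                ≈⟨ *-congˡ (trans (^-congʳ μ (≡.trans (≡.cong suc p≡) (≡.sym (ℕ.*-suc 3 n))))
            (μ^[3*n] (suc n))) ⟩
        ω ^ j * (l ^ suc n * (η w * l) ^ suc n)          ≈⟨ *-assoc _ _ _ ⟨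
        ω ^ j * l ^ suc n * (η w * l) ^ suc n            ≈⟨ *-congʳ h ⟨
        l′ ^ suc n * (η w * l) ^ suc n                   ≈⟨ ^-*-inverse (suc n) l′wl≈1 ⟩
        1#                                               ∎
      μ^p : μ ^ p ≈ ω ^ (2 ℕ.* j) * ν
      μ^p = inverse-unique (trans (*-comm _ _) μ^p⁺) (twisted-inverse j)
      ν^p : ν ^ p ≈ ω ^ j * μ
      ν^p = inverse-unique (trans (*-congˡ (sym μ^p)) (trans (*-comm _ _) μ^p*ν^p≈1)) (trans (*-comm _ _) (twisted-inverse j))

-- Eisenstein integers, quotients and pure cubic extensions

negω : ℤω → ℤω
negω (a + b ω) = (ℤ.- a) + (ℤ.- b) ω

ℤω-commutativeRing : CommutativeRing 0ℓ 0ℓ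
ℤω-commutativeRing = record
  { Carrier = ℤω ; _≈_ = _≡_ ; _+_ = _+ω_ ; _*_ = _*ω_ ; -_ = negω ; 0# = ι (+ 0) ; 1# = ι (+ 1)
  ; isCommutativeRing = record
    { isRing = record
      { +-isAbelianGroup = record
        { isGroup = record
          { isMonoid = record
            { isSemigroup = record
              { isMagma = record { isEquivalence = ≡.isEquivalence ; ∙-cong = ≡.cong₂ _+ω_ }
              ; assoc = λ { (a + b ω) (c + d ω) (e + f ω) → ≡.cong₂ _+_ω (ℤ.+-assoc a c e) (ℤ.+-assoc b d f) } }
            ; identity = (λ { (a + b ω) → ≡.cong₂ _+_ω (ℤ.+-identityˡ a) (ℤ.+-identityˡ b) })
                       , (λ { (a + b ω) → ≡.cong₂ _+_ω (ℤ.+-identityʳ a) (ℤ.+-identityʳ b) }) }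
          ; inverse = (λ { (a + b ω) → ≡.cong₂ _+_ω (ℤ.+-inverseˡ a) (ℤ.+-inverseˡ b) })
                    , (λ { (a + b ω) → ≡.cong₂ _+_ω (ℤ.+-inverseʳ a) (ℤ.+-inverseʳ b) })
          ; ⁻¹-cong = ≡.cong negω }
        ; comm = λ { (a + b ω) (c + d ω) → ≡.cong₂ _+_ω (ℤ.+-comm a c) (ℤ.+-comm b d) } }
      ; *-cong = ≡.cong₂ _*ω_
      ; *-assoc = λ { (a + b ω) (c + d ω) (e + f ω) → ≡.cong₂ _+_ω (assoc-re a b c d e f) (assoc-im a b c d e f) }
      ; *-identity = (λ { (a + b ω) → ≡.cong₂ _+_ω (idˡ-re a b) (idˡ-im a b) })
                   , (λ { (a + b ω) → ≡.cong₂ _+_ω (idʳ-re a b) (idʳ-im a b) })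
      ; distrib = (λ { (a + b ω) (c + d ω) (e + f ω) → ≡.cong₂ _+_ω (distribˡ-re a b c d e f) (distribˡ-im a b c d e f) })
                , (λ { (a + b ω) (c + d ω) (e + f ω) → ≡.cong₂ _+_ω (distribʳ-re a b c d e f) (distribʳ-im a b c d e f) }) }
    ; *-comm = λ { (a + b ω) (c + d ω) → ≡.cong₂ _+_ω (comm-re a b c d) (comm-im a b c d) } }
  }
  where
  open import Data.Integer using (_-_; _*_) renaming (_+_ to _⊕_)
  assoc-re : ∀ a b c d e f → (a * c - b * d) * e - (a * d ⊕ b * c - b * d) * f ≡ a * (c * e - d * f) - b * (c * f ⊕ d * e - d * f)
  assoc-re = ℤ-Tactic.solve-∀
  assoc-im : ∀ a b c d e f → (a * c - b * d) * f ⊕ (a * d ⊕ b * c - b * d) * e - (a * d ⊕ b * c - b * d) * f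
                           ≡ a * (c * f ⊕ d * e - d * f) ⊕ b * (c * e - d * f) - b * (c * f ⊕ d * e - d * f)
  assoc-im = ℤ-Tactic.solve-∀
  idˡ-re : ∀ a b → + 1 * a - + 0 * b ≡ a
  idˡ-re = ℤ-Tactic.solve-∀
  idˡ-im : ∀ a b → + 1 * b ⊕ + 0 * a - + 0 * b ≡ b
  idˡ-im = ℤ-Tactic.solve-∀
  idʳ-re : ∀ a b → a * + 1 - b * + 0 ≡ a
  idʳ-re = ℤ-Tactic.solve-∀
  idʳ-im : ∀ a b → a * + 0 ⊕ b * + 1 - b * + 0 ≡ b
  idʳ-im = ℤ-Tactic.solve-∀
  distribˡ-re : ∀ a b c d e f → a * (c ⊕ e) - b * (d ⊕ f) ≡ (a * c - b * d) ⊕ (a * e - b * f)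
  distribˡ-re = ℤ-Tactic.solve-∀
  distribˡ-im : ∀ a b c d e f → a * (d ⊕ f) ⊕ b * (c ⊕ e) - b * (d ⊕ f) ≡ (a * d ⊕ b * c - b * d) ⊕ (a * f ⊕ b * e - b * f)
  distribˡ-im = ℤ-Tactic.solve-∀
  distribʳ-re : ∀ a b c d e f → (c ⊕ e) * a - (d ⊕ f) * b ≡ (c * a - d * b) ⊕ (e * a - f * b)
  distribʳ-re = ℤ-Tactic.solve-∀
  distribʳ-im : ∀ a b c d e f → (c ⊕ e) * b ⊕ (d ⊕ f) * a - (d ⊕ f) * b ≡ (c * b ⊕ d * a - d * b) ⊕ (e * b ⊕ f * a - f * b)
  distribʳ-im = ℤ-Tactic.solve-∀
  comm-re : ∀ a b c d → a * c - b * d ≡ c * a - d * b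
  comm-re = ℤ-Tactic.solve-∀
  comm-im : ∀ a b c d → a * d ⊕ b * c - b * d ≡ c * b ⊕ d * a - d * b
  comm-im = ℤ-Tactic.solve-∀

ℤω-algebra : ℤAlgebra
ℤω-algebra = record
  { commRing = ℤω-commutativeRing ; η = ι
  ; η-+ = λ m n → ≡.refl
  ; η-* = λ m n → ≡.cong₂ _+_ω (ι-*-re m n) (ι-*-im m n)
  ; η-neg = λ m → ≡.refl ; η-0 = ≡.refl ; η-1 = ≡.refl }
  where
  ι-*-re : ∀ m n → m ℤ.* n ≡ m ℤ.* n ℤ.- + 0 ℤ.* + 0
  ι-*-re = ℤ-Tactic.solve-∀
  ι-*-im : ∀ m n → + 0 ≡ m ℤ.* + 0 ℤ.+ + 0 ℤ.* n ℤ.- + 0 ℤ.* + 0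
  ι-*-im = ℤ-Tactic.solve-∀

module Quotient (K : ℤAlgebra) (d : ℤAlgebra.Carrier K) where
  open ℤAlgebra K
  open AlgebraProperties K

  infix 4 _~_
  -- Over ℤ[ω] this unfolds to the congruence `_≡ω_[mod_]`, so a congruence in the definition of the
  -- character is literally an equation in the quotient ring.
  _~_ : Carrier → Carrier → Set
  x ~ y = ∃ λ z → d * z ≈ x - y

  ≈⇒~ : ∀ {x y} → x ≈ y → x ~ y
  ≈⇒~ {x} {y} h = η (+ 0) , lincomb₁ (η -[1+ 0 ]) (solve 3 (λ d x y → d :* con (+ 0) := x :- y :+ con -[1+ 0 ] :* (x :- y)) refl d x y) h

  quotientRing : CommutativeRing 0ℓ 0ℓ
  quotientRing = record
    { Carrier = Carrier ; _≈_ = _~_ ; _+_ = _+_ ; _*_ = _*_ ; -_ = -_ ; 0# = 0# ; 1# = 1#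
    ; isCommutativeRing = record
      { isRing = record
        { +-isAbelianGroup = record
          { isGroup = record
            { isMonoid = record
              { isSemigroup = record
                { isMagma = record
                  { isEquivalence = record { refl = ≈⇒~ refl ; sym = ~-sym ; trans = ~-trans }
                  ; ∙-cong = ~-+ }
                ; assoc = λ x y z → ≈⇒~ (+-assoc x y z) }
              ; identity = (λ x → ≈⇒~ (+-identityˡ x)) , (λ x → ≈⇒~ (+-identityʳ x)) }
            ; inverse = (λ x → ≈⇒~ (-‿inverseˡ x)) , (λ x → ≈⇒~ (-‿inverseʳ x))
            ; ⁻¹-cong = ~-neg }
          ; comm = λ x y → ≈⇒~ (+-comm x y) }
        ; *-cong = ~-*
        ; *-assoc = λ x y z → ≈⇒~ (*-assoc x y z)
        ; *-identity = (λ x → ≈⇒~ (*-identityˡ x)) , (λ x → ≈⇒~ (*-identityʳ x))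
        ; distrib = (λ x y z → ≈⇒~ (distribˡ x y z)) , (λ x y z → ≈⇒~ (distribʳ x y z)) }
      ; *-comm = λ x y → ≈⇒~ (*-comm x y) }
    }
    where
    ~-sym : ∀ {x y} → x ~ y → y ~ x
    ~-sym {x} {y} (z , h) = - z , lincomb₁ (η -[1+ 0 ]) (solve 4 (λ d z x y → d :* (:- z) := y :- x :+ con -[1+ 0 ] :* (d :* z :- (x :- y)))
        refl d z x y) h
    ~-trans : ∀ {x y z} → x ~ y → y ~ z → x ~ z
    ~-trans {x} {y} {z} (u , h) (v , k) = u + v ,
      lincomb₂ (η (+ 1)) (η (+ 1)) (solve 6 (λ d u v x y z → d :* (u :+ v) := x :- z :+ con (+ 1) :* (d :* u :- (x :- y))
          :+ con (+ 1) :* (d :* v :- (y :- z))) refl d u v x y z) h k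
    ~-+ : ∀ {x y u v} → x ~ y → u ~ v → x + u ~ y + v
    ~-+ {x} {y} {u} {v} (a , h) (b , k) = a + b ,
      lincomb₂ (η (+ 1)) (η (+ 1)) (solve 7 (λ d a b x y u v → d :* (a :+ b) := x :+ u :- (y :+ v) :+ con (+ 1) :* (d :* a :- (x :- y))
          :+ con (+ 1) :* (d :* b :- (u :- v))) refl d a b x y u v) h k
    ~-* : ∀ {x y u v} → x ~ y → u ~ v → x * u ~ y * v
    ~-* {x} {y} {u} {v} (a , h) (b , k) = a * u + y * b ,
      lincomb₂ u y (solve 7 (λ d a b x y u v → d :* (a :* u :+ y :* b) := x :* u :- y :* v :+ u :* (d :* a :- (x :- y))
          :+ y :* (d :* b :- (u :- v))) refl d a b x y u v) h k
    ~-neg : ∀ {x y} → x ~ y → - x ~ - y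
    ~-neg {x} {y} (a , h) = - a , lincomb₁ (η -[1+ 0 ]) (solve 4 (λ d a x y → d :* (:- a) := :- x :- :- y
        :+ con -[1+ 0 ] :* (d :* a :- (x :- y))) refl d a x y) h

  quotient : ℤAlgebra
  quotient = record
    { commRing = quotientRing ; η = η
    ; η-+ = λ m n → ≈⇒~ (η-+ m n) ; η-* = λ m n → ≈⇒~ (η-* m n) ; η-neg = λ m → ≈⇒~ (η-neg m)
    ; η-0 = ≈⇒~ η-0 ; η-1 = ≈⇒~ η-1 }

  d~0 : d ~ 0#
  d~0 = 1# , trans (*-identityʳ d) (sym (trans (+-congˡ (trans (sym (+-identityˡ _)) (-‿inverseʳ 0#))) (+-identityʳ d)))

-- The ring K[θ]/(θ³-γ) as a free module of rank three. Even when γ is a cube, equality of embedded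
-- elements is equality in K, so results proved with μ = θ descend.
module CubicExtension (K : ℤAlgebra) (γ : ℤAlgebra.Carrier K) where
  open ℤAlgebra K
  open AlgebraProperties K

  infixl 6 _⊕_
  infixl 7 _⊗_

  -- (a , b , c) stands for a + b θ + c θ², where θ³ = γ.
  E : Set
  E = Carrier × Carrier × Carrier

  _≋_ : E → E → Set
  (a , b , c) ≋ (a′ , b′ , c′) = a ≈ a′ × b ≈ b′ × c ≈ c′

  _⊕_ : E → E → E
  (a , b , c) ⊕ (a′ , b′ , c′) = a + a′ , b + b′ , c + c′

  _⊗_ : E → E → E
  (a , b , c) ⊗ (a′ , b′ , c′) = a * a′ + γ * (b * c′ + c * b′) , a * b′ + b * a′ + γ * (c * c′) , a * c′ + b * b′ + c * a′

  embed : Carrier → E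
  embed a = a , η (+ 0) , η (+ 0)

  extensionRing : CommutativeRing 0ℓ 0ℓ
  extensionRing = record
    { Carrier = E ; _≈_ = _≋_ ; _+_ = _⊕_ ; _*_ = _⊗_ ; -_ = λ (a , b , c) → - a , - b , - c ; 0# = embed (η (+ 0)) ; 1# = embed (η (+ 1))
    ; isCommutativeRing = record
      { isRing = record
        { +-isAbelianGroup = record
          { isGroup = record
            { isMonoid = record
              { isSemigroup = record
                { isMagma = record
                  { isEquivalence = record
                    { refl = refl , refl , refl
                    ; sym = λ (h , k , l) → sym h , sym k , sym l
                    ; trans = λ (h , k , l) (h′ , k′ , l′) → trans h h′ , trans k k′ , trans l l′ }
                  ; ∙-cong = λ (h , k , l) (h′ , k′ , l′) → +-cong h h′ , +-cong k k′ , +-cong l l′ }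
                ; assoc = λ _ _ _ → +-assoc _ _ _ , +-assoc _ _ _ , +-assoc _ _ _ }
              ; identity = (λ (a , b , c) → 0+ a , 0+ b , 0+ c) , (λ (a , b , c) → +0 a , +0 b , +0 c) }
            ; inverse = (λ (a , b , c) → inv′ a , inv′ b , inv′ c) , (λ (a , b , c) → inv″ a , inv″ b , inv″ c)
            ; ⁻¹-cong = λ (h , k , l) → -‿cong h , -‿cong k , -‿cong l }
          ; comm = λ _ _ → +-comm _ _ , +-comm _ _ , +-comm _ _ }
        ; *-cong = λ (h , k , l) (h′ , k′ , l′) →
            +-cong (*-cong h h′) (*-congˡ (+-cong (*-cong k l′) (*-cong l k′)))
          , +-cong (+-cong (*-cong h k′) (*-cong k h′)) (*-congˡ (*-cong l l′))
          , +-cong (+-cong (*-cong h l′) (*-cong k k′)) (*-cong l h′)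
        ; *-assoc = λ (a , b , c) (a′ , b′ , c′) (a″ , b″ , c″) →
            assoc₀ γ a b c a′ b′ c′ a″ b″ c″ , assoc₁ γ a b c a′ b′ c′ a″ b″ c″ , assoc₂ γ a b c a′ b′ c′ a″ b″ c″
        ; *-identity = (λ (a , b , c) → idˡ₀ γ a b c , idˡ₁ γ a b c , idˡ₂ a b c)
                     , (λ (a , b , c) → idʳ₀ γ a b c , idʳ₁ γ a b c , idʳ₂ a b c)
        ; distrib = (λ (a , b , c) (a′ , b′ , c′) (a″ , b″ , c″) →
                       distribˡ₀ γ a b c a′ b′ c′ a″ b″ c″ , distribˡ₁ γ a b c a′ b′ c′ a″ b″ c″ , distribˡ₂ a b c a′ b′ c′ a″ b″ c″)
                  , (λ (a , b , c) (a′ , b′ , c′) (a″ , b″ , c″) →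
                       distribʳ₀ γ a b c a′ b′ c′ a″ b″ c″ , distribʳ₁ γ a b c a′ b′ c′ a″ b″ c″ , distribʳ₂ a b c a′ b′ c′ a″ b″ c″) }
      ; *-comm = λ (a , b , c) (a′ , b′ , c′) → comm₀ γ a b c a′ b′ c′ , comm₁ γ a b c a′ b′ c′ , comm₂ a b c a′ b′ c′ }
    }
    where
    0+ : ∀ x → η (+ 0) + x ≈ x
    0+ = solve 1 (λ x → con (+ 0) :+ x := x) refl
    +0 : ∀ x → x + η (+ 0) ≈ x
    +0 = solve 1 (λ x → x :+ con (+ 0) := x) refl
    inv′ : ∀ x → - x + x ≈ η (+ 0)
    inv′ = solve 1 (λ x → :- x :+ x := con (+ 0)) refl
    inv″ : ∀ x → x - x ≈ η (+ 0)
    inv″ = solve 1 (λ x → x :- x := con (+ 0)) refl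
    assoc₀ : ∀ g a b c d e f h k l → (a * d + g * (b * f + c * e)) * h + g * ((a * e + b * d + g * (c * f)) * l
        + (a * f + b * e + c * d) * k) ≈ a * (d * h + g * (e * l + f * k)) + g * (b * (d * l + e * k + f * h)
        + c * (d * k + e * h + g * (f * l)))
    assoc₀ = solve 10 (λ g a b c d e f h k l → (a :* d :+ g :* (b :* f :+ c :* e)) :* h
        :+ g :* ((a :* e :+ b :* d :+ g :* (c :* f)) :* l :+ (a :* f :+ b :* e :+ c :* d) :* k) := a :* (d :* h :+ g :* (e :* l :+ f :* k))
        :+ g :* (b :* (d :* l :+ e :* k :+ f :* h) :+ c :* (d :* k :+ e :* h :+ g :* (f :* l)))) refl
    assoc₁ : ∀ g a b c d e f h k l → (a * d + g * (b * f + c * e)) * k + (a * e + b * d + g * (c * f)) * h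
        + g * ((a * f + b * e + c * d) * l) ≈ a * (d * k + e * h + g * (f * l)) + b * (d * h + g * (e * l + f * k))
        + g * (c * (d * l + e * k + f * h))
    assoc₁ = solve 10 (λ g a b c d e f h k l → (a :* d :+ g :* (b :* f :+ c :* e)) :* k :+ (a :* e :+ b :* d :+ g :* (c :* f)) :* h
        :+ g :* ((a :* f :+ b :* e :+ c :* d) :* l) := a :* (d :* k :+ e :* h :+ g :* (f :* l)) :+ b :* (d :* h :+ g :* (e :* l :+ f :* k))
        :+ g :* (c :* (d :* l :+ e :* k :+ f :* h))) refl
    assoc₂ : ∀ g a b c d e f h k l → (a * d + g * (b * f + c * e)) * l + (a * e + b * d + g * (c * f)) * k + (a * f + b * e + c * d) * h
        ≈ a * (d * l + e * k + f * h) + b * (d * k + e * h + g * (f * l)) + c * (d * h + g * (e * l + f * k))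
    assoc₂ = solve 10 (λ g a b c d e f h k l → (a :* d :+ g :* (b :* f :+ c :* e)) :* l :+ (a :* e :+ b :* d :+ g :* (c :* f)) :* k
        :+ (a :* f :+ b :* e :+ c :* d) :* h := a :* (d :* l :+ e :* k :+ f :* h) :+ b :* (d :* k :+ e :* h :+ g :* (f :* l))
        :+ c :* (d :* h :+ g :* (e :* l :+ f :* k))) refl
    idˡ₀ : ∀ g a b c → η (+ 1) * a + g * (η (+ 0) * c + η (+ 0) * b) ≈ a
    idˡ₀ = solve 4 (λ g a b c → con (+ 1) :* a :+ g :* (con (+ 0) :* c :+ con (+ 0) :* b) := a) refl
    idˡ₁ : ∀ g a b c → η (+ 1) * b + η (+ 0) * a + g * (η (+ 0) * c) ≈ b
    idˡ₁ = solve 4 (λ g a b c → con (+ 1) :* b :+ con (+ 0) :* a :+ g :* (con (+ 0) :* c) := b) refl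
    idˡ₂ : ∀ a b c → η (+ 1) * c + η (+ 0) * b + η (+ 0) * a ≈ c
    idˡ₂ = solve 3 (λ a b c → con (+ 1) :* c :+ con (+ 0) :* b :+ con (+ 0) :* a := c) refl
    idʳ₀ : ∀ g a b c → a * η (+ 1) + g * (b * η (+ 0) + c * η (+ 0)) ≈ a
    idʳ₀ = solve 4 (λ g a b c → a :* con (+ 1) :+ g :* (b :* con (+ 0) :+ c :* con (+ 0)) := a) refl
    idʳ₁ : ∀ g a b c → a * η (+ 0) + b * η (+ 1) + g * (c * η (+ 0)) ≈ b
    idʳ₁ = solve 4 (λ g a b c → a :* con (+ 0) :+ b :* con (+ 1) :+ g :* (c :* con (+ 0)) := b) refl
    idʳ₂ : ∀ a b c → a * η (+ 0) + b * η (+ 0) + c * η (+ 1) ≈ c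
    idʳ₂ = solve 3 (λ a b c → a :* con (+ 0) :+ b :* con (+ 0) :+ c :* con (+ 1) := c) refl
    distribˡ₀ : ∀ g a b c d e f h k l → a * (d + h) + g * (b * (f + l) + c * (e + k)) ≈ a * d + g * (b * f + c * e)
        + (a * h + g * (b * l + c * k))
    distribˡ₀ = solve 10 (λ g a b c d e f h k l → a :* (d :+ h) :+ g :* (b :* (f :+ l) :+ c :* (e :+ k)) := a :* d
        :+ g :* (b :* f :+ c :* e) :+ (a :* h :+ g :* (b :* l :+ c :* k))) refl
    distribˡ₁ : ∀ g a b c d e f h k l → a * (e + k) + b * (d + h) + g * (c * (f + l)) ≈ a * e + b * d + g * (c * f)
        + (a * k + b * h + g * (c * l))
    distribˡ₁ = solve 10 (λ g a b c d e f h k l → a :* (e :+ k) :+ b :* (d :+ h) :+ g :* (c :* (f :+ l)) := a :* e :+ b :* d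
        :+ g :* (c :* f) :+ (a :* k :+ b :* h :+ g :* (c :* l))) refl
    distribˡ₂ : ∀ a b c d e f h k l → a * (f + l) + b * (e + k) + c * (d + h) ≈ a * f + b * e + c * d + (a * l + b * k + c * h)
    distribˡ₂ = solve 9 (λ a b c d e f h k l → a :* (f :+ l) :+ b :* (e :+ k) :+ c :* (d :+ h) := a :* f :+ b :* e :+ c :* d
        :+ (a :* l :+ b :* k :+ c :* h)) refl
    distribʳ₀ : ∀ g a b c d e f h k l → (d + h) * a + g * ((e + k) * c + (f + l) * b) ≈ d * a + g * (e * c + f * b)
        + (h * a + g * (k * c + l * b))
    distribʳ₀ = solve 10 (λ g a b c d e f h k l → (d :+ h) :* a :+ g :* ((e :+ k) :* c :+ (f :+ l) :* b) := d :* a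
        :+ g :* (e :* c :+ f :* b) :+ (h :* a :+ g :* (k :* c :+ l :* b))) refl
    distribʳ₁ : ∀ g a b c d e f h k l → (d + h) * b + (e + k) * a + g * ((f + l) * c) ≈ d * b + e * a + g * (f * c)
        + (h * b + k * a + g * (l * c))
    distribʳ₁ = solve 10 (λ g a b c d e f h k l → (d :+ h) :* b :+ (e :+ k) :* a :+ g :* ((f :+ l) :* c) := d :* b :+ e :* a
        :+ g :* (f :* c) :+ (h :* b :+ k :* a :+ g :* (l :* c))) refl
    distribʳ₂ : ∀ a b c d e f h k l → (d + h) * c + (e + k) * b + (f + l) * a ≈ d * c + e * b + f * a + (h * c + k * b + l * a)
    distribʳ₂ = solve 9 (λ a b c d e f h k l → (d :+ h) :* c :+ (e :+ k) :* b :+ (f :+ l) :* a := d :* c :+ e :* b :+ f :* a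
        :+ (h :* c :+ k :* b :+ l :* a)) refl
    comm₀ : ∀ g a b c d e f → a * d + g * (b * f + c * e) ≈ d * a + g * (e * c + f * b)
    comm₀ = solve 7 (λ g a b c d e f → a :* d :+ g :* (b :* f :+ c :* e) := d :* a :+ g :* (e :* c :+ f :* b)) refl
    comm₁ : ∀ g a b c d e f → a * e + b * d + g * (c * f) ≈ d * b + e * a + g * (f * c)
    comm₁ = solve 7 (λ g a b c d e f → a :* e :+ b :* d :+ g :* (c :* f) := d :* b :+ e :* a :+ g :* (f :* c)) refl
    comm₂ : ∀ a b c d e f → a * f + b * e + c * d ≈ d * c + e * b + f * a
    comm₂ = solve 6 (λ a b c d e f → a :* f :+ b :* e :+ c :* d := d :* c :+ e :* b :+ f :* a) refl

  extension : ℤAlgebra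
  extension = record
    { commRing = extensionRing ; η = λ z → embed (η z)
    ; η-+ = λ m n → η-+ m n , 0≈0+0 , 0≈0+0
    ; η-* = λ m n → trans (η-* m n) (mul₀ γ (η m) (η n)) , mul₁ γ (η m) (η n) , mul₂ (η m) (η n)
    ; η-neg = λ m → η-neg m , 0≈-0 , 0≈-0
    ; η-0 = refl , refl , refl ; η-1 = refl , refl , refl }
    where
    0≈0+0 : η (+ 0) ≈ η (+ 0) + η (+ 0)
    0≈0+0 = η-+ (+ 0) (+ 0)
    0≈-0 : η (+ 0) ≈ - η (+ 0)
    0≈-0 = η-neg (+ 0)
    mul₀ : ∀ g a b → a * b ≈ a * b + g * (η (+ 0) * η (+ 0) + η (+ 0) * η (+ 0))
    mul₀ = solve 3 (λ g a b → a :* b := a :* b :+ g :* (con (+ 0) :* con (+ 0) :+ con (+ 0) :* con (+ 0))) refl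
    mul₁ : ∀ g a b → η (+ 0) ≈ a * η (+ 0) + η (+ 0) * b + g * (η (+ 0) * η (+ 0))
    mul₁ = solve 3 (λ g a b → con (+ 0) := a :* con (+ 0) :+ con (+ 0) :* b :+ g :* (con (+ 0) :* con (+ 0))) refl
    mul₂ : ∀ a b → η (+ 0) ≈ a * η (+ 0) + η (+ 0) * η (+ 0) + η (+ 0) * b
    mul₂ = solve 2 (λ a b → con (+ 0) := a :* con (+ 0) :+ con (+ 0) :* con (+ 0) :+ con (+ 0) :* b) refl

-- Residues modulo p and cubic characters

ℤ-algebra : ℤAlgebra
ℤ-algebra = record
  { commRing = ℤ.+-*-commutativeRing ; η = id
  ; η-+ = λ _ _ → ≡.refl ; η-* = λ _ _ → ≡.refl ; η-neg = λ _ → ≡.refl ; η-0 = ≡.refl ; η-1 = ≡.refl }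

module Modular (p : ℕ) where

  𝔽 : ℤAlgebra
  𝔽 = Quotient.quotient ℤ-algebra (+ p)

  open Quotient ℤ-algebra (+ p) public using (_~_; ≈⇒~)

  ∣⇒~ : ∀ {x y} → p ∣ ∣ x ℤ.- y ∣ → x ~ y
  ∣⇒~ {x} {y} p∣ = go (x ℤ.- y) p∣
    where
    go : ∀ z → p ∣ ∣ z ∣ → ∃ λ q → + p ℤ.* q ≡ z
    go (+ n) (divides q eq) = + q , ≡.trans (≡.sym (ℤ.pos-* p q)) (cong +_ (≡.trans (ℕ.*-comm p q) (≡.sym eq)))
    go -[1+ n ] (divides q eq) = ℤ.- (+ q) , ≡.trans (≡.sym (ℤ.neg-distribʳ-* (+ p) (+ q)))
      (cong ℤ.-_ (≡.trans (≡.sym (ℤ.pos-* p q)) (cong +_ (≡.trans (ℕ.*-comm p q) (≡.sym eq)))))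

  ~⇒∣ : ∀ {x y} → x ~ y → p ∣ ∣ x ℤ.- y ∣
  ~⇒∣ {x} {y} (q , eq) = divides ∣ q ∣ (≡.trans (cong ∣_∣ (≡.sym eq)) (≡.trans (ℤ.abs-* (+ p) q) (ℕ.*-comm p ∣ q ∣)))

  ∣⇒~0 : ∀ {x} → p ∣ ∣ x ∣ → x ~ + 0
  ∣⇒~0 {x} p∣ = ∣⇒~ {x} {+ 0} (subst (λ z → p ∣ ∣ z ∣) (≡.sym (ℤ.+-identityʳ x)) p∣)

  ~0⇒∣ : ∀ {x} → x ~ + 0 → p ∣ ∣ x ∣
  ~0⇒∣ {x} h = subst (λ z → p ∣ ∣ z ∣) (ℤ.+-identityʳ x) (~⇒∣ {x} {+ 0} h)

  module _ (p-prime : Prime p) where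

    private
      coprime : ∀ n → ¬ (p ∣ n) → Coprime p n
      coprime n p∤n (d∣p , d∣n) with prime⇒irreducible p-prime d∣p
      ... | inj₁ d≡1  = d≡1
      ... | inj₂ ≡.refl = contradiction d∣n p∤n

      inverse-ℕ : ∀ n → ¬ (p ∣ n) → ∃ λ y → y ℤ.* + n ~ + 1
      inverse-ℕ n p∤n with coprime-Bézout (coprime n p∤n)
      ... | Bézout.+- x y eq = ℤ.- (+ y) , ℤ.- (+ x) , lemma (+ p) (+ x) (+ y) (+ n)
          (≡.trans (cong (ℤ._+_ (+ 1)) (≡.sym (ℤ.pos-* y n))) (≡.trans (cong +_ eq) (ℤ.pos-* x p)))
        where
        lemma′ : ∀ p x y n → p ℤ.* (ℤ.- x) ≡ (ℤ.- y) ℤ.* n ℤ.- + 1 ℤ.+ ((+ 1 ℤ.+ y ℤ.* n) ℤ.- x ℤ.* p)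
        lemma′ = ℤ-Tactic.solve-∀
        lemma : ∀ p x y n → + 1 ℤ.+ y ℤ.* n ≡ x ℤ.* p → p ℤ.* (ℤ.- x) ≡ (ℤ.- y) ℤ.* n ℤ.- + 1
        lemma p x y n h = ≡.trans (lemma′ p x y n) (≡.trans (cong (λ z → (ℤ.- y) ℤ.* n ℤ.- + 1 ℤ.+ z) (ℤ.i≡j⇒i-j≡0 h))
            (ℤ.+-identityʳ ((ℤ.- y) ℤ.* n ℤ.- + 1)))
      ... | Bézout.-+ x y eq = + y , + x , lemma (+ p) (+ x) (+ y) (+ n)
          (≡.trans (cong (ℤ._+_ (+ 1)) (≡.sym (ℤ.pos-* x p))) (≡.trans (cong +_ eq) (ℤ.pos-* y n)))
        where
        lemma′ : ∀ p x y n → p ℤ.* x ≡ y ℤ.* n ℤ.- + 1 ℤ.+ ((+ 1 ℤ.+ x ℤ.* p) ℤ.- y ℤ.* n)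
        lemma′ = ℤ-Tactic.solve-∀
        lemma : ∀ p x y n → + 1 ℤ.+ x ℤ.* p ≡ y ℤ.* n → p ℤ.* x ≡ y ℤ.* n ℤ.- + 1
        lemma p x y n h = ≡.trans (lemma′ p x y n) (≡.trans (cong (λ z → y ℤ.* n ℤ.- + 1 ℤ.+ z) (ℤ.i≡j⇒i-j≡0 h))
            (ℤ.+-identityʳ (y ℤ.* n ℤ.- + 1)))

    inverse : ∀ z → ¬ (p ∣ ∣ z ∣) → ∃ λ y → y ℤ.* z ~ + 1
    inverse (+ n)    p∤z = inverse-ℕ n p∤z
    inverse -[1+ n ] p∤z with inverse-ℕ (suc n) p∤z
    ... | y , h = ℤ.- y , subst (_~ + 1) (lemma y (+ suc n)) h
      where
      lemma : ∀ y z → y ℤ.* z ≡ (ℤ.- y) ℤ.* (ℤ.- z)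
      lemma = ℤ-Tactic.solve-∀

    zero-or-unit : ∀ z → z ~ + 0 ⊎ ∃ λ y → y ℤ.* z ~ + 1
    zero-or-unit z with p ∣? ∣ z ∣
    ... | yes p∣z = inj₁ (∣⇒~0 {z} p∣z)
    ... | no  p∤z = inj₂ (inverse z p∤z)

module CharacterAlgebra (K : ℤAlgebra) where
  open ℤAlgebra K
  open AlgebraProperties K
  open Relation.Binary.Reasoning.Setoid setoid

  -- Removes the denominator v of c, which the encoding of the character carries on both sides as
  -- v^e.
  cancel-power : ∀ {X v v′ L W} e → X ≈ v * L → v′ * v ≈ 1# → X ^ e ≈ W * v ^ e → L ^ e ≈ W
  cancel-power {X} {v} {v′} {L} {W} e X≈vL v′v≈1 h = begin
    L ^ e                        ≈⟨ *-identityˡ _ ⟨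
    1# * L ^ e                   ≈⟨ *-congʳ v′v^e≈1 ⟨
    v′ ^ e * v ^ e * L ^ e       ≈⟨ *-assoc _ _ _ ⟩
    v′ ^ e * (v ^ e * L ^ e)     ≈⟨ *-congˡ (^-distrib-* v L e) ⟨
    v′ ^ e * (v * L) ^ e         ≈⟨ *-congˡ (^-congˡ e X≈vL) ⟨
    v′ ^ e * X ^ e               ≈⟨ *-congˡ h ⟩
    v′ ^ e * (W * v ^ e)         ≈⟨ solve 3 (λ a w b → a :* (w :* b) := w :* (a :* b)) refl (v′ ^ e) W (v ^ e) ⟩
    W * (v′ ^ e * v ^ e)         ≈⟨ *-congˡ v′v^e≈1 ⟩
    W * 1#                       ≈⟨ *-identityʳ W ⟩
    W                            ∎
    where
    v′v^e≈1 : v′ ^ e * v ^ e ≈ 1#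
    v′v^e≈1 = ^-*-inverse e v′v≈1

  factor-lift : ∀ {u v c s} → u ≈ v * c → u + v * s ≈ v * (c + s)
  factor-lift {u} {v} {c} {s} h = trans (+-congʳ h) (sym (distribˡ v c s))

  ^-mod-3 : ∀ {ω} → ω ^ 3 ≈ 1# → ∀ n → ω ^ n ≈ ω ^ (n % 3)
  ^-mod-3 {ω} ω³≈1 n = begin
    ω ^ n                                ≡⟨ cong (ω ^_) (m≡m%n+[m/n]*n n 3) ⟩
    ω ^ (n % 3 ℕ.+ (n / 3) ℕ.* 3)        ≈⟨ ^-homo-* ω (n % 3) _ ⟩
    ω ^ (n % 3) * ω ^ ((n / 3) ℕ.* 3)    ≡⟨ cong (λ m → ω ^ (n % 3) * ω ^ m) (ℕ.*-comm (n / 3) 3) ⟩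
    ω ^ (n % 3) * ω ^ (3 ℕ.* (n / 3))    ≈⟨ *-congˡ (^-assocʳ ω 3 (n / 3)) ⟨
    ω ^ (n % 3) * (ω ^ 3) ^ (n / 3)      ≈⟨ *-congˡ (trans (^-congˡ (n / 3) ω³≈1) (1^n≈1 (n / 3))) ⟩
    ω ^ (n % 3) * 1#                     ≈⟨ *-identityʳ _ ⟩
    ω ^ (n % 3)                          ∎

  -- X and X̄ stand for powers of c+√-3 and c-√-3 modulo π; the exponent b of the second comes from
  -- the conjugate prime. Then X = ω^a = ω^(a+b) · ω̄^b = ω^j X̄.
  combine-characters : ∀ {ω ω̄ X X̄} a b j → ω ^ 3 ≈ 1# → ω * ω̄ ≈ 1# → (a ℕ.+ b) % 3 ≡ j % 3 →
    X ≈ ω ^ a → X̄ ≈ ω̄ ^ b → X ≈ ω ^ j * X̄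
  combine-characters {ω} {ω̄} {X} {X̄} a b j ω³≈1 ωω̄≈1 ab≡j hX hX̄ = sym (begin
    ω ^ j * X̄                    ≈⟨ *-cong (^-mod-3 ω³≈1 j) hX̄ ⟩
    ω ^ (j % 3) * ω̄ ^ b          ≡⟨ cong (λ m → ω ^ m * ω̄ ^ b) ab≡j ⟨
    ω ^ ((a ℕ.+ b) % 3) * ω̄ ^ b  ≈⟨ *-congʳ (trans (sym (^-mod-3 ω³≈1 (a ℕ.+ b))) (^-homo-* ω a b)) ⟩
    ω ^ a * ω ^ b * ω̄ ^ b        ≈⟨ *-assoc _ _ _ ⟩
    ω ^ a * (ω ^ b * ω̄ ^ b)      ≈⟨ *-congˡ (^-*-inverse b ωω̄≈1) ⟩
    ω ^ a * 1#                   ≈⟨ *-identityʳ _ ⟩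
    ω ^ a                        ≈⟨ hX ⟨
    X                            ∎)

  module _ (p : ℕ) (p-prime : Prime p) (1<p : 1 ℕ.< p) (ηp≈0 : η (+ p) ≈ 0#) where
    open CharP K p p-prime 1<p ηp≈0

    -- For p = 3n+2 the Frobenius map exchanges c + √-3 and c - √-3.
    inert-character : ∀ {ω} (c : ℤ) → η (+ 1) + ω + ω ^ 2 ≈ η (+ 0) → ∀ n → p ≡ 2 ℕ.+ 3 ℕ.* n → ∀ j →
      (η c + (η (+ 1) + η (+ 2) * ω)) ^ (suc (3 ℕ.* n) ℕ.* suc n) ≈ ω ^ j →
      (η c - (η (+ 1) + η (+ 2) * ω)) ^ suc n ≈ ω ^ j * (η c + (η (+ 1) + η (+ 2) * ω)) ^ suc n
    inert-character {ω} c ω-root n p≡ j h = sym (begin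
      ω ^ j * L ^ suc n                              ≈⟨ *-congʳ h ⟨
      L ^ (suc (3 ℕ.* n) ℕ.* suc n) * L ^ suc n      ≈⟨ *-comm _ _ ⟩
      L ^ suc n * L ^ (suc (3 ℕ.* n) ℕ.* suc n)      ≈⟨ ^-homo-* L (suc n) _ ⟨
      -- (n+1) + (3n+1)(n+1) = (3n+2)(n+1) holds by computation: adding (p+1)/3 to the exponent
      -- (p²-1)/3 makes it a multiple of p.
      L ^ ((2 ℕ.+ 3 ℕ.* n) ℕ.* suc n)                ≡⟨ cong (λ m → L ^ (m ℕ.* suc n)) p≡ ⟨
      L ^ (p ℕ.* suc n)                              ≈⟨ ^-assocʳ L p (suc n) ⟨
      (L ^ p) ^ suc n                                ≈⟨ ^-congˡ (suc n) L^p ⟩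
      (η c - (η (+ 1) + η (+ 2) * ω)) ^ suc n        ∎)
      where
      L = η c + (η (+ 1) + η (+ 2) * ω)
      ω³≈1 : ω ^ 3 ≈ 1#
      ω³≈1 = trans (lincomb₁ (ω - η (+ 1)) (solve 1 (λ o → o :^ 3 := con (+ 1) :+ (o :- con (+ 1)) :* (con (+ 1) :+ o :+ o :^ 2
          :- con (+ 0))) refl ω) ω-root) η-1
      ω^p : ω ^ p ≈ ω ^ 2
      ω^p = begin
        ω ^ p                     ≡⟨ cong (ω ^_) p≡ ⟩
        ω ^ (2 ℕ.+ 3 ℕ.* n)       ≈⟨ ^-homo-* ω 2 (3 ℕ.* n) ⟩
        ω ^ 2 * ω ^ (3 ℕ.* n)     ≈⟨ *-congˡ (^-assocʳ ω 3 n) ⟨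
        ω ^ 2 * (ω ^ 3) ^ n       ≈⟨ *-congˡ (trans (^-congˡ n ω³≈1) (1^n≈1 n)) ⟩
        ω ^ 2 * 1#                ≈⟨ *-identityʳ _ ⟩
        ω ^ 2                     ∎
      L^p : L ^ p ≈ η c - (η (+ 1) + η (+ 2) * ω)
      L^p = begin
        L ^ p                                     ≈⟨ frobenius-+ _ _ ⟩
        η c ^ p + (η (+ 1) + η (+ 2) * ω) ^ p     ≈⟨ +-cong (fermat c) (frobenius-+ _ _) ⟩
        η c + (η (+ 1) ^ p + (η (+ 2) * ω) ^ p)   ≈⟨ +-congˡ (+-cong (fermat (+ 1)) (trans (^-distrib-* _ _ p) (*-cong (fermat (+ 2)) ω^p)))
            ⟩
        η c + (η (+ 1) + η (+ 2) * ω ^ 2)         ≈⟨ lincomb₁ (η (+ 2)) (solve 2 (λ c o → c :+ (con (+ 1) :+ con (+ 2) :* o :^ 2) := c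
            :- (con (+ 1) :+ con (+ 2) :* o) :+ con (+ 2) :* (con (+ 1) :+ o :+ o :^ 2 :- con (+ 0))) refl (η c) ω) ω-root ⟩
        η c - (η (+ 1) + η (+ 2) * ω)             ∎

√-3 : ℤω
√-3 = ι (+ 1) +ω ι (+ 2) *ω ωE

conj-sub : ∀ x y → conj (x -ω y) ≡ conj x -ω conj y
conj-sub (a + b ω) (c + d ω) = cong₂ _+_ω (lemma₁ a b c d) (lemma₂ b d)
  where
  lemma₁ : ∀ a b c d → (a ℤ.- c) ℤ.- (b ℤ.- d) ≡ (a ℤ.- b) ℤ.- (c ℤ.- d)
  lemma₁ = ℤ-Tactic.solve-∀
  lemma₂ : ∀ b d → ℤ.- (b ℤ.- d) ≡ ℤ.- b ℤ.- ℤ.- d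
  lemma₂ = ℤ-Tactic.solve-∀

conj-*ω : ∀ x y → conj (x *ω y) ≡ conj x *ω conj y
conj-*ω (a + b ω) (c + d ω) = cong₂ _+_ω (lemma₁ a b c d) (lemma₂ a b c d)
  where
  lemma₁ : ∀ a b c d → (a ℤ.* c ℤ.- b ℤ.* d) ℤ.- (a ℤ.* d ℤ.+ b ℤ.* c ℤ.- b ℤ.* d) ≡ (a ℤ.- b) ℤ.* (c ℤ.- d) ℤ.- ℤ.- b ℤ.* ℤ.- d
  lemma₁ = ℤ-Tactic.solve-∀
  lemma₂ : ∀ a b c d → ℤ.- (a ℤ.* d ℤ.+ b ℤ.* c ℤ.- b ℤ.* d) ≡ (a ℤ.- b) ℤ.* ℤ.- d ℤ.+ ℤ.- b ℤ.* (c ℤ.- d) ℤ.- ℤ.- b ℤ.* ℤ.- d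
  lemma₂ = ℤ-Tactic.solve-∀

conj-^ω : ∀ x n → conj (x ^ω n) ≡ conj x ^ω n
conj-^ω x zero    = ≡.refl
conj-^ω x (suc n) = ≡.trans (conj-*ω x (x ^ω n)) (cong (conj x *ω_) (conj-^ω x n))

conj-conj : ∀ x → conj (conj x) ≡ x
conj-conj (a + b ω) = cong₂ _+_ω (lemma a b) (ℤ.neg-involutive b)
  where
  lemma : ∀ a b → (a ℤ.- b) ℤ.- ℤ.- b ≡ a
  lemma = ℤ-Tactic.solve-∀

N-conj : ∀ x → N (conj x) ≡ N x
N-conj (a + b ω) = lemma a b
  where
  lemma : ∀ a b → (a ℤ.- b) ℤ.* (a ℤ.- b) ℤ.- (a ℤ.- b) ℤ.* ℤ.- b ℤ.+ ℤ.- b ℤ.* ℤ.- b ≡ a ℤ.* a ℤ.- a ℤ.* b ℤ.+ b ℤ.* b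
  lemma = ℤ-Tactic.solve-∀

*conj≡N : ∀ x → re (x *ω conj x) ≡ N x
*conj≡N (a + b ω) = lemma a b
  where
  lemma : ∀ a b → a ℤ.* (a ℤ.- b) ℤ.- b ℤ.* ℤ.- b ≡ a ℤ.* a ℤ.- a ℤ.* b ℤ.+ b ℤ.* b
  lemma = ℤ-Tactic.solve-∀

conj-L : ∀ c → conj (ι c +ω √-3) ≡ ι c -ω √-3
conj-L c = cong (_+ -[1+ 1 ] ω) (lemma c)
  where
  lemma : ∀ c → (c ℤ.+ + 1) ℤ.- + 2 ≡ c ℤ.- + 1
  lemma = ℤ-Tactic.solve-∀

-- The cofactor π′ makes one module cover both cases: a prime factor of p with its conjugate as
-- cofactor, and p itself with cofactor 1.
module Residue (p : ℕ) (π π′ : ℤω) (ππ′≡p : π *ω π′ ≡ ι (+ p)) where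
  open Modular p
  private module Z = ℤAlgebra ℤω-algebra
  Q : ℤAlgebra
  Q = Quotient.quotient ℤω-algebra π
  open ℤAlgebra Q
  open AlgebraProperties Q using (_^_)

  ι-cong : ∀ x y → x ~ y → ι x ≈ ι y
  ι-cong x y (q , pq≡x-y) = π′ *ω ι q ,
    ≡.trans (≡.sym (Z.*-assoc π π′ (ι q))) (≡.trans (cong (_*ω ι q) ππ′≡p) (≡.trans (≡.sym (Z.η-* (+ p) q)) (cong ι pq≡x-y)))

  ^ω≡^ : ∀ x n → x ^ω n ≡ x ^ n
  ^ω≡^ x zero    = ≡.refl
  ^ω≡^ x (suc n) = cong (x *ω_) (^ω≡^ x n)

  lift-formula : ∀ r → lift r ≡ ι (↥ r) +ω ι (+ ↧ₙ r) *ω √-3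
  lift-formula r = cong₂ _+_ω (lemma₁ (↥ r) (+ ↧ₙ r)) (lemma₂ (+ ↧ₙ r))
    where
    lemma₁ : ∀ u v → u ℤ.+ v ≡ u ℤ.+ (v ℤ.* + 1 ℤ.- + 0 ℤ.* + 2)
    lemma₁ = ℤ-Tactic.solve-∀
    lemma₂ : ∀ v → + 2 ℤ.* v ≡ + 0 ℤ.+ (v ℤ.* + 2 ℤ.+ + 0 ℤ.* + 1 ℤ.- + 0 ℤ.* + 2)
    lemma₂ = ℤ-Tactic.solve-∀

  character : ∀ r c v′ → ↥ r ~ + ↧ₙ r ℤ.* c → v′ ℤ.* + ↧ₙ r ~ + 1 → ∀ e j → (∣ N π ∣ ℕ.∸ 1) / 3 ≡ e →
    CharIs π r j → (ι c +ω √-3) ^ e ≈ ωE ^ j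
  character r c v′ u~vc v′v~1 e j ≡.refl h =
    CharacterAlgebra.cancel-power Q {lift r} {ι (+ ↧ₙ r)} {ι v′} {ι c +ω √-3} {ωE ^ j} e
      (≡.subst (_≈ ι (+ ↧ₙ r) * (ι c + √-3)) (≡.sym (lift-formula r))
        (CharacterAlgebra.factor-lift Q {ι (↥ r)} {ι (+ ↧ₙ r)} {ι c} {√-3} (≡.subst (ι (↥ r) ≈_) (Z.η-* (+ ↧ₙ r) c)
            (ι-cong (↥ r) (+ ↧ₙ r ℤ.* c) u~vc))))
      (≡.subst (_≈ ι (+ 1)) (Z.η-* v′ (+ ↧ₙ r)) (ι-cong (v′ ℤ.* + ↧ₙ r) (+ 1) v′v~1))
      (≡.subst₂ (λ a b → a ≈ b) (^ω≡^ (lift r) e) (cong₂ _*ω_ (^ω≡^ ωE j) (^ω≡^ (ι (+ ↧ₙ r)) e)) h)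

-- Gluing the congruences at π and at its conjugate

module TraceAlgebra (K : ℤAlgebra) where
  open ℤAlgebra K
  open AlgebraProperties K

  -- πX = ππ̄z and π̄X = ππ̄y, so the trace times X is a multiple of P. A unit trace modulo P thus
  -- replaces a Bézout relation between π and π̄.
  trace-multiple : ∀ {π π̄ P X y z} → π * y ≈ X → π̄ * z ≈ X → π * π̄ ≈ P → (π + π̄) * X ≈ P * (y + z)
  trace-multiple {π} {π̄} {P} {X} {y} {z} h k l = lincomb₃ (- π̄) (- π) (y + z)
    (solve 6 (λ a b P X y z → (a :+ b) :* X := P :* (y :+ z) :+ (:- b) :* (a :* y :- X) :+ (:- a) :* (b :* z :- X)
        :+ (y :+ z) :* (a :* b :- P)) refl π π̄ P X y z) h k l

  divide-by-unit : ∀ {P T T′ k u X} → P * k ≈ T′ * T - η (+ 1) → T * X ≈ P * u → P * (T′ * u - k * X) ≈ X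
  divide-by-unit {P} {T} {T′} {k} {u} {X} h l = lincomb₂ (- X) (- T′)
    (solve 6 (λ P T S k u X → P :* (S :* u :- k :* X) := X :+ (:- X) :* (P :* k :- (S :* T :- con (+ 1))) :+ (:- S) :* (T :* X :- P :* u))
        refl P T T′ k u X) h l

  -- A vanishing trace means b = 2a, and then the norm a² - ab + b² is 3a², a unit if a and 3 are
  -- units.
  norm-nonzero : ∀ {a a′ b t P} → P ≈ a * a - a * b + b * b → P ≈ η (+ 0) → a + (a - b) ≈ η (+ 0) →
    a′ * a ≈ η (+ 1) → t * η (+ 3) ≈ η (+ 1) → η (+ 1) ≈ η (+ 0)
  norm-nonzero {a} {a′} {b} {t} {P} hN hP hT ha ht = trans (sym u≈1) u≈0
    where
    3a²≈0 : η (+ 3) * (a * a) ≈ η (+ 0)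
    3a²≈0 = lincomb₃ (η -[1+ 0 ]) (η (+ 1)) (a + b)
      (solve 3 (λ a b P → con (+ 3) :* (a :* a) := con (+ 0) :+ con -[1+ 0 ] :* (P :- (a :* a :- a :* b :+ b :* b))
          :+ con (+ 1) :* (P :- con (+ 0)) :+ (a :+ b) :* ((a :+ (a :- b)) :- con (+ 0))) refl a b P) hN hP hT
    u≈1 : t * (a′ * a′) * (η (+ 3) * (a * a)) ≈ η (+ 1)
    u≈1 = lincomb₂ (η (+ 1)) (t * η (+ 3) * (a′ * a + η (+ 1)))
      (solve 3 (λ a s t → t :* (s :* s) :* (con (+ 3) :* (a :* a)) := con (+ 1) :+ con (+ 1) :* (t :* con (+ 3) :- con (+ 1))
          :+ (t :* con (+ 3) :* (s :* a :+ con (+ 1))) :* (s :* a :- con (+ 1))) refl a a′ t) ht ha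
    u≈0 : t * (a′ * a′) * (η (+ 3) * (a * a)) ≈ η (+ 0)
    u≈0 = trans (*-congˡ 3a²≈0) (solve 1 (λ x → x :* con (+ 0) := con (+ 0)) refl (t * (a′ * a′)))

module Splitting (p : ℕ) (p-prime : Prime p) (3<p : 3 ℕ.< p) where
  open Modular p
  private
    module Z = ℤAlgebra ℤω-algebra

  1<p : 1 ℕ.< p
  1<p = ℕ.<-trans (s≤s (s≤s z≤n)) 3<p

  third : ∃ λ t → t ℤ.* + 3 ~ + 1
  third = inverse p-prime (+ 3) (>⇒∤ {3} 3<p)

  1≁0 : ¬ (+ 1 ~ + 0)
  1≁0 h = contradiction (∣1⇒≡1 (~0⇒∣ {+ 1} h)) (λ p≡1 → ℕ.<-irrefl (≡.sym p≡1) 1<p)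

  module _ (π : ℤω) (ππ̄≡p : π *ω conj π ≡ ι (+ p)) where

    private
      a = re π
      b = im π

      N≡p : N π ≡ + p
      N≡p = ≡.trans (≡.sym (*conj≡N π)) (cong re ππ̄≡p)

    trace : ℤ
    trace = a ℤ.+ (a ℤ.- b)

    -- If p divided the trace 2a-b, then either a is a unit and `norm-nonzero` applies, or p divides
    -- both a and b and p² divides N(π) = p.
    trace-unit : ∃ λ y → y ℤ.* trace ~ + 1
    trace-unit with zero-or-unit p-prime trace
    ... | inj₂ u = u
    ... | inj₁ T~0@(m , pm≡) with zero-or-unit p-prime a
    ...   | inj₂ (a′ , a′a~1) = contradiction
              (TraceAlgebra.norm-nonzero 𝔽 {a} {a′} {b} {proj₁ third} {+ p} (≈⇒~ (≡.sym N≡p))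
                  (∣⇒~0 {+ p} (divides 1 (≡.sym (ℕ.*-identityˡ p)))) T~0 a′a~1 (proj₂ third))
              1≁0
    ...   | inj₁ (k , pk≡) = contradiction (W , ≡.trans pW≡1 (≡.sym (ℤ.+-identityʳ (+ 1)))) 1≁0
      where
      -- W is N(π)/p², expressed through a = pk and b = p(2k-m).
      W : ℤ
      W = k ℤ.* k ℤ.- k ℤ.* (+ 2 ℤ.* k ℤ.- m) ℤ.+ (+ 2 ℤ.* k ℤ.- m) ℤ.* (+ 2 ℤ.* k ℤ.- m)
      a≡ : a ≡ + p ℤ.* k
      a≡ = ≡.trans (≡.sym (ℤ.+-identityʳ a)) (≡.sym pk≡)
      b≡ : b ≡ + p ℤ.* (+ 2 ℤ.* k ℤ.- m)
      b≡ = ≡.trans (lemma a b) (≡.trans (cong₂ (λ u v → + 2 ℤ.* u ℤ.- v) a≡ (≡.trans (≡.sym (ℤ.+-identityʳ trace)) (≡.sym pm≡)))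
          (lemma′ (+ p) k m))
        where
        lemma : ∀ a b → b ≡ + 2 ℤ.* a ℤ.- (a ℤ.+ (a ℤ.- b))
        lemma = ℤ-Tactic.solve-∀
        lemma′ : ∀ p k m → + 2 ℤ.* (p ℤ.* k) ℤ.- p ℤ.* m ≡ p ℤ.* (+ 2 ℤ.* k ℤ.- m)
        lemma′ = ℤ-Tactic.solve-∀
      pW≡1 : + p ℤ.* W ≡ + 1
      pW≡1 = ℤ.*-cancelˡ-≡ (+ p) (+ p ℤ.* W) (+ 1) {{ℕ.>-nonZero (ℕ.<-trans ℕ.0<1+n 1<p)}}
        (≡.trans (≡.sym (≡.trans (cong₂ (λ u v → u ℤ.* u ℤ.- u ℤ.* v ℤ.+ v ℤ.* v) a≡ b≡) (lemma (+ p) k (+ 2 ℤ.* k ℤ.- m))))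
          (≡.trans N≡p (≡.sym (ℤ.*-identityʳ (+ p)))))
        where
        lemma : ∀ p k l → (p ℤ.* k) ℤ.* (p ℤ.* k) ℤ.- (p ℤ.* k) ℤ.* (p ℤ.* l) ℤ.+ (p ℤ.* l) ℤ.* (p ℤ.* l)
            ≡ p ℤ.* (p ℤ.* (k ℤ.* k ℤ.- k ℤ.* l ℤ.+ l ℤ.* l))
        lemma = ℤ-Tactic.solve-∀

    ∣-both⇒∣p : ∀ X → π ∣ω X → conj π ∣ω X → ι (+ p) ∣ω X
    ∣-both⇒∣p X (y , πy≡X) (z , π̄z≡X) = ι T′ *ω (y +ω z) +ω negω (ι k *ω X) ,
      TraceAlgebra.divide-by-unit ℤω-algebra {ι (+ p)} {ι trace} {ι T′} {ι k} {y +ω z} {X} unit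
        (≡.trans (cong (_*ω X) trace≡) (TraceAlgebra.trace-multiple ℤω-algebra {π} {conj π} {ι (+ p)} {X} {y} {z} πy≡X π̄z≡X ππ̄≡p))
      where
      T′ = proj₁ trace-unit
      k = proj₁ (proj₂ trace-unit)
      trace≡ : ι trace ≡ π +ω conj π
      trace≡ = cong (trace +_ω) (≡.sym (ℤ.+-inverseʳ b))
      unit : ι (+ p) *ω ι k ≡ ι T′ *ω ι trace +ω negω (ι (+ 1))
      unit = ≡.trans (≡.sym (Z.η-* (+ p) k)) (≡.trans (cong ι (proj₂ (proj₂ trace-unit))) (cong (_+ω negω (ι (+ 1))) (Z.η-* T′ trace)))

    norm-exponent : ∀ n → p ≡ suc (3 ℕ.* n) → (∣ N π ∣ ℕ.∸ 1) / 3 ≡ n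
    norm-exponent n p≡ = ≡.trans (cong (λ m → (∣ m ∣ ℕ.∸ 1) / 3) N≡p) (≡.trans (cong (λ m → (m ℕ.∸ 1) / 3) p≡)
      (≡.trans (cong (_/ 3) (ℕ.*-comm 3 n)) (m*n/n≡m n 3)))

  module _ (r : ℚ) (c v′ : ℤ) (u~vc : ↥ r ~ + ↧ₙ r ℤ.* c) (v′v~1 : v′ ℤ.* + ↧ₙ r ~ + 1) where

    private
      L L̄ : ℤω
      L = ι c +ω √-3
      L̄ = ι c -ω √-3

    split-at : ∀ π → π *ω conj π ≡ ι (+ p) → ∀ n → p ≡ suc (3 ℕ.* n) → ∀ a b j →
      CharIs π r a → CharIs (conj π) r b → (a ℕ.+ b) % 3 ≡ j % 3 → π ∣ω ((L ^ω n) -ω (ωE ^ω j) *ω (L̄ ^ω n))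
    split-at π ππ̄≡p n p≡ a b j χ χ̄ ab≡j =
      ≡.subst₂ (λ u v → π ∣ω (u -ω v)) (≡.sym (R.^ω≡^ L n)) (≡.sym (cong₂ _*ω_ (R.^ω≡^ ωE j) (R.^ω≡^ L̄ n)))
        (CharacterAlgebra.combine-characters R.Q {ωE} {conj ωE} {L ^ n} {L̄ ^ n} a b j (Quotient.≈⇒~ ℤω-algebra π {ι (+ 1)} ≡.refl)
            (Quotient.≈⇒~ ℤω-algebra π {ι (+ 1)} ≡.refl) ab≡j
          (R.character r c v′ u~vc v′v~1 n a (norm-exponent π ππ̄≡p n p≡) χ) at-conj)
      where
      module R = Residue p π (conj π) ππ̄≡p
      open AlgebraProperties R.Q using (_^_)
      module R̄ = Residue p (conj π) π (≡.trans (Z.*-comm (conj π) π) ππ̄≡p)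
      norm-exponent-conj : (∣ N (conj π) ∣ ℕ.∸ 1) / 3 ≡ n
      norm-exponent-conj = ≡.trans (cong (λ m → (∣ m ∣ ℕ.∸ 1) / 3) (N-conj π)) (norm-exponent π ππ̄≡p n p≡)
      χ̄′ : conj π ∣ω ((L ^ω n) -ω (ωE ^ω b))
      χ̄′ = ≡.subst₂ (λ u v → conj π ∣ω (u -ω v)) (≡.sym (R̄.^ω≡^ L n)) (≡.sym (R̄.^ω≡^ ωE b))
        (R̄.character r c v′ u~vc v′v~1 n b norm-exponent-conj χ̄)
      at-conj : π ∣ω (L̄ ^ n -ω conj ωE ^ b)
      -- Conjugating a congruence modulo the conjugate prime yields one modulo π in which c+√-3 has
      -- become c-√-3 and ω its inverse.
      at-conj = conj (proj₁ χ̄′) , (begin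
        π *ω conj y                        ≡⟨ cong (_*ω conj y) (≡.sym (conj-conj π)) ⟩
        conj (conj π) *ω conj y            ≡⟨ ≡.sym (conj-*ω (conj π) y) ⟩
        conj (conj π *ω y)                 ≡⟨ cong conj (proj₂ χ̄′) ⟩
        conj ((L ^ω n) -ω (ωE ^ω b))       ≡⟨ conj-sub (L ^ω n) (ωE ^ω b) ⟩
        conj (L ^ω n) -ω conj (ωE ^ω b)    ≡⟨ cong₂ _-ω_ (conj-^ω L n) (conj-^ω ωE b) ⟩
        (conj L ^ω n) -ω (conj ωE ^ω b)    ≡⟨ cong (λ u → (u ^ω n) -ω (conj ωE ^ω b)) (conj-L c) ⟩
        (L̄ ^ω n) -ω (conj ωE ^ω b)         ≡⟨ cong₂ _-ω_ (R.^ω≡^ L̄ n) (R.^ω≡^ (conj ωE) b) ⟩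
        L̄ ^ n -ω conj ωE ^ b               ∎)
        where
        open ≡.≡-Reasoning
        y = proj₁ χ̄′

    -- Membership in C_j modulo p itself: ((c+√-3)/(c-√-3))^((p-1)/3) = ω^j for p = 3n+1, and the
    -- inverse quotient to the power (p+1)/3 for p = 3n+2, with denominators cleared.
    Condition₁ Condition₂ : ℕ → Set
    Condition₁ j = ∃ λ n → p ≡ suc (3 ℕ.* n) × ι (+ p) ∣ω ((L ^ω n) -ω (ωE ^ω j) *ω (L̄ ^ω n))
    Condition₂ j = ∃ λ n → p ≡ 2 ℕ.+ 3 ℕ.* n × ι (+ p) ∣ω ((L̄ ^ω suc n) -ω (ωE ^ω j) *ω (L ^ω suc n))

    cubic-condition : ∀ j → Cubic3 p r j → Condition₁ j ⊎ Condition₂ j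
    cubic-condition j (inj₂ (p%3≡1 , π , a , b , _ , ππ̄≡p , χ , χ̄ , ab≡j)) = inj₁ (n , p≡ ,
      ∣-both⇒∣p π ππ̄≡p _ (split-at π ππ̄≡p n p≡ a b j χ χ̄ ab≡j)
        -- The congruence at the other prime is the same statement with π and its conjugate, and a
        -- and b, exchanged.
        (split-at (conj π) (≡.trans (cong (conj π *ω_) (conj-conj π)) (≡.trans (Z.*-comm (conj π) π) ππ̄≡p)) n p≡ b a j χ̄
          (subst (λ ρ → CharIs ρ r a) (≡.sym (conj-conj π)) χ) (≡.trans (cong (_% 3) (ℕ.+-comm b a)) ab≡j)))
      where
      n = p / 3
      p≡ : p ≡ suc (3 ℕ.* n)
      p≡ = ≡.trans (m≡m%n+[m/n]*n p 3) (cong₂ ℕ._+_ p%3≡1 (ℕ.*-comm n 3))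
    cubic-condition j (inj₁ (p%3≡2 , χ)) = inj₂ (n , p≡ ,
      ≡.subst₂ (λ u v → ι (+ p) ∣ω (u -ω v)) (≡.sym (R.^ω≡^ L̄ (suc n))) (≡.sym (cong₂ _*ω_ (R.^ω≡^ ωE j) (R.^ω≡^ L (suc n))))
        (CharacterAlgebra.inert-character R.Q p p-prime 1<p (Quotient.d~0 ℤω-algebra (ι (+ p))) {ωE} c
            (Quotient.≈⇒~ ℤω-algebra (ι (+ p)) {ι (+ 0)} ≡.refl) n p≡ j
          (R.character r c v′ u~vc v′v~1 (suc (3 ℕ.* n) ℕ.* suc n) j exponent χ)))
      where
      module R = Residue p (ι (+ p)) (ι (+ 1)) (Z.*-identityʳ (ι (+ p)))
      n = p / 3
      p≡ : p ≡ 2 ℕ.+ 3 ℕ.* n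
      p≡ = ≡.trans (m≡m%n+[m/n]*n p 3) (cong₂ ℕ._+_ p%3≡2 (ℕ.*-comm n 3))
      N≡ : N (ι (+ p)) ≡ + (p ℕ.* p)
      N≡ = ≡.trans (lemma (+ p)) (≡.sym (ℤ.pos-* p p))
        where
        lemma : ∀ x → x ℤ.* x ℤ.- x ℤ.* + 0 ℤ.+ + 0 ℤ.* + 0 ≡ x ℤ.* x
        lemma = ℤ-Tactic.solve-∀
      exponent : (∣ N (ι (+ p)) ∣ ℕ.∸ 1) / 3 ≡ suc (3 ℕ.* n) ℕ.* suc n
      exponent = ≡.trans (cong (λ m → (∣ m ∣ ℕ.∸ 1) / 3) N≡) (≡.trans (cong (λ m → (m ℕ.* m ℕ.∸ 1) / 3) p≡)
        (≡.trans (cong (λ m → (m ℕ.∸ 1) / 3) (lemma n)) (m*n/n≡m (suc (3 ℕ.* n) ℕ.* suc n) 3)))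
        where
        lemma : ∀ n → (2 ℕ.+ 3 ℕ.* n) ℕ.* (2 ℕ.+ 3 ℕ.* n) ≡ suc (suc (3 ℕ.* n) ℕ.* suc n ℕ.* 3)
        lemma = ℕ-Tactic.solve-∀

-- Adjoining μ and descending from the extension

module CubicExtensionProperties (A : ℤAlgebra) (γ : ℤAlgebra.Carrier A) where
  open ℤAlgebra A
  open AlgebraProperties A
  open CubicExtension A γ
  private
    module K = ℤAlgebra extension
    module KP = AlgebraProperties extension

  embed-cong : ∀ {x y} → x ≈ y → embed x K.≈ embed y
  embed-cong h = h , refl , refl

  embed-+ : ∀ x y → embed (x + y) K.≈ embed x K.+ embed y
  embed-+ x y = refl , η-+ (+ 0) (+ 0) , η-+ (+ 0) (+ 0)

  embed-neg : ∀ x → embed (- x) K.≈ K.- embed x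
  embed-neg x = refl , η-neg (+ 0) , η-neg (+ 0)

  embed-- : ∀ x y → embed (x - y) K.≈ embed x K.- embed y
  embed-- x y = K.trans (embed-+ x (- y)) (K.+-congˡ {embed x} (embed-neg y))

  embed-* : ∀ x y → embed (x * y) K.≈ embed x K.* embed y
  embed-* x y =
      solve 3 (λ g a b → a :* b := a :* b :+ g :* (con (+ 0) :* con (+ 0) :+ con (+ 0) :* con (+ 0))) refl γ x y
    , solve 3 (λ g a b → con (+ 0) := a :* con (+ 0) :+ con (+ 0) :* b :+ g :* (con (+ 0) :* con (+ 0))) refl γ x y
    , solve 2 (λ a b → con (+ 0) := a :* con (+ 0) :+ con (+ 0) :* con (+ 0) :+ con (+ 0) :* b) refl x y

  embed-^ : ∀ x n → embed (x ^ n) K.≈ embed x KP.^ n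
  embed-^ x zero    = sym η-1 , refl , refl
  embed-^ x (suc n) = K.trans (embed-* x (x ^ n)) (K.*-congˡ {embed x} (embed-^ x n))

  θ : K.Carrier
  θ = η (+ 0) , η (+ 1) , η (+ 0)

  -- The element δθ². When γδ = 1 it is the inverse of θ and serves as ν.
  θ² : Carrier → K.Carrier
  θ² δ = η (+ 0) , η (+ 0) , δ

  θ*θ² : ∀ δ → θ K.* θ² δ K.≈ embed (γ * δ)
  θ*θ² δ =
      solve 2 (λ g d → con (+ 0) :* con (+ 0) :+ g :* (con (+ 1) :* d :+ con (+ 0) :* con (+ 0)) := g :* d) refl γ δ
    , solve 2 (λ g d → con (+ 0) :* con (+ 0) :+ con (+ 1) :* con (+ 0) :+ g :* (con (+ 0) :* d) := con (+ 0)) refl γ δ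
    , solve 1 (λ d → con (+ 0) :* d :+ con (+ 1) :* con (+ 0) :+ con (+ 0) :* con (+ 0) := con (+ 0)) refl δ

  θ*θ : θ K.* θ K.≈ θ² (η (+ 1))
  θ*θ =
      solve 1 (λ g → con (+ 0) :* con (+ 0) :+ g :* (con (+ 1) :* con (+ 0) :+ con (+ 0) :* con (+ 1)) := con (+ 0)) refl γ
    , solve 1 (λ g → con (+ 0) :* con (+ 1) :+ con (+ 1) :* con (+ 0) :+ g :* (con (+ 0) :* con (+ 0)) := con (+ 0)) refl γ
    , solve 1 (λ g → con (+ 0) :* con (+ 0) :+ con (+ 1) :* con (+ 1) :+ con (+ 0) :* con (+ 0) := con (+ 1)) refl γ

  θ^3 : θ KP.^ 3 K.≈ embed γ
  θ^3 = K.trans (K.*-congˡ {θ} (K.trans (K.*-congˡ {θ} (K.*-identityʳ θ)) θ*θ))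
    (K.trans (θ*θ² (η (+ 1))) (embed-cong (solve 1 (λ g → g :* con (+ 1) := g) refl γ)))

module Adjunction (A : ℤAlgebra) (p : ℕ) (p-prime : Prime p) (1<p : 1 ℕ.< p) (ηp≈0 : ℤAlgebra._≈_ A (ℤAlgebra.η A (+ p)) (ℤAlgebra.0# A))
    where
  open ℤAlgebra A
  open AlgebraProperties A

  module _ (ω : Carrier) (ω-root : η (+ 1) + ω + ω ^ 2 ≈ η (+ 0)) (c w t i : ℤ)
    (wc≈1 : η w * (η c * η c + η (+ 3)) ≈ η (+ 1)) (3t≈1 : η (+ 3) * η t ≈ η (+ 1)) (2ci≈1 : η (+ 2) * η c * η i ≈ η (+ 1)) where

    L L̄ γ δ : Carrier
    L = η c + (η (+ 1) + η (+ 2) * ω)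
    L̄ = η c - (η (+ 1) + η (+ 2) * ω)
    γ = η w * L ^ 2
    δ = η w * L̄ ^ 2

    open CubicExtension A γ
    open CubicExtensionProperties A γ
    private
      module K = ℤAlgebra extension
      module KP = AlgebraProperties extension

    -- γδ is the square of w(c+√-3)(c-√-3) = 1.
    γδ≈1 : γ * δ ≈ η (+ 1)
    γδ≈1 = lincomb₂ (η w * (η c * η c + η (+ 3)) + η (+ 1)) (η (+ 16) * η w * η w * (ω ^ 2 + ω + η (+ 1))
        - η (+ 8) * η w * η w * (η c * η c + η (+ 3)))
      (solve 3 (λ o c w → w :* (c :+ (con (+ 1) :+ con (+ 2) :* o)) :^ 2 :* (w :* (c :- (con (+ 1) :+ con (+ 2) :* o)) :^ 2)
        := con (+ 1) :+ (w :* (c :* c :+ con (+ 3)) :+ con (+ 1)) :* (w :* (c :* c :+ con (+ 3)) :- con (+ 1))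
         :+ (con (+ 16) :* w :* w :* (o :^ 2 :+ o :+ con (+ 1)) :- con (+ 8) :* w :* w :* (c :* c :+ con (+ 3))) :* (con (+ 1) :+ o
             :+ o :^ 2 :- con (+ 0))) refl ω (η c) (η w))
      wc≈1 ω-root

    Ω ν : K.Carrier
    Ω = embed ω
    ν = θ² δ

    private
      θν≈1 : θ K.* ν K.≈ K.η (+ 1)
      θν≈1 = K.trans (θ*θ² δ) (embed-cong γδ≈1)

      ν^3 : ν KP.^ 3 K.≈ embed δ
      ν^3 = begin
        ν KP.^ 3                                     ≈⟨ K.*-identityˡ _ ⟨
        K.1# K.* ν KP.^ 3                            ≈⟨ K.*-congʳ {ν KP.^ 3} (K.trans (embed-cong (trans (*-comm δ γ) γδ≈1)) K.η-1) ⟨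
        embed (δ * γ) K.* ν KP.^ 3                   ≈⟨ K.*-congʳ {ν KP.^ 3} (K.trans (embed-* δ γ) (K.*-congˡ {embed δ} (K.sym θ^3))) ⟩
        embed δ K.* θ KP.^ 3 K.* ν KP.^ 3            ≈⟨ K.*-assoc (embed δ) (θ KP.^ 3) (ν KP.^ 3) ⟩
        embed δ K.* (θ KP.^ 3 K.* ν KP.^ 3)          ≈⟨ K.*-congˡ {embed δ} (KP.^-*-inverse {θ} {ν} 3 (K.trans θν≈1 K.η-1)) ⟩
        embed δ K.* K.1#                             ≈⟨ K.*-identityʳ _ ⟩
        embed δ                                      ∎
        where open Relation.Binary.Reasoning.Setoid K.setoid

      embed-√-3 : embed (η (+ 1) + η (+ 2) * ω) K.≈ K.η (+ 1) K.+ K.η (+ 2) K.* Ω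
      embed-√-3 = K.trans (embed-+ _ _) (K.+-congˡ {K.η (+ 1)} (embed-* _ _))

      embed-L : embed L K.≈ K.η c K.+ (K.η (+ 1) K.+ K.η (+ 2) K.* Ω)
      embed-L = K.trans (embed-+ _ _) (K.+-congˡ {K.η c} embed-√-3)

      embed-L̄ : embed L̄ K.≈ K.η c K.- (K.η (+ 1) K.+ K.η (+ 2) K.* Ω)
      embed-L̄ = K.trans (embed-- _ _) (K.+-congˡ {K.η c} (K.-‿cong embed-√-3))

      Ω-root : K.η (+ 1) K.+ Ω K.+ Ω KP.^ 2 K.≈ K.η (+ 0)
      Ω-root = K.trans (K.sym (K.trans (embed-+ _ _) (K.+-cong (embed-+ _ _) (embed-^ ω 2)))) (embed-cong ω-root)

      wc≈1ᴷ : K.η w K.* (K.η c K.* K.η c K.+ K.η (+ 3)) K.≈ K.η (+ 1)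
      wc≈1ᴷ = K.trans (K.sym (K.trans (embed-* _ _) (K.*-congˡ {K.η w} (K.trans (embed-+ _ _) (K.+-congʳ {K.η (+ 3)} (embed-* _ _))))))
          (embed-cong wc≈1)

      3t≈1ᴷ : K.η (+ 3) K.* K.η t K.≈ K.η (+ 1)
      3t≈1ᴷ = K.trans (K.sym (embed-* _ _)) (embed-cong 3t≈1)

      2ci≈1ᴷ : K.η (+ 2) K.* K.η c K.* K.η i K.≈ K.η (+ 1)
      2ci≈1ᴷ = K.trans (K.sym (K.trans (embed-* _ _) (K.*-congʳ {K.η i} (embed-* _ _)))) (embed-cong 2ci≈1)

      θ³≈ : θ KP.^ 3 K.≈ K.η w K.* (K.η c K.+ (K.η (+ 1) K.+ K.η (+ 2) K.* Ω)) KP.^ 2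
      θ³≈ = K.trans θ^3 (K.trans (embed-* _ _) (K.*-congˡ {K.η w} (K.trans (embed-^ L 2) (KP.^-congˡ 2 embed-L))))

      ν³≈ : ν KP.^ 3 K.≈ K.η w K.* (K.η c K.- (K.η (+ 1) K.+ K.η (+ 2) K.* Ω)) KP.^ 2
      ν³≈ = K.trans ν^3 (K.trans (embed-* _ _) (K.*-congˡ {K.η w} (K.trans (embed-^ L̄ 2) (KP.^-congˡ 2 embed-L̄))))

      ηp≈0ᴷ : K.η (+ p) K.≈ K.0#
      ηp≈0ᴷ = embed-cong (trans ηp≈0 (sym η-0))

      radicals : Kummer.Radicals extension p p-prime 1<p ηp≈0ᴷ c w t i
      radicals = record
        { ω = Ω ; μ = θ ; ν = ν ; ω-root = Ω-root ; μν≈1 = θν≈1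
        ; wc≈1 = wc≈1ᴷ ; 3t≈1 = 3t≈1ᴷ ; 2ci≈1 = 2ci≈1ᴷ ; μ³ = θ³≈ ; ν³ = ν³≈ }

    CubicCondition : ℕ → Set
    CubicCondition j = (∃ λ n → p ≡ suc (3 ℕ.* n) × L ^ n ≈ ω ^ j * L̄ ^ n)
                     ⊎ (∃ λ n → p ≡ 2 ℕ.+ 3 ℕ.* n × L̄ ^ suc n ≈ ω ^ j * L ^ suc n)

    private
      power-condition : ∀ {X Y Xᴷ Yᴷ} n j → embed X K.≈ Xᴷ → embed Y K.≈ Yᴷ → X ^ n ≈ ω ^ j * Y ^ n → Xᴷ KP.^ n K.≈ Ω KP.^ j K.* Yᴷ KP.^ n
      power-condition {X} {Y} {Xᴷ} {Yᴷ} n j hX hY h = K.trans (KP.^-congˡ n (K.sym hX))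
          (K.trans (K.sym (embed-^ X n)) (K.trans (embed-cong h)
        (K.trans (embed-* _ _) (K.*-cong (embed-^ ω j) (K.trans (embed-^ Y n) (KP.^-congˡ n hY))))))

      shift : ∀ j → CubicCondition j → Kummer.RadicalProperties.FrobeniusShift extension p p-prime 1<p ηp≈0ᴷ radicals j
      shift j (inj₁ (n , p≡ , h)) =
        Kummer.RadicalProperties.frobeniusShift-1mod3 extension p p-prime 1<p ηp≈0ᴷ radicals n p≡ j (power-condition n j embed-L embed-L̄ h)
      shift j (inj₂ (n , p≡ , h)) =
        Kummer.RadicalProperties.frobeniusShift-2mod3 extension p p-prime 1<p ηp≈0ᴷ radicals n p≡ j
            (power-condition (suc n) j embed-L̄ embed-L h)

    module FirstSum (x a : ℤ) (ax≈1 : η a * η x ≈ η (+ 1)) (hx : η (+ 9) * η x ≈ η (+ 4) * η w) where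

      private
        axᴷ : K.η a K.* K.η x K.≈ K.η (+ 1)
        axᴷ = K.trans (K.sym (embed-* _ _)) (embed-cong ax≈1)

        hxᴷ : K.η (+ 9) K.* K.η x K.≈ K.η (+ 4) K.* K.η w
        hxᴷ = K.trans (K.sym (embed-* _ _)) (K.trans (embed-cong hx) (embed-* _ _))

      -- Both sides of the equation in the extension are embedded, so its coordinate at 1 is the
      -- equation below; the other values descend in the same way.
      value₀ : CubicCondition 0 → η (g x p 0) ≈ η (+ 1)
      value₀ h = proj₁ (Kummer.RadicalProperties.FirstSum.value₀ extension p p-prime 1<p ηp≈0ᴷ radicals x a axᴷ hxᴷ (shift 0 h))

      value₁ : CubicCondition 1 → η (g x p 0) ≈ (- (η (+ 1) + η c)) * η i
      value₁ h = proj₁ (K.trans (Kummer.RadicalProperties.FirstSum.value₁ extension p p-prime 1<p ηp≈0ᴷ radicals x a axᴷ hxᴷ (shift 1 h))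
        (K.sym (K.trans (embed-* _ _) (K.*-congʳ {K.η i} (K.trans (embed-neg _) (K.-‿cong (embed-+ _ _)))))))

      value₂ : CubicCondition 2 → η (g x p 0) ≈ (η (+ 1) - η c) * η i
      value₂ h = proj₁ (K.trans (Kummer.RadicalProperties.FirstSum.value₂ extension p p-prime 1<p ηp≈0ᴷ radicals x a axᴷ hxᴷ (shift 2 h))
          (K.sym (K.trans (embed-* _ _) (K.*-congʳ {K.η i} (embed-- _ _)))))

    module SecondSum (x a : ℤ) (ax≈1 : η a * η x ≈ η (+ 1)) (hx : η (+ 27) * η x ≈ η (+ 4) * (η c * η c) * η w) where

      private
        axᴷ : K.η a K.* K.η x K.≈ K.η (+ 1)
        axᴷ = K.trans (K.sym (embed-* _ _)) (embed-cong ax≈1)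

        hxᴷ : K.η (+ 27) K.* K.η x K.≈ K.η (+ 4) K.* (K.η c K.* K.η c) K.* K.η w
        hxᴷ = K.trans (K.sym (embed-* _ _)) (K.trans (embed-cong hx)
          (K.trans (embed-* _ _) (K.*-congʳ {K.η w} (K.trans (embed-* _ _) (K.*-congˡ {K.η (+ 4)} (embed-* _ _))))))

        embed-S : embed (η (g x p 0) - η (+ 2) * η (g x p 1)) K.≈ K.η (g x p 0) K.- K.η (+ 2) K.* K.η (g x p 1)
        embed-S = K.trans (embed-- _ _) (K.+-congˡ {K.η (g x p 0)} (K.-‿cong (embed-* _ _)))

      value₀ : CubicCondition 0 → η (g x p 0) - η (+ 2) * η (g x p 1) ≈ η (+ 1)
      value₀ h = proj₁ (K.trans embed-S (Kummer.RadicalProperties.SecondSum.value₀ extension p p-prime 1<p ηp≈0ᴷ radicals x a axᴷ hxᴷ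
          (shift 0 h)))

      value₁ : CubicCondition 1 → η (g x p 0) - η (+ 2) * η (g x p 1) ≈ (- (η (+ 9) + η c)) * η i
      value₁ h = proj₁ (K.trans embed-S (K.trans (Kummer.RadicalProperties.SecondSum.value₁ extension p p-prime 1<p ηp≈0ᴷ radicals x a axᴷ
          hxᴷ (shift 1 h))
        (K.sym (K.trans (embed-* _ _) (K.*-congʳ {K.η i} (K.trans (embed-neg _) (K.-‿cong (embed-+ _ _))))))))

      value₂ : CubicCondition 2 → η (g x p 0) - η (+ 2) * η (g x p 1) ≈ (η (+ 9) - η c) * η i
      value₂ h = proj₁ (K.trans embed-S (K.trans (Kummer.RadicalProperties.SecondSum.value₂ extension p p-prime 1<p ηp≈0ᴷ radicals x a axᴷ
          hxᴷ (shift 2 h)) (K.sym (K.trans (embed-* _ _) (K.*-congʳ {K.η i} (embed-- _ _))))))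

-- The arguments of the two sums as integers, and the resulting integer congruences

module Parameters (K : ℤAlgebra) where
  open ℤAlgebra K
  open AlgebraProperties K

  9-inverse : ∀ {w t n} → w * n ≈ η (+ 1) → η (+ 3) * t ≈ η (+ 1) → (w * (t * t)) * (η (+ 9) * n) ≈ η (+ 1)
  9-inverse {w} {t} {n} h k = lincomb₂ (η (+ 1)) ((η (+ 3) * t + η (+ 1)) * (w * n))
    (solve 3 (λ w t n → (w :* (t :* t)) :* (con (+ 9) :* n) := con (+ 1) :+ con (+ 1) :* (w :* n :- con (+ 1))
        :+ ((con (+ 3) :* t :+ con (+ 1)) :* (w :* n)) :* (con (+ 3) :* t :- con (+ 1))) refl w t n) h k

  27-inverse : ∀ {w t n} → w * n ≈ η (+ 1) → η (+ 3) * t ≈ η (+ 1) → (w * (t * t * t)) * (η (+ 27) * n) ≈ η (+ 1)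
  27-inverse {w} {t} {n} h k = lincomb₂ (η (+ 1)) ((η (+ 9) * t * t + η (+ 3) * t + η (+ 1)) * (w * n))
    (solve 3 (λ w t n → (w :* (t :* t :* t)) :* (con (+ 27) :* n) := con (+ 1) :+ con (+ 1) :* (w :* n :- con (+ 1))
        :+ ((con (+ 9) :* t :* t :+ con (+ 3) :* t :+ con (+ 1)) :* (w :* n)) :* (con (+ 3) :* t :- con (+ 1))) refl w t n) h k

  module Units {c w t i : Carrier} (wc≈1 : w * (c * c + η (+ 3)) ≈ η (+ 1)) (3t≈1 : η (+ 3) * t ≈ η (+ 1))
      (2ci≈1 : η (+ 2) * c * i ≈ η (+ 1)) where

    9x₁≈4w : η (+ 9) * (η (+ 4) * (w * (t * t))) ≈ η (+ 4) * w
    9x₁≈4w = lincomb₁ (η (+ 4) * w * (η (+ 3) * t + η (+ 1)))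
      (solve 2 (λ w t → con (+ 9) :* (con (+ 4) :* (w :* (t :* t))) := con (+ 4) :* w
          :+ (con (+ 4) :* w :* (con (+ 3) :* t :+ con (+ 1))) :* (con (+ 3) :* t :- con (+ 1))) refl w t) 3t≈1

    27x₂≈4c²w : η (+ 27) * (η (+ 4) * c * c * (w * (t * t * t))) ≈ η (+ 4) * (c * c) * w
    27x₂≈4c²w = lincomb₁ (η (+ 4) * (c * c) * w * (η (+ 9) * t * t + η (+ 3) * t + η (+ 1)))
      (solve 3 (λ c w t → con (+ 27) :* (con (+ 4) :* c :* c :* (w :* (t :* t :* t))) := con (+ 4) :* (c :* c) :* w
          :+ (con (+ 4) :* (c :* c) :* w :* (con (+ 9) :* t :* t :+ con (+ 3) :* t :+ con (+ 1))) :* (con (+ 3) :* t :- con (+ 1))) refl c w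
          t) 3t≈1

    -- Since 2ci = 1, (ci)² stands for 1/4 and the first factor is 9(c²+3)/4. In `a₂x₂≈1`, i² stands
    -- for 1/(4c²).
    a₁x₁≈1 : (c * i * (c * i) * (η (+ 9) * (c * c + η (+ 3)))) * (η (+ 4) * (w * (t * t))) ≈ η (+ 1)
    a₁x₁≈1 = lincomb₃ (η (+ 1)) ((η (+ 3) * t + η (+ 1)) * (w * (c * c + η (+ 3))))
        ((η (+ 2) * c * i + η (+ 1)) * (η (+ 9) * t * t) * (w * (c * c + η (+ 3))))
      (solve 4 (λ c w t i → (c :* i :* (c :* i) :* (con (+ 9) :* (c :* c :+ con (+ 3)))) :* (con (+ 4) :* (w :* (t :* t)))
        := con (+ 1) :+ con (+ 1) :* (w :* (c :* c :+ con (+ 3)) :- con (+ 1)) :+ ((con (+ 3) :* t :+ con (+ 1)) :*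
            (w :* (c :* c :+ con (+ 3)))) :* (con (+ 3) :* t :- con (+ 1))
          :+ ((con (+ 2) :* c :* i :+ con (+ 1)) :* (con (+ 9) :* t :* t) :* (w :* (c :* c :+ con (+ 3)))) :* (con (+ 2) :* c :* i
              :- con (+ 1))) refl c w t i)
      wc≈1 3t≈1 2ci≈1

    a₂x₂≈1 : (i * i * (η (+ 27) * (c * c + η (+ 3)))) * (η (+ 4) * c * c * (w * (t * t * t))) ≈ η (+ 1)
    a₂x₂≈1 = lincomb₃ (η (+ 1)) ((η (+ 9) * t * t + η (+ 3) * t + η (+ 1)) * (w * (c * c + η (+ 3))))
        ((η (+ 2) * c * i + η (+ 1)) * (η (+ 27) * t * t * t) * (w * (c * c + η (+ 3))))
      (solve 4 (λ c w t i → (i :* i :* (con (+ 27) :* (c :* c :+ con (+ 3)))) :* (con (+ 4) :* c :* c :* (w :* (t :* t :* t)))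
        := con (+ 1) :+ con (+ 1) :* (w :* (c :* c :+ con (+ 3)) :- con (+ 1)) :+ ((con (+ 9) :* t :* t :+ con (+ 3) :* t :+ con (+ 1)) :*
            (w :* (c :* c :+ con (+ 3)))) :* (con (+ 3) :* t :- con (+ 1))
          :+ ((con (+ 2) :* c :* i :+ con (+ 1)) :* (con (+ 27) :* t :* t :* t) :* (w :* (c :* c :+ con (+ 3)))) :* (con (+ 2) :* c :* i
              :- con (+ 1))) refl c w t i)
      wc≈1 3t≈1 2ci≈1

module IntegerCongruences (p : ℕ) (p-prime : Prime p) (3<p : 3 ℕ.< p) where
  open Modular p
  open Splitting p p-prime 3<p
  private
    module Z = ℤAlgebra ℤω-algebra
    module R = Residue p (ι (+ p)) (ι (+ 1)) (Z.*-identityʳ (ι (+ p)))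
    module A = ℤAlgebra R.Q

    -- Descent from ℤ[ω]/p to ℤ/p: the real part of a multiple of the rational integer p is a
    -- multiple of p.
    ι-injective : ∀ x y → ι x A.≈ ι y → x ~ y
    ι-injective x y (q , pq≡) = re q , ≡.trans (lemma (+ p) (re q) (im q)) (cong re pq≡)
      where
      lemma : ∀ p a b → p ℤ.* a ≡ p ℤ.* a ℤ.- + 0 ℤ.* b
      lemma = ℤ-Tactic.solve-∀

  module _ (r : ℚ) (c v′ : ℤ) (u~vc : ↥ r ~ + ↧ₙ r ℤ.* c) (v′v~1 : v′ ℤ.* + ↧ₙ r ~ + 1) (w t i : ℤ)
    (wc~1 : w ℤ.* (c ℤ.* c ℤ.+ + 3) ~ + 1) (3t~1 : + 3 ℤ.* t ~ + 1) (2ci~1 : + 2 ℤ.* c ℤ.* i ~ + 1) where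

    private
      ι-≈ : ∀ x y {X Y} → ι x ≡ X → ι y ≡ Y → x ~ y → X A.≈ Y
      ι-≈ x y ≡.refl ≡.refl h = R.ι-cong x y h

      ι-≈⁻¹ : ∀ x y {X Y} → ι x ≡ X → ι y ≡ Y → X A.≈ Y → x ~ y
      ι-≈⁻¹ x y ≡.refl ≡.refl h = ι-injective x y h

      module P = Parameters.Units 𝔽 {c} {w} {t} {i} wc~1 3t~1 2ci~1

      x₁ x₂ a₁ a₂ : ℤ
      x₁ = + 4 ℤ.* (w ℤ.* (t ℤ.* t))
      x₂ = + 4 ℤ.* c ℤ.* c ℤ.* (w ℤ.* (t ℤ.* t ℤ.* t))
      a₁ = c ℤ.* i ℤ.* (c ℤ.* i) ℤ.* (+ 9 ℤ.* (c ℤ.* c ℤ.+ + 3))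
      a₂ = i ℤ.* i ℤ.* (+ 27 ℤ.* (c ℤ.* c ℤ.+ + 3))

      ιp≈0 : ι (+ p) A.≈ ι (+ 0)
      ιp≈0 = Quotient.d~0 ℤω-algebra (ι (+ p))

      wc≈1 : ι w *ω (ι c *ω ι c +ω ι (+ 3)) A.≈ ι (+ 1)
      wc≈1 = ι-≈ (w ℤ.* (c ℤ.* c ℤ.+ + 3)) (+ 1) (≡.trans (Z.η-* w (c ℤ.* c ℤ.+ + 3)) (cong (λ u → ι w *ω (u +ω ι (+ 3))) (Z.η-* c c)))
          ≡.refl wc~1

      3t≈1 : ι (+ 3) *ω ι t A.≈ ι (+ 1)
      3t≈1 = ι-≈ (+ 3 ℤ.* t) (+ 1) (Z.η-* (+ 3) t) ≡.refl 3t~1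

      2ci≈1 : ι (+ 2) *ω ι c *ω ι i A.≈ ι (+ 1)
      2ci≈1 = ι-≈ (+ 2 ℤ.* c ℤ.* i) (+ 1) (≡.trans (Z.η-* (+ 2 ℤ.* c) i) (cong (_*ω ι i) (Z.η-* (+ 2) c))) ≡.refl 2ci~1

      ω-root : A._≈_ (ι (+ 1) +ω ωE +ω AlgebraProperties._^_ R.Q ωE 2) (ι (+ 0))
      ω-root = Quotient.≈⇒~ ℤω-algebra (ι (+ p)) {ι (+ 0)} ≡.refl

      a₁x₁≈1 : ι a₁ *ω ι x₁ A.≈ ι (+ 1)
      a₁x₁≈1 = ι-≈ (a₁ ℤ.* x₁) (+ 1) (Z.η-* a₁ x₁) ≡.refl P.a₁x₁≈1

      9x₁≈4w : ι (+ 9) *ω ι x₁ A.≈ ι (+ 4) *ω ι w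
      9x₁≈4w = ι-≈ (+ 9 ℤ.* x₁) (+ 4 ℤ.* w) (Z.η-* (+ 9) x₁) (Z.η-* (+ 4) w) P.9x₁≈4w

      a₂x₂≈1 : ι a₂ *ω ι x₂ A.≈ ι (+ 1)
      a₂x₂≈1 = ι-≈ (a₂ ℤ.* x₂) (+ 1) (Z.η-* a₂ x₂) ≡.refl P.a₂x₂≈1

      27x₂≈4c²w : ι (+ 27) *ω ι x₂ A.≈ ι (+ 4) *ω (ι c *ω ι c) *ω ι w
      27x₂≈4c²w = ι-≈ (+ 27 ℤ.* x₂) (+ 4 ℤ.* (c ℤ.* c) ℤ.* w) (Z.η-* (+ 27) x₂)
          (≡.trans (Z.η-* (+ 4 ℤ.* (c ℤ.* c)) w) (cong (_*ω ι w) (≡.trans (Z.η-* (+ 4) (c ℤ.* c)) (cong (ι (+ 4) *ω_) (Z.η-* c c)))))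
              P.27x₂≈4c²w

      condition : ∀ j → Cubic3 p r j → Adjunction.CubicCondition R.Q p p-prime 1<p ιp≈0 ωE ω-root c w t i wc≈1 3t≈1 2ci≈1 j
      condition j h with cubic-condition r c v′ u~vc v′v~1 j h
      ... | inj₁ (n , p≡ , d) = inj₁ (n , p≡ ,
        subst₂ (λ u v → ι (+ p) ∣ω (u -ω v)) (R.^ω≡^ (ι c +ω √-3) n) (cong₂ _*ω_ (R.^ω≡^ ωE j) (R.^ω≡^ (ι c -ω √-3) n)) d)
      ... | inj₂ (n , p≡ , d) = inj₂ (n , p≡ ,
        subst₂ (λ u v → ι (+ p) ∣ω (u -ω v)) (R.^ω≡^ (ι c -ω √-3) (suc n)) (cong₂ _*ω_ (R.^ω≡^ ωE j) (R.^ω≡^ (ι c +ω √-3) (suc n))) d)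

      S₂ : ℤ
      S₂ = g x₂ p 0 ℤ.- + 2 ℤ.* g x₂ p 1

      ι-S₂ : ι S₂ ≡ ι (g x₂ p 0) +ω negω (ι (+ 2) *ω ι (g x₂ p 1))
      ι-S₂ = cong (λ u → ι (g x₂ p 0) +ω negω u) (Z.η-* (+ 2) (g x₂ p 1))

    first₀ : Cubic3 p r 0 → g x₁ p 0 ~ + 1
    first₀ h = ι-injective (g x₁ p 0) (+ 1) (Adjunction.FirstSum.value₀ R.Q p p-prime 1<p ιp≈0 ωE ω-root c w t i wc≈1 3t≈1 2ci≈1 x₁ a₁
        a₁x₁≈1 9x₁≈4w (condition 0 h))

    first₁ : Cubic3 p r 1 → g x₁ p 0 ~ (ℤ.- (+ 1 ℤ.+ c)) ℤ.* i
    first₁ h = ι-≈⁻¹ (g x₁ p 0) ((ℤ.- (+ 1 ℤ.+ c)) ℤ.* i) ≡.refl (Z.η-* (ℤ.- (+ 1 ℤ.+ c)) i)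
        (Adjunction.FirstSum.value₁ R.Q p p-prime 1<p ιp≈0 ωE ω-root c w t i wc≈1 3t≈1 2ci≈1 x₁ a₁ a₁x₁≈1 9x₁≈4w (condition 1 h))

    first₂ : Cubic3 p r 2 → g x₁ p 0 ~ (+ 1 ℤ.- c) ℤ.* i
    first₂ h = ι-≈⁻¹ (g x₁ p 0) ((+ 1 ℤ.- c) ℤ.* i) ≡.refl (Z.η-* (+ 1 ℤ.- c) i)
        (Adjunction.FirstSum.value₂ R.Q p p-prime 1<p ιp≈0 ωE ω-root c w t i wc≈1 3t≈1 2ci≈1 x₁ a₁ a₁x₁≈1 9x₁≈4w (condition 2 h))

    second₀ : Cubic3 p r 0 → S₂ ~ + 1
    second₀ h = ι-≈⁻¹ S₂ (+ 1) ι-S₂ ≡.refl (Adjunction.SecondSum.value₀ R.Q p p-prime 1<p ιp≈0 ωE ω-root c w t i wc≈1 3t≈1 2ci≈1 x₂ a₂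
        a₂x₂≈1 27x₂≈4c²w (condition 0 h))

    second₁ : Cubic3 p r 1 → S₂ ~ (ℤ.- (+ 9 ℤ.+ c)) ℤ.* i
    second₁ h = ι-≈⁻¹ S₂ ((ℤ.- (+ 9 ℤ.+ c)) ℤ.* i) ι-S₂ (Z.η-* (ℤ.- (+ 9 ℤ.+ c)) i)
        (Adjunction.SecondSum.value₁ R.Q p p-prime 1<p ιp≈0 ωE ω-root c w t i wc≈1 3t≈1 2ci≈1 x₂ a₂ a₂x₂≈1 27x₂≈4c²w (condition 1 h))

    second₂ : Cubic3 p r 2 → S₂ ~ (+ 9 ℤ.- c) ℤ.* i
    second₂ h = ι-≈⁻¹ S₂ ((+ 9 ℤ.- c) ℤ.* i) ι-S₂ (Z.η-* (+ 9 ℤ.- c) i) (Adjunction.SecondSum.value₂ R.Q p p-prime 1<p ιp≈0 ωE ω-root c w t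
        i wc≈1 3t≈1 2ci≈1 x₂ a₂ a₂x₂≈1 27x₂≈4c²w (condition 2 h))

-- Reduction of rational numbers modulo p

fromℤ-+ : ∀ m n → fromℤ (m ℤ.+ n) ≡ fromℤ m ℚ.+ fromℤ n
fromℤ-+ m n = ℚ.toℚᵘ-injective (ℚᵘ.≃-trans (ℚ.toℚᵘ-fromℚᵘ (mkℚᵘ (m ℤ.+ n) 0)) (ℚᵘ.≃-sym
  (ℚᵘ.≃-trans (ℚ.toℚᵘ-homo-+ (fromℤ m) (fromℤ n)) (ℚᵘ.≃-trans (ℚᵘ.+-cong (ℚ.toℚᵘ-fromℚᵘ (mkℚᵘ m 0)) (ℚ.toℚᵘ-fromℚᵘ (mkℚᵘ n 0)))
      (*≡* (lemma m n))))))
  where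
  lemma : ∀ m n → (m ℤ.* + 1 ℤ.+ n ℤ.* + 1) ℤ.* + 1 ≡ (m ℤ.+ n) ℤ.* (+ 1 ℤ.* + 1)
  lemma = ℤ-Tactic.solve-∀

fromℤ-* : ∀ m n → fromℤ (m ℤ.* n) ≡ fromℤ m ℚ.* fromℤ n
fromℤ-* m n = ℚ.toℚᵘ-injective (ℚᵘ.≃-trans (ℚ.toℚᵘ-fromℚᵘ (mkℚᵘ (m ℤ.* n) 0)) (ℚᵘ.≃-sym
  (ℚᵘ.≃-trans (ℚ.toℚᵘ-homo-* (fromℤ m) (fromℤ n)) (ℚᵘ.≃-trans (ℚᵘ.*-cong (ℚ.toℚᵘ-fromℚᵘ (mkℚᵘ m 0)) (ℚ.toℚᵘ-fromℚᵘ (mkℚᵘ n 0)))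
      (*≡* (lemma m n))))))
  where
  lemma : ∀ m n → m ℤ.* n ℤ.* + 1 ≡ (m ℤ.* n) ℤ.* (+ 1 ℤ.* + 1)
  lemma = ℤ-Tactic.solve-∀

fromℤ-neg : ∀ m → fromℤ (ℤ.- m) ≡ ℚ.- fromℤ m
fromℤ-neg m = ℚ.toℚᵘ-injective (ℚᵘ.≃-trans (ℚ.toℚᵘ-fromℚᵘ (mkℚᵘ (ℤ.- m) 0)) (ℚᵘ.≃-sym
  (ℚᵘ.≃-trans (ℚ.toℚᵘ-homo‿- (fromℤ m)) (ℚᵘ.-‿cong (ℚ.toℚᵘ-fromℚᵘ (mkℚᵘ m 0))))))

fromℤ-injective : ∀ {m n} → fromℤ m ≡ fromℤ n → m ≡ n
fromℤ-injective {m} {n} h with ℚ.fromℚᵘ-injective {mkℚᵘ m 0} {mkℚᵘ n 0} h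
... | *≡* eq = ≡.trans (≡.sym (ℤ.*-identityʳ m)) (≡.trans eq (ℤ.*-identityʳ n))

ℚ-algebra : ℤAlgebra
ℚ-algebra = record
  { commRing = ℚ.+-*-commutativeRing ; η = fromℤ
  ; η-+ = fromℤ-+ ; η-* = fromℤ-* ; η-neg = fromℤ-neg ; η-0 = ≡.refl ; η-1 = ≡.refl }

*-denominator : ∀ r → r ℚ.* fromℤ (↧ r) ≡ fromℤ (↥ r)
*-denominator r@record{} = ℚ.toℚᵘ-injective (ℚᵘ.≃-trans (ℚ.toℚᵘ-homo-* r (fromℤ (↧ r)))
  (ℚᵘ.≃-trans (ℚᵘ.*-congˡ {toℚᵘ r} (ℚ.toℚᵘ-fromℚᵘ (mkℚᵘ (↧ r) 0))) (ℚᵘ.≃-trans (*≡* (lemma (↥ r) (↧ r)))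
      (ℚᵘ.≃-sym (ℚ.toℚᵘ-fromℚᵘ (mkℚᵘ (↥ r) 0))))))
  where
  lemma : ∀ u v → u ℤ.* v ℤ.* + 1 ≡ u ℤ.* (v ℤ.* + 1)
  lemma = ℤ-Tactic.solve-∀

inv-*-cancel : ∀ r → ¬ (↥ r ≡ + 0) → inv r ℚ.* r ≡ 1ℚ
inv-*-cancel (mkℚ (+ zero)   _ _) r≢0 = contradiction ≡.refl r≢0
inv-*-cancel r@(mkℚ +[1+ n ] _ _) _   = ℚ.*-inverseˡ r
inv-*-cancel r@(mkℚ -[1+ n ] _ _) _   = ℚ.*-inverseˡ r

module ReductionAlgebra (K : ℤAlgebra) where
  open ℤAlgebra K
  open AlgebraProperties K

  +-clear : ∀ {r s d e m n} → r * d ≈ m → s * e ≈ n → (r + s) * (d * e) ≈ m * e + n * d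
  +-clear {r} {s} {d} {e} {m} {n} h k = lincomb₂ e d
    (solve 6 (λ r s d e m n → (r :+ s) :* (d :* e) := m :* e :+ n :* d :+ e :* (r :* d :- m) :+ d :* (s :* e :- n)) refl r s d e m n) h k

  *-clear : ∀ {r s d e m n} → r * d ≈ m → s * e ≈ n → (r * s) * (d * e) ≈ m * n
  *-clear {r} {s} {d} {e} {m} {n} h k = trans (solve 4 (λ r s d e → (r :* s) :* (d :* e) := (r :* d) :* (s :* e)) refl r s d e) (*-cong h k)

  neg-clear : ∀ {r d m} → r * d ≈ m → (- r) * d ≈ - m
  neg-clear {r} {d} h = trans (solve 2 (λ r d → (:- r) :* d := :- (r :* d)) refl r d) (-‿cong h)

  inv-clear : ∀ {r s d m} → s * r ≈ 1# → r * d ≈ m → s * m ≈ d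
  inv-clear {r} {s} {d} {m} h k = trans (*-congˡ (sym k)) (trans (sym (*-assoc s r d)) (trans (*-congʳ h) (*-identityˡ d)))

  +-residue : ∀ {m n d e y z} → m ≈ y * d → n ≈ z * e → m * e + n * d ≈ (y + z) * (d * e)
  +-residue {m} {n} {d} {e} {y} {z} h k = trans (+-cong (*-congʳ h) (*-congʳ k))
      (solve 4 (λ d e y z → y :* d :* e :+ z :* e :* d := (y :+ z) :* (d :* e)) refl d e y z)

  *-residue : ∀ {m n d e y z} → m ≈ y * d → n ≈ z * e → m * n ≈ (y * z) * (d * e)
  *-residue {m} {n} {d} {e} {y} {z} h k = trans (*-cong h k) (solve 4 (λ d e y z → (y :* d) :* (z :* e) := (y :* z) :* (d :* e)) refl d e y
      z)

  neg-residue : ∀ {m d y} → m ≈ y * d → - m ≈ (- y) * d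
  neg-residue {m} {d} {y} h = trans (-‿cong h) (solve 2 (λ d y → :- (y :* d) := (:- y) :* d) refl d y)

  inv-residue : ∀ {m d y z} → y * z ≈ η (+ 1) → m ≈ z * d → d ≈ y * m
  inv-residue {m} {d} {y} {z} h k = lincomb₂ (- d) (- y)
    (solve 4 (λ m d y z → d := y :* m :+ (:- d) :* (y :* z :- con (+ 1)) :+ (:- y) :* (m :- z :* d)) refl m d y z) h k

  zero-residue : ∀ {m d y} → y ≈ η (+ 0) → m ≈ y * d → m ≈ η (+ 0)
  zero-residue {m} {d} {y} h k = trans k (trans (*-congʳ h) (solve 1 (λ d → con (+ 0) :* d := con (+ 0)) refl d))

  unit-cancel : ∀ {u v v′} → v′ * v ≈ η (+ 1) → u ≈ v * (v′ * u)
  unit-cancel {u} {v} {v′} h = lincomb₁ (- u) (solve 3 (λ u v w → u := v :* (w :* u) :+ (:- u) :* (w :* v :- con (+ 1))) refl u v v′) h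

module Reduction (p : ℕ) (p-prime : Prime p) where
  open Modular p
  private
    module F = ReductionAlgebra 𝔽
    module 𝔽ₚ = ℤAlgebra 𝔽
    module Q = ReductionAlgebra ℚ-algebra

  p∤1 : ¬ (p ∣ 1)
  p∤1 p∣1 = ¬prime[1] (subst Prime (∣1⇒≡1 p∣1) p-prime)

  p∤* : ∀ {m n} → ¬ (p ∣ ∣ m ∣) → ¬ (p ∣ ∣ n ∣) → ¬ (p ∣ ∣ m ℤ.* n ∣)
  p∤* {m} {n} p∤m p∤n p∣mn = [ p∤m , p∤n ] (euclidsLemma ∣ m ∣ ∣ n ∣ p-prime (subst (p ∣_) (ℤ.abs-* m n) p∣mn))

  -- r lies in D_p and reduces to z modulo p.
  record Reduces (r : ℚ) (z : ℤ) : Set where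
    constructor reduces
    field
      numerator denominator : ℤ
      p∤denominator         : ¬ (p ∣ ∣ denominator ∣)
      clear                 : r ℚ.* fromℤ denominator ≡ fromℤ numerator
      residue               : numerator ~ z ℤ.* denominator

  Reduces-fromℤ : ∀ z → Reduces (fromℤ z) z
  Reduces-fromℤ z = reduces z (+ 1) p∤1 (ℚ.*-identityʳ (fromℤ z)) (≈⇒~ (≡.sym (ℤ.*-identityʳ z)))

  Reduces-+ : ∀ {r s y z} → Reduces r y → Reduces s z → Reduces (r ℚ.+ s) (y ℤ.+ z)
  Reduces-+ {r} {s} {y} {z} (reduces m d p∤d h k) (reduces n e p∤e h′ k′) = reduces (m ℤ.* e ℤ.+ n ℤ.* d) (d ℤ.* e) (p∤* {d} {e} p∤d p∤e)
    (≡.trans (cong ((r ℚ.+ s) ℚ.*_) (fromℤ-* d e)) (≡.trans (Q.+-clear {r} {s} {fromℤ d} {fromℤ e} {fromℤ m} {fromℤ n} h h′)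
      (≡.sym (≡.trans (fromℤ-+ (m ℤ.* e) (n ℤ.* d)) (cong₂ ℚ._+_ (fromℤ-* m e) (fromℤ-* n d))))))
    (F.+-residue {m} {n} {d} {e} {y} {z} k k′)

  Reduces-* : ∀ {r s y z} → Reduces r y → Reduces s z → Reduces (r ℚ.* s) (y ℤ.* z)
  Reduces-* {r} {s} {y} {z} (reduces m d p∤d h k) (reduces n e p∤e h′ k′) = reduces (m ℤ.* n) (d ℤ.* e) (p∤* {d} {e} p∤d p∤e)
    (≡.trans (cong ((r ℚ.* s) ℚ.*_) (fromℤ-* d e)) (≡.trans (Q.*-clear {r} {s} {fromℤ d} {fromℤ e} {fromℤ m} {fromℤ n} h h′)
        (≡.sym (fromℤ-* m n))))
    (F.*-residue {m} {n} {d} {e} {y} {z} k k′)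

  Reduces-neg : ∀ {r z} → Reduces r z → Reduces (ℚ.- r) (ℤ.- z)
  Reduces-neg {r} {z} (reduces m d p∤d h k) = reduces (ℤ.- m) d p∤d
    (≡.trans (Q.neg-clear {r} {fromℤ d} {fromℤ m} h) (≡.sym (fromℤ-neg m))) (F.neg-residue {m} {d} {z} k)

  Reduces-- : ∀ {r s y z} → Reduces r y → Reduces s z → Reduces (r ℚ.- s) (y ℤ.- z)
  Reduces-- {r} {s} {y} {z} h k = Reduces-+ {r} {ℚ.- s} {y} {ℤ.- z} h (Reduces-neg {s} {z} k)

  -- Numerator and denominator change roles. From d ≡ y·m and p not dividing d it follows that p
  -- does not divide m, which makes m a legitimate denominator and keeps r away from the default
  -- value of `inv` at 0.
  Reduces-inv : ∀ {r z} y → y ℤ.* z ~ + 1 → Reduces r z → Reduces (inv r) y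
  Reduces-inv {r} {z} y yz~1 (reduces m d p∤d h k) = reduces d m p∤m
    (Q.inv-clear {r} {inv r} {fromℤ d} {fromℤ m} (inv-*-cancel r r≢0) h) d~ym
    where
    d~ym : d ~ y ℤ.* m
    d~ym = F.inv-residue {m} {d} {y} {z} yz~1 k
    p∤m : ¬ (p ∣ ∣ m ∣)
    p∤m p∣m = p∤d (~0⇒∣ {d} (F.zero-residue {d} {y} {m} (∣⇒~0 {m} p∣m) (𝔽ₚ.trans {d} {y ℤ.* m} {m ℤ.* y} d~ym (𝔽ₚ.*-comm y m))))
    r≢0 : ¬ (↥ r ≡ + 0)
    r≢0 ↥r≡0 = p∤m (subst (λ n → p ∣ ∣ n ∣) (≡.sym m≡0) (divides 0 ≡.refl))
      where
      m≡0 : m ≡ + 0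
      m≡0 = fromℤ-injective {m} {+ 0} (≡.trans (≡.sym h) (≡.trans (cong (ℚ._* fromℤ d) (ℚ.↥p≡0⇒p≡0 r ↥r≡0)) (ℚ.*-zeroˡ (fromℤ d))))

  Reduces-^ : ∀ {r z} → Reduces r z → ∀ k → Reduces (r ^Q k) (z ℤ.^ k)
  Reduces-^ h zero    = Reduces-fromℤ (+ 1)
  Reduces-^ {r} {z} h (suc k) = Reduces-* {r} {r ^Q k} {z} {z ℤ.^ k} h (Reduces-^ h k)

  Reduces-InD : ∀ {r} → InD p r → ∀ v′ → v′ ℤ.* + ↧ₙ r ~ + 1 → ↥ r ~ + ↧ₙ r ℤ.* (v′ ℤ.* ↥ r) × Reduces r (v′ ℤ.* ↥ r)
  Reduces-InD {r} p∤↧r v′ v′v~1 = u~vc , reduces (↥ r) (+ ↧ₙ r) p∤↧r (*-denominator r)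
    (𝔽ₚ.trans {↥ r} {+ ↧ₙ r ℤ.* (v′ ℤ.* ↥ r)} {(v′ ℤ.* ↥ r) ℤ.* + ↧ₙ r} u~vc (𝔽ₚ.*-comm (+ ↧ₙ r) (v′ ℤ.* ↥ r)))
    where
    u~vc : ↥ r ~ + ↧ₙ r ℤ.* (v′ ℤ.* ↥ r)
    u~vc = F.unit-cancel {↥ r} {+ ↧ₙ r} {v′} v′v~1

  -- Here an arbitrary representing fraction m/d is compared with lowest terms: cross-multiplication
  -- gives ↥ r · d = m · ↧ r, p divides m, and Euclid's lemma discards d.
  Reduces-0 : ∀ {r z} → z ~ + 0 → Reduces r z → p ∣ ∣ ↥ r ∣
  Reduces-0 {r} {z} z~0 (reduces m d p∤d h k) = [ (λ p∣u → p∣u) , (λ p∣d → contradiction p∣d p∤d) ]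
      (euclidsLemma ∣ ↥ r ∣ ∣ d ∣ p-prime p∣ud)
    where
    ud≡ : ↥ r ℤ.* d ≡ m ℤ.* ↧ r
    ud≡ = fromℤ-injective {↥ r ℤ.* d} {m ℤ.* ↧ r} (begin
      fromℤ (↥ r ℤ.* d)                        ≡⟨ fromℤ-* (↥ r) d ⟩
      fromℤ (↥ r) ℚ.* fromℤ d                  ≡⟨ cong (ℚ._* fromℤ d) (*-denominator r) ⟨
      r ℚ.* fromℤ (↧ r) ℚ.* fromℤ d            ≡⟨ ℚ.*-assoc r (fromℤ (↧ r)) (fromℤ d) ⟩
      r ℚ.* (fromℤ (↧ r) ℚ.* fromℤ d)          ≡⟨ cong (r ℚ.*_) (ℚ.*-comm (fromℤ (↧ r)) (fromℤ d)) ⟩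
      r ℚ.* (fromℤ d ℚ.* fromℤ (↧ r))          ≡⟨ ℚ.*-assoc r (fromℤ d) (fromℤ (↧ r)) ⟨
      r ℚ.* fromℤ d ℚ.* fromℤ (↧ r)            ≡⟨ cong (ℚ._* fromℤ (↧ r)) h ⟩
      fromℤ m ℚ.* fromℤ (↧ r)                  ≡⟨ fromℤ-* m (↧ r) ⟨
      fromℤ (m ℤ.* ↧ r)                        ∎)
      where open ≡-Reasoning
    p∣ud : p ∣ ∣ ↥ r ∣ ℕ.* ∣ d ∣
    p∣ud = subst (p ∣_) (≡.trans (≡.sym (ℤ.abs-* m (↧ r))) (≡.trans (cong ∣_∣ (≡.sym ud≡)) (ℤ.abs-* (↥ r) d)))
      (∣m⇒∣m*n ∣ ↧ r ∣ (~0⇒∣ {m} (F.zero-residue {m} {d} {z} z~0 k)))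

  Reduces⇒≡ : ∀ {r s y z} → Reduces r y → Reduces s z → y ~ z → r ≡[mod p ] s
  Reduces⇒≡ {r} {s} {y} {z} hr hs y~z = Reduces-0 {r ℚ.- s} {y ℤ.- z} (∣⇒~0 {y ℤ.- z} (~⇒∣ {y} {z} y~z)) (Reduces-- {r} {s} {y} {z} hr hs)

  C[3k,k] : ∀ k → (3 ℕ.* k) C k ≡ (3 ℕ.* k) C (2 ℕ.* k)
  C[3k,k] k = ≡.trans (nCk≡nC[n∸k] (ℕ.m≤m+n k _)) (cong ((3 ℕ.* k) C_) (ℕ.m+n∸m≡n k (2 ℕ.* k)))

  first-sum : ∀ {r x} → Reduces r x → ∀ n → Reduces (sumQ n (λ k → fromℕ ((3 ℕ.* k) C k) ℚ.* (r ^Q k))) (g x n 0)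
  first-sum h zero    = Reduces-fromℤ (+ 0)
  first-sum {r} {x} h (suc n) = Reduces-+ {sumQ n f} {f n} {g x n 0} {term x 0 n} (first-sum h n)
    (subst (Reduces (f n)) eq (Reduces-* {fromℕ ((3 ℕ.* n) C n)} {r ^Q n} {+ ((3 ℕ.* n) C n)} {x ℤ.^ n} (Reduces-fromℤ (+ ((3 ℕ.* n) C n)))
        (Reduces-^ h n)))
    where
    f : ℕ → ℚ
    f k = fromℕ ((3 ℕ.* k) C k) ℚ.* (r ^Q k)
    eq : + ((3 ℕ.* n) C n) ℤ.* x ℤ.^ n ≡ term x 0 n
    eq = ≡.trans (ℤ.*-comm (+ ((3 ℕ.* n) C n)) (x ℤ.^ n)) (cong (λ b → x ℤ.^ n ℤ.* + b)
        (≡.trans (C[3k,k] n) (cong ((3 ℕ.* n) C_) (≡.sym (ℕ.+-identityʳ (2 ℕ.* n))))))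

  -- `C-neighbours` gives (2k+1)B′ = kB, hence (2k+1)(B - 2B′) = B. The integral form is essential:
  -- for k = (p-1)/2 the denominator 2k+1 is p itself, so the defining fraction could not be reduced
  -- modulo p directly.
  C2-integral : ∀ k → C2 k ≡ fromℤ (+ ((3 ℕ.* k) C (2 ℕ.* k)) ℤ.- + 2 ℤ.* + ((3 ℕ.* k) C suc (2 ℕ.* k)))
  C2-integral k = ≡.trans (cong (λ b → (+ b) ℚ./ suc (2 ℕ.* k)) (C[3k,k] k))
    (ℚ.fromℚᵘ-cong {mkℚᵘ (+ B) (2 ℕ.* k)} {mkℚᵘ (+ B ℤ.- + 2 ℤ.* + B′) 0} (*≡* (begin
      + B ℤ.* + 1                                                        ≡⟨ lemma (+ (2 ℕ.* k)) (+ k) (+ B) (+ B′) ⟩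
      (+ B ℤ.- + 2 ℤ.* + B′) ℤ.* (+ 1 ℤ.+ + (2 ℕ.* k)) ℤ.+ (+ 2 ℤ.* ((+ (2 ℕ.* k) ℤ.* + B ℤ.+ (+ 1 ℤ.+ + (2 ℕ.* k)) ℤ.* + B′)
          ℤ.- (+ (2 ℕ.* k) ℤ.+ + k) ℤ.* + B) ℤ.+ (+ 2 ℤ.* + k ℤ.- + (2 ℕ.* k)) ℤ.* + B)
        ≡⟨ cong₂ (λ u v → (+ B ℤ.- + 2 ℤ.* + B′) ℤ.* (+ 1 ℤ.+ + (2 ℕ.* k)) ℤ.+ (+ 2 ℤ.* u ℤ.+ v ℤ.* + B)) (ℤ.i≡j⇒i-j≡0 neighbours)
            (ℤ.i≡j⇒i-j≡0 (≡.sym (ℤ.pos-* 2 k))) ⟩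
      (+ B ℤ.- + 2 ℤ.* + B′) ℤ.* (+ 1 ℤ.+ + (2 ℕ.* k)) ℤ.+ (+ 0 ℤ.+ + 0) ≡⟨ ℤ.+-identityʳ ((+ B ℤ.- + 2 ℤ.* + B′) ℤ.* (+ 1 ℤ.+ + (2 ℕ.* k)))
          ⟩
      (+ B ℤ.- + 2 ℤ.* + B′) ℤ.* + suc (2 ℕ.* k) ∎)))
    where
    open ≡-Reasoning
    B  = (3 ℕ.* k) C (2 ℕ.* k)
    B′ = (3 ℕ.* k) C suc (2 ℕ.* k)
    neighbours : + (2 ℕ.* k) ℤ.* + B ℤ.+ (+ 1 ℤ.+ + (2 ℕ.* k)) ℤ.* + B′ ≡ (+ (2 ℕ.* k) ℤ.+ + k) ℤ.* + B
    neighbours = begin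
      + (2 ℕ.* k) ℤ.* + B ℤ.+ + suc (2 ℕ.* k) ℤ.* + B′ ≡⟨ cong₂ ℤ._+_ (ℤ.pos-* (2 ℕ.* k) B) (ℤ.pos-* (suc (2 ℕ.* k)) B′) ⟨
      + (2 ℕ.* k ℕ.* B ℕ.+ suc (2 ℕ.* k) ℕ.* B′)       ≡⟨ cong +_ (C-neighbours (3 ℕ.* k) (2 ℕ.* k)) ⟩
      + (3 ℕ.* k ℕ.* B)                               ≡⟨ cong (λ n → + (n ℕ.* B)) (3k≡2k+k k) ⟩
      + ((2 ℕ.* k ℕ.+ k) ℕ.* B)                        ≡⟨ ℤ.pos-* (2 ℕ.* k ℕ.+ k) B ⟩
      (+ (2 ℕ.* k) ℤ.+ + k) ℤ.* + B                    ∎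
    lemma : ∀ K k b b′ → b ℤ.* + 1 ≡ (b ℤ.- + 2 ℤ.* b′) ℤ.* (+ 1 ℤ.+ K) ℤ.+ (+ 2 ℤ.* ((K ℤ.* b ℤ.+ (+ 1 ℤ.+ K) ℤ.* b′) ℤ.- (K ℤ.+ k) ℤ.* b)
        ℤ.+ (+ 2 ℤ.* k ℤ.- K) ℤ.* b)
    lemma = ℤ-Tactic.solve-∀

  second-sum : ∀ {r x} → Reduces r x → ∀ n → Reduces (sumQ n (λ k → C2 k ℚ.* (r ^Q k))) (g x n 0 ℤ.- + 2 ℤ.* g x n 1)
  second-sum h zero    = Reduces-fromℤ (+ 0)
  second-sum {r} {x} h (suc n) = subst (Reduces (sumQ n f ℚ.+ f n)) (lemma (g x n 0) (g x n 1) (term x 0 n) (term x 1 n))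
    (Reduces-+ {sumQ n f} {f n} {g x n 0 ℤ.- + 2 ℤ.* g x n 1} {term x 0 n ℤ.- + 2 ℤ.* term x 1 n} (second-sum h n)
      (subst₂ Reduces (cong (ℚ._* (r ^Q n)) (≡.sym (C2-integral n))) eq
        (Reduces-* {fromℤ (+ B ℤ.- + 2 ℤ.* + B′)} {r ^Q n} {+ B ℤ.- + 2 ℤ.* + B′} {x ℤ.^ n} (Reduces-fromℤ (+ B ℤ.- + 2 ℤ.* + B′))
            (Reduces-^ h n))))
    where
    f : ℕ → ℚ
    f k = C2 k ℚ.* (r ^Q k)
    B  = (3 ℕ.* n) C (2 ℕ.* n)
    B′ = (3 ℕ.* n) C suc (2 ℕ.* n)
    lemma′ : ∀ b b′ y → (b ℤ.- + 2 ℤ.* b′) ℤ.* y ≡ y ℤ.* b ℤ.- + 2 ℤ.* (y ℤ.* b′)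
    lemma′ = ℤ-Tactic.solve-∀
    eq : (+ B ℤ.- + 2 ℤ.* + B′) ℤ.* x ℤ.^ n ≡ term x 0 n ℤ.- + 2 ℤ.* term x 1 n
    eq = ≡.trans (lemma′ (+ B) (+ B′) (x ℤ.^ n)) (cong₂ (λ u v → x ℤ.^ n ℤ.* + u ℤ.- + 2 ℤ.* (x ℤ.^ n ℤ.* + v))
      (cong ((3 ℕ.* n) C_) (≡.sym (ℕ.+-identityʳ (2 ℕ.* n)))) (cong ((3 ℕ.* n) C_) (ℕ.+-comm 1 (2 ℕ.* n))))
    lemma : ∀ a b a′ b′ → (a ℤ.- + 2 ℤ.* b) ℤ.+ (a′ ℤ.- + 2 ℤ.* b′) ≡ (a ℤ.+ a′) ℤ.- + 2 ℤ.* (b ℤ.+ b′)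
    lemma = ℤ-Tactic.solve-∀

-- The congruences for rational c

open import Data.Rational using (-_; _+_; _-_; _*_)

module Congruences (p : ℕ) (p-prime : Prime p) (3<p : 3 < p) (c : ℚ) (c∈D : InD p c)
  (c²≢-3 : ¬ ((c * c) ≡[mod p ] (- fromℕ 3))) (c≢0 : ¬ (c ≡[mod p ] 0ℚ)) where
  open Modular p
  open Reduction p p-prime
  private
    module 𝔽ₚ = ℤAlgebra 𝔽

  v′ : ℤ
  v′ = proj₁ (inverse p-prime (+ ↧ₙ c) c∈D)
  v′v~1 : v′ ℤ.* + ↧ₙ c ~ + 1
  v′v~1 = proj₂ (inverse p-prime (+ ↧ₙ c) c∈D)

  c̄ : ℤ
  c̄ = v′ ℤ.* ↥ c
  u~vc : ↥ c ~ + ↧ₙ c ℤ.* c̄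
  u~vc = proj₁ (Reduces-InD {c} c∈D v′ v′v~1)
  c↦c̄ : Reduces c c̄
  c↦c̄ = proj₂ (Reduces-InD {c} c∈D v′ v′v~1)

  n̄ : ℤ
  n̄ = c̄ ℤ.* c̄ ℤ.+ + 3

  n↦n̄ : Reduces (c * c + fromℕ 3) n̄
  n↦n̄ = Reduces-+ {c * c} {fromℕ 3} {c̄ ℤ.* c̄} {+ 3} (Reduces-* {c} {c} {c̄} {c̄} c↦c̄ c↦c̄) (Reduces-fromℤ (+ 3))

  -- `Reduces⇒≡` carries divisibility of the residue back to the excluded congruence in ℚ. In this
  -- way the hypotheses on c provide the inverses of c²+3 and, in `p∤2c̄`, of 2c.
  p∤n̄ : ¬ (p ∣ ∣ n̄ ∣)
  p∤n̄ p∣n̄ = c²≢-3 (Reduces⇒≡ {c * c} { - fromℕ 3} {c̄ ℤ.* c̄} {ℤ.- + 3} (Reduces-* {c} {c} {c̄} {c̄} c↦c̄ c↦c̄) (Reduces-fromℤ (ℤ.- + 3))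
      (∣⇒~ {c̄ ℤ.* c̄} {ℤ.- + 3} p∣n̄))

  p∤2c̄ : ¬ (p ∣ ∣ + 2 ℤ.* c̄ ∣)
  p∤2c̄ = p∤* {+ 2} {c̄} (>⇒∤ {2} (ℕ.<-trans (ℕ.n<1+n 2) 3<p))
    (λ p∣c̄ → c≢0 (Reduces⇒≡ {c} {0ℚ} {c̄} {+ 0} c↦c̄ (Reduces-fromℤ (+ 0)) (∣⇒~0 {c̄} p∣c̄)))

  w t i : ℤ
  w = proj₁ (inverse p-prime n̄ p∤n̄)
  t = proj₁ (inverse p-prime (+ 3) (>⇒∤ {3} 3<p))
  i = proj₁ (inverse p-prime (+ 2 ℤ.* c̄) p∤2c̄)

  wn~1 : w ℤ.* n̄ ~ + 1
  wn~1 = proj₂ (inverse p-prime n̄ p∤n̄)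

  3t~1 : + 3 ℤ.* t ~ + 1
  3t~1 = 𝔽ₚ.trans {+ 3 ℤ.* t} {t ℤ.* + 3} {+ 1} (𝔽ₚ.*-comm (+ 3) t) (proj₂ (inverse p-prime (+ 3) (>⇒∤ {3} 3<p)))

  i2c~1 : i ℤ.* (+ 2 ℤ.* c̄) ~ + 1
  i2c~1 = proj₂ (inverse p-prime (+ 2 ℤ.* c̄) p∤2c̄)

  2ci~1 : + 2 ℤ.* c̄ ℤ.* i ~ + 1
  2ci~1 = 𝔽ₚ.trans {+ 2 ℤ.* c̄ ℤ.* i} {i ℤ.* (+ 2 ℤ.* c̄)} {+ 1} (𝔽ₚ.*-comm (+ 2 ℤ.* c̄) i) i2c~1

  X₁ X₂ I Σ₁ Σ₂ : ℚ
  X₁ = fromℕ 4 * inv (fromℕ 9 * (c * c + fromℕ 3))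
  X₂ = fromℕ 4 * c * c * inv (fromℕ 27 * (c * c + fromℕ 3))
  I  = inv (fromℕ 2 * c)
  Σ₁ = sumQ p (λ k → fromℕ ((3 ℕ.* k) C k) * (X₁ ^Q k))
  Σ₂ = sumQ p (λ k → C2 k * (X₂ ^Q k))

  -- Spelled exactly as in `IntegerCongruences`, so that the congruences proved there apply by
  -- definitional equality; t² and t³ stand for 1/9 and 1/27.
  x₁ x₂ : ℤ
  x₁ = + 4 ℤ.* (w ℤ.* (t ℤ.* t))
  x₂ = + 4 ℤ.* c̄ ℤ.* c̄ ℤ.* (w ℤ.* (t ℤ.* t ℤ.* t))

  X₁↦x₁ : Reduces X₁ x₁
  X₁↦x₁ = Reduces-* {fromℕ 4} {inv (fromℕ 9 * (c * c + fromℕ 3))} {+ 4} {w ℤ.* (t ℤ.* t)} (Reduces-fromℤ (+ 4))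
    (Reduces-inv {fromℕ 9 * (c * c + fromℕ 3)} {+ 9 ℤ.* n̄} (w ℤ.* (t ℤ.* t)) (Parameters.9-inverse 𝔽 {w} {t} {n̄} wn~1 3t~1)
      (Reduces-* {fromℕ 9} {c * c + fromℕ 3} {+ 9} {n̄} (Reduces-fromℤ (+ 9)) n↦n̄))

  X₂↦x₂ : Reduces X₂ x₂
  X₂↦x₂ = Reduces-* {fromℕ 4 * c * c} {inv (fromℕ 27 * (c * c + fromℕ 3))} {+ 4 ℤ.* c̄ ℤ.* c̄} {w ℤ.* (t ℤ.* t ℤ.* t)}
    (Reduces-* {fromℕ 4 * c} {c} {+ 4 ℤ.* c̄} {c̄} (Reduces-* {fromℕ 4} {c} {+ 4} {c̄} (Reduces-fromℤ (+ 4)) c↦c̄) c↦c̄)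
    (Reduces-inv {fromℕ 27 * (c * c + fromℕ 3)} {+ 27 ℤ.* n̄} (w ℤ.* (t ℤ.* t ℤ.* t)) (Parameters.27-inverse 𝔽 {w} {t} {n̄} wn~1 3t~1)
      (Reduces-* {fromℕ 27} {c * c + fromℕ 3} {+ 27} {n̄} (Reduces-fromℤ (+ 27)) n↦n̄))

  I↦i : Reduces I i
  I↦i = Reduces-inv {fromℕ 2 * c} {+ 2 ℤ.* c̄} i i2c~1 (Reduces-* {fromℕ 2} {c} {+ 2} {c̄} (Reduces-fromℤ (+ 2)) c↦c̄)

  Σ₁↦ : Reduces Σ₁ (g x₁ p 0)
  Σ₁↦ = first-sum {X₁} {x₁} X₁↦x₁ p

  Σ₂↦ : Reduces Σ₂ (g x₂ p 0 ℤ.- + 2 ℤ.* g x₂ p 1)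
  Σ₂↦ = second-sum {X₂} {x₂} X₂↦x₂ p

  -[m+c]/2c : ∀ m → Reduces (- ((fromℤ m + c) * I)) (ℤ.- ((m ℤ.+ c̄) ℤ.* i))
  -[m+c]/2c m = Reduces-neg {(fromℤ m + c) * I} {(m ℤ.+ c̄) ℤ.* i} (Reduces-* {fromℤ m + c} {I} {m ℤ.+ c̄} {i}
      (Reduces-+ {fromℤ m} {c} {m} {c̄} (Reduces-fromℤ m) c↦c̄) I↦i)

  [m-c]/2c : ∀ m → Reduces ((fromℤ m - c) * I) ((m ℤ.- c̄) ℤ.* i)
  [m-c]/2c m = Reduces-* {fromℤ m - c} {I} {m ℤ.- c̄} {i} (Reduces-- {fromℤ m} {c} {m} {c̄} (Reduces-fromℤ m) c↦c̄) I↦i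

  neg-* : ∀ {z} m → z ~ (ℤ.- (m ℤ.+ c̄)) ℤ.* i → z ~ ℤ.- ((m ℤ.+ c̄) ℤ.* i)
  neg-* {z} m h = 𝔽ₚ.trans {z} {(ℤ.- (m ℤ.+ c̄)) ℤ.* i} {ℤ.- ((m ℤ.+ c̄) ℤ.* i)} h (≈⇒~ (≡.sym (ℤ.neg-distribˡ-* (m ℤ.+ c̄) i)))

  module IC = IntegerCongruences p p-prime 3<p

  first₀ : Cset 0 p c → Σ₁ ≡[mod p ] 1ℚ
  first₀ (_ , h) = Reduces⇒≡ {Σ₁} {1ℚ} {g x₁ p 0} {+ 1} Σ₁↦ (Reduces-fromℤ (+ 1)) (IC.first₀ c c̄ v′ u~vc v′v~1 w t i wn~1 3t~1 2ci~1 h)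

  first₁ : Cset 1 p c → Σ₁ ≡[mod p ] (- ((1ℚ + c) * I))
  first₁ (_ , h) = Reduces⇒≡ {Σ₁} { - ((1ℚ + c) * I)} {g x₁ p 0} {ℤ.- ((+ 1 ℤ.+ c̄) ℤ.* i)} Σ₁↦ (-[m+c]/2c (+ 1))
    (neg-* {g x₁ p 0} (+ 1) (IC.first₁ c c̄ v′ u~vc v′v~1 w t i wn~1 3t~1 2ci~1 h))

  first₂ : Cset 2 p c → Σ₁ ≡[mod p ] ((1ℚ - c) * I)
  first₂ (_ , h) = Reduces⇒≡ {Σ₁} {(1ℚ - c) * I} {g x₁ p 0} {(+ 1 ℤ.- c̄) ℤ.* i} Σ₁↦ ([m-c]/2c (+ 1))
      (IC.first₂ c c̄ v′ u~vc v′v~1 w t i wn~1 3t~1 2ci~1 h)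

  second₀ : Cset 0 p c → Σ₂ ≡[mod p ] 1ℚ
  second₀ (_ , h) = Reduces⇒≡ {Σ₂} {1ℚ} {g x₂ p 0 ℤ.- + 2 ℤ.* g x₂ p 1} {+ 1} Σ₂↦ (Reduces-fromℤ (+ 1))
      (IC.second₀ c c̄ v′ u~vc v′v~1 w t i wn~1 3t~1 2ci~1 h)

  second₁ : Cset 1 p c → Σ₂ ≡[mod p ] (- ((fromℕ 9 + c) * I))
  second₁ (_ , h) = Reduces⇒≡ {Σ₂} { - ((fromℕ 9 + c) * I)} {g x₂ p 0 ℤ.- + 2 ℤ.* g x₂ p 1} {ℤ.- ((+ 9 ℤ.+ c̄) ℤ.* i)} Σ₂↦ (-[m+c]/2c (+ 9))
    (neg-* {g x₂ p 0 ℤ.- + 2 ℤ.* g x₂ p 1} (+ 9) (IC.second₁ c c̄ v′ u~vc v′v~1 w t i wn~1 3t~1 2ci~1 h))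

  second₂ : Cset 2 p c → Σ₂ ≡[mod p ] ((fromℕ 9 - c) * I)
  second₂ (_ , h) = Reduces⇒≡ {Σ₂} {(fromℕ 9 - c) * I} {g x₂ p 0 ℤ.- + 2 ℤ.* g x₂ p 1} {(+ 9 ℤ.- c̄) ℤ.* i} Σ₂↦ ([m-c]/2c (+ 9))
      (IC.second₂ c c̄ v′ u~vc v′v~1 w t i wn~1 3t~1 2ci~1 h)

theorem26 : (p : ℕ) → Prime p → 3 < p → (c : ℚ) → InD p c
    → ¬ ((c * c) ≡[mod p ] (- fromℕ 3))
    → ¬ (c ≡[mod p ] 0ℚ)
    → ((Cset 0 p c → sumQ p (λ k → fromℕ ((3 ℕ.* k) C k) * ((fromℕ 4 * inv (fromℕ 9 * (c * c + fromℕ 3))) ^Q k)) ≡[mod p ] 1ℚ)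
    × (Cset 1 p c → sumQ p (λ k → fromℕ ((3 ℕ.* k) C k) * ((fromℕ 4 * inv (fromℕ 9 * (c * c + fromℕ 3))) ^Q k)) ≡[mod p ] (- ((1ℚ + c) * inv (fromℕ 2 * c))))
    × (Cset 2 p c → sumQ p (λ k → fromℕ ((3 ℕ.* k) C k) * ((fromℕ 4 * inv (fromℕ 9 * (c * c + fromℕ 3))) ^Q k)) ≡[mod p ] ((1ℚ - c) * inv (fromℕ 2 * c))))
    × ((Cset 0 p c → sumQ p (λ k → C2 k * ((fromℕ 4 * c * c * inv (fromℕ 27 * (c * c + fromℕ 3))) ^Q k)) ≡[mod p ] 1ℚ)
    × (Cset 1 p c → sumQ p (λ k → C2 k * ((fromℕ 4 * c * c * inv (fromℕ 27 * (c * c + fromℕ 3))) ^Q k)) ≡[mod p ] (- ((fromℕ 9 + c) * inv (fromℕ 2 * c))))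
    × (Cset 2 p c → sumQ p (λ k → C2 k * ((fromℕ 4 * c * c * inv (fromℕ 27 * (c * c + fromℕ 3))) ^Q k)) ≡[mod p ] ((fromℕ 9 - c) * inv (fromℕ 2 * c))))
theorem26 p p-prime 3<p c c∈D c²≢-3 c≢0 = (T.first₀ , T.first₁ , T.first₂) , (T.second₀ , T.second₁ , T.second₂)
  where module T = Congruences p p-prime 3<p c c∈D c²≢-3 c≢0
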